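{- (a) Let $T$ be a rooted tree such that the forest $T'$ is a collection of cyclotomic trees and $\nu(T')>2$. Then $T$ is a Salem tree. (If instead $\nu(T')\le2$, then $T$ is a cyclotomic tree.) (b) Let $T_1$ and $T_2$ be rooted trees each of the type in (a) (i.e. $T_i'$ is a collection of cyclotomic trees and $\nu(T_i')>2$), with $(\nu(T_1')-2)(\nu(T_2')-2)\le1$. Then $T_1+T_2$ is a Salem tree. (If $(\nu(T_1')-2)(\nu(T_2')-2)>1$, then the reciprocal polynomial of $T_1+T_2$ has two roots outside the unit circle.) (c) Every Salem tree is, for a suitable choice of root, of the type in (a), or is of the form $T_1+T_2$ as in (b).
   Context: Graphs are finite simple graphs; eigenvalues are those of the adjacency matrix. A graph is cyclotomic if all its eigenvalues lie in $[-2,2]$. A bipartite graph (in particular a tree) is a Salem graph if it has exactly one eigenvalue $\lambda>2$ and only the eigenvalue $-\lambda$ in $(-\infty,-2)$; a Salem tree is a tree that is a Salem graph. For a tree $T$ on $n$ vertices with characteristic polynomial $\chi_T$, $R_T(z)=z^{n/2}\chi_T(\sqrt z+1/\sqrt z)$. A rooted tree has a distinguished vertex $r$; $T'$ is the rooted forest $T-\{r\}$, each component rooted at the vertex adjacent to $r$. The quotient of a rooted tree is $q_T=\prod_iR_{T_i}(z)/R_T(z)$ over the trees $T_i$ of $T'$; the quotient of a rooted forest is the sum of the quotients of its trees. The $\nu$-value of a rooted tree is $\nu(T)=q_T(1)$, with $\nu(T)=\infty$ if $q_T$ has a pole at $1$; for a forest, $\nu$ is the sum of the $\nu$-values of its trees.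 For rooted trees $T_1,T_2$, $T_1+T_2$ is the rooted tree obtained by joining their roots by an edge, rooted at the root of $T_1$. -}

module Defs where

open import Algebra.Bundles using (CommutativeRing)
open import Algebra.Bundles.Raw using (RawRing)
import Algebra.Definitions.RawMonoid as RawMonoidDefs
import Algebra.Definitions.RawSemiring as RawSemiringDefs
open import Data.Bool.Base using (Bool; true; false; _∧_; _∨_; not; if_then_else_)
open import Data.Bool.ListAction using (any)
import Data.Bool.Properties as Bool
open import Data.Fin.Base as Fin using (Fin; zero; suc; toℕ; inject₁; fromℕ; punchIn; splitAt; _↑ˡ_)
import Data.Fin.Properties as Fin
open import Data.Integer.Base as ℤ using (ℤ; +_; +0; +[1+_]; -[1+_])
open import Data.List.Base using (List; []; _∷_; map; foldr; filter; allFin; length; lookup)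
open import Data.List.Membership.Propositional using (_∈_)
open import Data.List.Membership.Propositional.Properties using (∈-filter⁺; ∈-allFin)
open import Data.List.Relation.Unary.All using (All)
open import Data.List.Relation.Unary.Any using (index)
open import Data.Nat.Base as ℕ using (ℕ; zero; suc; _∸_; ⌊_/2⌋)
open import Data.Product.Base using (Σ; ∃-syntax; _×_; _,_)
open import Data.Rational.Base as ℚ using (ℚ; 0ℚ)
open import Data.Sum.Base using (_⊎_; inj₁; inj₂)
open import Function.Base using (_∘_)
open import Function.Bundles using (_↔_; Inverse)
open import Function.Definitions using (Injective)
open import Level using (Level; 0ℓ; _⊔_) renaming (suc to lsuc)
open import Relation.Binary.Construct.Add.Supremum.Strict ℚ._<_ using (_<⁺_)
import Relation.Binary.Construct.StrictToNonStrict as StrictToNonStrict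
open import Relation.Binary.Core using (Rel)
open import Relation.Binary.PropositionalEquality.Core using (_≡_; _≢_; refl)
open import Relation.Binary.Structures using (IsStrictTotalOrder)
open import Relation.Nullary.Construct.Add.Supremum using (_⁺; [_]; ⊤⁺)
open import Relation.Nullary.Decidable using (does; dec-true)
open import Relation.Nullary.Negation.Core using (¬_)

private
  variable
    c ℓ ℓ₁ ℓ₂ : Level

-- The polynomial a₀ + a₁X + … is the list a₀ ∷ a₁ ∷ …; trailing zeros
-- are allowed and are ignored by the equality.

module Coefficients (K : RawRing c ℓ) where
  open RawRing K

  coeff : List Carrier → ℕ → Carrier
  coeff []      _       = 0#
  coeff (a ∷ _) zero    = a
  coeff (_ ∷ p) (suc k) = coeff p k

  eval : List Carrier → Carrier → Carrier
  eval []      _ = 0#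
  eval (a ∷ p) x = a + x * eval p x

  scale : Carrier → List Carrier → List Carrier
  scale a = map (a *_)

  add : List Carrier → List Carrier → List Carrier
  add []      q       = q
  add (a ∷ p) []      = a ∷ p
  add (a ∷ p) (b ∷ q) = a + b ∷ add p q

  mul : List Carrier → List Carrier → List Carrier
  mul []      _ = []
  mul (a ∷ p) q = add (scale a q) (0# ∷ mul p q)

  X : List Carrier
  X = 0# ∷ 1# ∷ []

_[X] : RawRing c ℓ → RawRing c ℓ
K [X] = record
  { Carrier = List Carrier
  ; _≈_     = λ p q → ∀ k → coeff p k ≈ coeff q k
  ; _+_     = add
  ; _*_     = mul
  ; -_      = map -_
  ; 0#      = []
  ; 1#      = 1# ∷ []
  }
  where
  open RawRing K
  open Coefficients K

module Matrices (K : RawRing c ℓ) where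
  open RawRing K
  open RawMonoidDefs +-rawMonoid public using (sum)
  open RawSemiringDefs rawSemiring using (_^_)

  Matrix : ℕ → Set c
  Matrix n = Fin n → Fin n → Carrier

  det : ∀ {n} → Matrix n → Carrier
  det {zero}  M = 1#
  det {suc n} M =
    sum λ j → (- 1#) ^ toℕ j * (M zero j * det λ i k → M (suc i) (punchIn j k))

  scalar : ∀ {n} → Carrier → Matrix n
  scalar x i j = if does (i Fin.≟ j) then x else 0#

record Graph : Set where
  field
    order     : ℕ
    adj       : Fin order → Fin order → Bool
    symmetric : ∀ u v → adj u v ≡ adj v u
    loopless  : ∀ v → adj v v ≡ false

  Vertex : Set
  Vertex = Fin order

  Adj : Rel Vertex 0ℓ
  Adj u v = adj u v ≡ true

  neighbours : Vertex → List Vertex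
  neighbours v = filter (λ u → adj v u Bool.≟ true) (allFin order)

open Graph using (order; Vertex; Adj; neighbours)

record _≅_ (G H : Graph) : Set where
  private
    module G = Graph G
    module H = Graph H
  field
    vertices : G.Vertex ↔ H.Vertex
    preserve : ∀ u v → G.adj u v ≡ H.adj (Inverse.to vertices u) (Inverse.to vertices v)

Bipartite : Graph → Set
Bipartite G = Σ (Vertex G → Bool) λ colour → ∀ u v → Adj G u v → colour u ≢ colour v

data Walk (G : Graph) : Rel (Vertex G) 0ℓ where
  []  : ∀ {v} → Walk G v v
  _∷_ : ∀ {u v w} → Adj G u v → Walk G v w → Walk G u w

record Cycle (G : Graph) : Set where
  field
    {k}      : ℕ
    vertex   : Fin (3 ℕ.+ k) → Vertex G
    distinct : Injective _≡_ _≡_ vertex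
    step     : ∀ i → Adj G (vertex (inject₁ i)) (vertex (suc i))
    close    : Adj G (vertex (fromℕ (2 ℕ.+ k))) (vertex zero)

record IsTree (G : Graph) : Set where
  field
    nonempty  : Vertex G
    connected : ∀ u v → Walk G u v
    acyclic   : ¬ Cycle G

-- Meaningful for duplicate-free lists.

induced : (G : Graph) → List (Vertex G) → Graph
induced G vs = record
  { order     = length vs
  ; adj       = λ i j → G.adj (lookup vs i) (lookup vs j)
  ; symmetric = λ i j → G.symmetric (lookup vs i) (lookup vs j)
  ; loopless  = λ i → G.loopless (lookup vs i)
  }
  where module G = Graph G

record RootedGraph : Set where
  constructor _rootedAt_
  field
    graph : Graph
    root  : Vertex graph

open RootedGraph using (graph; root)

module Branches (T : RootedGraph) where
  open Graph (graph T) using (adj) renaming (order to n; Vertex to V)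

  -- Is there a walk of length at most k from s to v that does not
  -- return to the root?

  reach : ℕ → V → V → Bool
  reach zero    s v = does (s Fin.≟ v)
  reach (suc k) s v = reach k s v ∨
    (any (λ u → reach k s u ∧ adj u v) (allFin n) ∧ not (does (v Fin.≟ root T)))

  reach-refl : ∀ k s → reach k s s ≡ true
  reach-refl zero    s = dec-true (s Fin.≟ s) refl
  reach-refl (suc k) s rewrite reach-refl k s = refl

  component : V → List V
  component s = filter (λ v → reach n s v Bool.≟ true) (allFin n)

  ∈-component : ∀ s → s ∈ component s
  ∈-component s =
    ∈-filter⁺ (λ v → reach n s v Bool.≟ true) (∈-allFin s) (reach-refl n s)

  -- For a neighbour s of the root: the component of s in the graph with
  -- the root deleted, rooted at s.

  branch : V → RootedGraph
  branch s = induced (graph T) (component s) rootedAt index (∈-component s)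

infix 9 _′

_′ : RootedGraph → List RootedGraph
T ′ = map branch (neighbours (graph T) (root T))
  where open Branches T

infixl 6 _+ᵀ_

_+ᵀ_ : RootedGraph → RootedGraph → RootedGraph
(G rootedAt r) +ᵀ (H rootedAt s) = record
  { order     = order G ℕ.+ order H
  ; adj       = λ u v → join (splitAt (order G) u) (splitAt (order G) v)
  ; symmetric = λ u v → join-sym (splitAt (order G) u) (splitAt (order G) v)
  ; loopless  = λ v → join-irr (splitAt (order G) v)
  } rootedAt (r ↑ˡ order H)
  where
  module G = Graph G
  module H = Graph H

  areRoots : G.Vertex → H.Vertex → Bool
  areRoots u v = does (u Fin.≟ r) ∧ does (v Fin.≟ s)

  join : G.Vertex ⊎ H.Vertex → G.Vertex ⊎ H.Vertex → Bool
  join (inj₁ u) (inj₁ v) = G.adj u v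
  join (inj₁ u) (inj₂ v) = areRoots u v
  join (inj₂ u) (inj₁ v) = areRoots v u
  join (inj₂ u) (inj₂ v) = H.adj u v

  join-sym : ∀ x y → join x y ≡ join y x
  join-sym (inj₁ u) (inj₁ v) = G.symmetric u v
  join-sym (inj₁ u) (inj₂ v) = refl
  join-sym (inj₂ u) (inj₁ v) = refl
  join-sym (inj₂ u) (inj₂ v) = H.symmetric u v

  join-irr : ∀ x → join x x ≡ false
  join-irr (inj₁ u) = G.loopless u
  join-irr (inj₂ v) = H.loopless v

adjacency : (K : RawRing c ℓ) (G : Graph) → Matrices.Matrix K (order G)
adjacency K G u v = if Graph.adj G u v then 1# else 0#
  where open RawRing K

ℤ[X] : RawRing 0ℓ 0ℓ
ℤ[X] = ℤ.+-*-rawRing [X]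

open Coefficients ℤ.+-*-rawRing using (coeff; eval; scale; X)

χ : Graph → List ℤ
χ G = det λ u v → scalar X u v + (- adjacency ℤ[X] G u v)
  where
  open RawRing ℤ[X]
  open Matrices ℤ[X]

-- If χ = Σₖ cₖ xᵏ then z^(n/2) χ(√z + 1/√z) = Σₖ cₖ z^((n-k)/2) (z+1)ᵏ.
-- For a bipartite graph cₖ = 0 unless n - k is even, so that rounding
-- the exponent down has no effect; R is meaningful only in this case.

R : Graph → List ℤ
R G = sum λ (k : Fin (suc n)) →
  scale (coeff (χ G) (toℕ k)) (X ^ ⌊ (n ∸ toℕ k) /2⌋ * (1# + X) ^ toℕ k)
  where
  open RawRing ℤ[X]
  open RawSemiringDefs rawSemiring using (_^_)
  open Matrices ℤ[X] using (sum)
  n = order G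

-- The numerator and the denominator of q_T.

quotient : RootedGraph → List ℤ × List ℤ
quotient T = foldr _*_ 1# (map (R ∘ graph) (T ′)) , R (graph T)
  where open RawRing ℤ[X]

-- The quotient of a polynomial on division by X - 1.

deflate : List ℤ → List ℤ
deflate []          = []
deflate (_ ∷ [])    = []
deflate (_ ∷ b ∷ p) = eval (b ∷ p) (+ 1) ∷ deflate (b ∷ p)

-- The value at 1 of the rational function p / q, with ⊤⁺ for a pole.
-- The number k bounds how many common factors X - 1 are cancelled.

valueAtOne : (k : ℕ) (p q : List ℤ) → ℚ ⁺
valueAtOne k p q with eval p (+ 1) | eval q (+ 1)
valueAtOne k       p q | a  | +[1+ b ] = [ a ℚ./ suc b ]
valueAtOne k       p q | a  | -[1+ b ] = [ (ℤ.- a) ℚ./ suc b ]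
valueAtOne (suc k) p q | +0 | +0       = valueAtOne k (deflate p) (deflate q)
valueAtOne _       p q | _  | +0       = ⊤⁺

infixl 6 _+⁺_ _-⁺_
infixl 7 _*⁺_

_+⁺_ : ℚ ⁺ → ℚ ⁺ → ℚ ⁺
[ x ] +⁺ [ y ] = [ x ℚ.+ y ]
[ _ ] +⁺ ⊤⁺    = ⊤⁺
⊤⁺    +⁺ _     = ⊤⁺

_-⁺_ : ℚ ⁺ → ℚ → ℚ ⁺
[ x ] -⁺ y = [ x ℚ.- y ]
⊤⁺    -⁺ _ = ⊤⁺

-- Only used for positive factors.

_*⁺_ : ℚ ⁺ → ℚ ⁺ → ℚ ⁺
[ x ] *⁺ [ y ] = [ x ℚ.* y ]
[ _ ] *⁺ ⊤⁺    = ⊤⁺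
⊤⁺    *⁺ _     = ⊤⁺

-- R_T has degree |T|, so 1 is a root of multiplicity at most |T|.

ν : RootedGraph → ℚ ⁺
ν T = let (p , q) = quotient T in valueAtOne (order (graph T)) p q

νᶠ : List RootedGraph → ℚ ⁺
νᶠ = foldr _+⁺_ [ 0ℚ ] ∘ map ν

2ℚ : ℚ
2ℚ = + 2 ℚ./ 1

excess : RootedGraph → RootedGraph → ℚ ⁺
excess T₁ T₂ = (νᶠ (T₁ ′) -⁺ 2ℚ) *⁺ (νᶠ (T₂ ′) -⁺ 2ℚ)

-- Ordered fields with decidable order in which polynomials satisfy the
-- intermediate value theorem.  Classically ℝ is one; the real algebraic
-- numbers, which contain every eigenvalue of every graph, are one
-- constructively.

record RealClosedField c ℓ₁ ℓ₂ : Set (lsuc (c ⊔ ℓ₁ ⊔ ℓ₂)) where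
  field
    commutativeRing : CommutativeRing c ℓ₁
  open CommutativeRing commutativeRing public
  infix 4 _<_
  field
    _<_                : Rel Carrier ℓ₂
    isStrictTotalOrder : IsStrictTotalOrder _≈_ _<_
    0<1                : 0# < 1#
    +-monoˡ-<          : ∀ z {x y} → x < y → x + z < y + z
    *-pos              : ∀ {x y} → 0# < x → 0# < y → 0# < x * y
    inverse            : ∀ {x} → x ≉ 0# → ∃[ y ] x * y ≈ 1#
  open Coefficients rawRing using () renaming (eval to evaluate)
  field
    ivt : ∀ p {a b} → a < b → evaluate p a < 0# → 0# < evaluate p b →
          ∃[ x ] a < x × x < b × evaluate p x ≈ 0#

module Spectra (ℝ : RealClosedField c ℓ₁ ℓ₂) where
  open RealClosedField ℝ
  open StrictToNonStrict _≈_ _<_ using (_≤_)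
  open RawMonoidDefs +-rawMonoid using (sum) renaming (_×_ to _×ℕ_)

  2ᴿ : Carrier
  2ᴿ = 1# + 1#

  -- A v = x v, where v may be zero.

  InEigenspace : (G : Graph) → Carrier → (Vertex G → Carrier) → Set ℓ₁
  InEigenspace G x v =
    ∀ i → sum (λ j → adjacency rawRing G i j * v j) ≈ x * v i

  IsEigenvector : (G : Graph) → Carrier → (Vertex G → Carrier) → Set ℓ₁
  IsEigenvector G x v = (∃[ i ] v i ≉ 0#) × InEigenspace G x v

  IsEigenvalue : Graph → Carrier → Set (c ⊔ ℓ₁)
  IsEigenvalue G x = ∃[ v ] IsEigenvector G x v

  -- Adjacency matrices are symmetric, so geometric and algebraic
  -- multiplicities agree.

  IsSimpleEigenvalue : Graph → Carrier → Set (c ⊔ ℓ₁)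
  IsSimpleEigenvalue G x = ∃[ v ] IsEigenvector G x v ×
    (∀ w → InEigenspace G x w → ∃[ t ] (∀ i → w i ≈ t * v i))

  -- x is, with multiplicity, the one eigenvalue of G satisfying P.

  IsOnlyEigenvalue : ∀ {p} → Graph → (Carrier → Set p) → Carrier → Set (c ⊔ ℓ₁ ⊔ p)
  IsOnlyEigenvalue G P x =
    P x × IsSimpleEigenvalue G x × (∀ y → IsEigenvalue G y → P y → y ≈ x)

  Cyclotomic : Graph → Set (c ⊔ ℓ₁ ⊔ ℓ₂)
  Cyclotomic G = ∀ x → IsEigenvalue G x → - 2ᴿ ≤ x × x ≤ 2ᴿ

  SalemGraph : Graph → Set (c ⊔ ℓ₁ ⊔ ℓ₂)
  SalemGraph G = Bipartite G ×
    ∃[ x ] IsOnlyEigenvalue G (2ᴿ <_) x × IsOnlyEigenvalue G (_< - 2ᴿ) (- x)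

  CyclotomicTree SalemTree : Graph → Set (c ⊔ ℓ₁ ⊔ ℓ₂)
  CyclotomicTree G = IsTree G × Cyclotomic G
  SalemTree      G = IsTree G × SalemGraph G

  CyclotomicForest : List RootedGraph → Set (c ⊔ ℓ₁ ⊔ ℓ₂)
  CyclotomicForest = All (CyclotomicTree ∘ graph)

  TypeA : RootedGraph → Set (c ⊔ ℓ₁ ⊔ ℓ₂)
  TypeA T = IsTree (graph T) × CyclotomicForest (T ′) × [ 2ℚ ] <⁺ νᶠ (T ′)

  ℂ : RawRing c ℓ₁
  ℂ = record
    { Carrier = Carrier × Carrier
    ; _≈_     = λ (a , b) (a′ , b′) → a ≈ a′ × b ≈ b′
    ; _+_     = λ (a , b) (a′ , b′) → a + a′ , b + b′
    ; _*_     = λ (a , b) (a′ , b′) → a * a′ - b * b′ , a * b′ + b * a′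
    ; -_      = λ (a , b) → - a , - b
    ; 0#      = 0# , 0#
    ; 1#      = 1# , 0#
    }

  private
    module ℂ = RawRing ℂ
    module ℂ[X] = RawRing (ℂ [X])

  fromℤ : ℤ → ℂ.Carrier
  fromℤ (+ n)    = n ×ℕ 1# , 0#
  fromℤ -[1+ n ] = - (suc n ×ℕ 1#) , 0#

  OutsideUnitCircle : ℂ.Carrier → Set ℓ₂
  OutsideUnitCircle (a , b) = 1# < a * a + b * b

  X-_ : ℂ.Carrier → ℂ[X].Carrier
  X- z = ℂ.- z ∷ ℂ.1# ∷ []

  -- Exactly two, counted with multiplicity, and distinct.

  TwoRootsOutsideUnitCircle : List ℤ → Set (c ⊔ ℓ₁ ⊔ ℓ₂)
  TwoRootsOutsideUnitCircle p = ∃[ a ] ∃[ b ] ∃[ s ]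
    a ℂ.≉ b × OutsideUnitCircle a × OutsideUnitCircle b ×
    map fromℤ p ℂ[X].≈ (X- a) ℂ[X].* (X- b) ℂ[X].* s ×
    (∀ z → Coefficients.eval ℂ s z ℂ.≈ ℂ.0# → ¬ OutsideUnitCircle z)

{-# OPTIONS --safe #-}

-- Eliminate the vertices of a rooted tree from the leaves. The pivot at v is
-- a(v) = x − Σ 1/a(c), summed over the children c of v, and the product of
-- all pivots is the characteristic polynomial. As long as the pivots below v
-- are positive, a(v) is an increasing function of x; hence a tree has an
-- eigenvalue above x exactly if some pivot fails to be positive there, and
-- if the branches are cyclotomic, the sign of a(r) = 2 − ν at x = 2 decides (a).
--
-- The eigenvalues of T₁ + T₂ above 2 are the solutions of a(r₁) a(r₂) = 1.
-- Both factors increase, so there is one solution with both positive and at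
-- most one with both negative, which exists exactly if the product at 2,
-- (ν₁ − 2)(ν₂ − 2), exceeds 1. Roots of R are translated by
-- R(s²) = sⁿ χ(s + 1/s): for Im x > 0 every pivot has positive imaginary
-- part, so the roots outside the unit circle come from real x > 2, and they
-- are simple since P′ F − P F′ > 0 for P the characteristic polynomial of
-- the tree and F that of the tree without its root.
--
-- For (c), walk from any vertex into a branch with an eigenvalue above 2.
-- The walk ends at a root as in (a) or at an edge as in (b), unless some
-- vertex has two such branches. Then, with that vertex as the root, F has
-- two zeros in (2 , λ), where λ is the largest eigenvalue. If P had no zero
-- there, P′ F − P F′ > 0 would make F cross zero in the same direction
-- twice in a row; so P has a second zero above 2.

module Submission where

open import Defs
open import Algebra.Bundles using (AbelianGroup; CommutativeMonoid; CommutativeRing)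
open import Algebra.Bundles.Raw using (RawRing)
import Algebra.Construct.DirectProduct as DirectProduct
import Algebra.Definitions.RawMonoid as RawMonoidDefs
import Algebra.Definitions.RawSemiring as RawSemiringDefs
import Algebra.Properties.CommutativeMonoid.Sum as MonoidSum
import Algebra.Properties.CommutativeSemiring.Exp as CommutativeExp
import Algebra.Properties.Ring as RingProperties
import Algebra.Properties.Semiring.Exp as SemiringExp
import Algebra.Properties.Semiring.Mult as SemiringMult
import Algebra.Properties.Semiring.Mult.TCOptimised as OptimisedMult
import Algebra.Properties.Semiring.Sum as SemiringSum
import Algebra.Solver.Ring as RingSolver
open import Algebra.Solver.Ring.AlmostCommutativeRing using (fromCommutativeRing; _-Raw-AlmostCommutative⟶_)
open import Data.Bool.Base using (Bool; true; false; _∧_; not; if_then_else_)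
open import Data.Bool.ListAction using (any)
import Data.Bool.Properties as Bool
open import Data.Empty using (⊥; ⊥-elim)
open import Data.Fin.Base as Fin using (Fin; zero; suc; toℕ; punchIn; splitAt; _↑ˡ_; _↑ʳ_; inject₁; fromℕ)
open import Data.Fin.Permutation using (Permutation; _⟨$⟩ʳ_; ↔⇒≡)
import Data.Fin.Properties as Fin
open import Data.Fin.Relation.Unary.Top using (View; view; ‵fromℕ; ‵inject₁)
open import Data.Integer.Base as ℤ using (ℤ; +_; +0; +[1+_]; -[1+_])
import Data.Integer.GCD as ℤ
import Data.Integer.Properties as ℤ
open import Data.List.Base using (List; []; _∷_; map; foldr; length; allFin; lookup)
open import Data.List.Membership.Propositional using (_∈_; _∉_)
import Data.List.Membership.Propositional.Properties as ∈
import Data.List.Properties as List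
open import Data.List.Relation.Binary.Pointwise.Base using (Pointwise; []; _∷_)
open import Data.List.Relation.Unary.All as All using (All; []; _∷_)
open import Data.List.Relation.Unary.AllPairs using ([]; _∷_)
open import Data.List.Relation.Unary.Any as Any using (Any; here; there)
open import Data.List.Relation.Unary.Any.Properties using (lookup-index)
open import Data.List.Relation.Unary.Unique.Propositional using (Unique)
import Data.List.Relation.Unary.Unique.Propositional.Properties as Unique
open import Data.Maybe.Base using (Maybe; just; nothing)
open import Data.Nat.Base as ℕ using (ℕ; zero; suc; _∸_; ⌊_/2⌋)
import Data.Nat.Properties as ℕ
import Data.Nat.Solver as NatSolver
open import Data.Product.Base using (∃-syntax; _×_; _,_; proj₁; proj₂)
open import Data.Rational.Base as ℚ using (ℚ; 0ℚ; 1ℚ; ↥_; ↧_; ↧ₙ_)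
import Data.Rational.Properties as ℚ
open import Data.Sum.Base as Sum using (_⊎_; inj₁; inj₂)
open import Data.Sum.Function.Propositional using (_⊎-↔_)
open import Data.Unit.Polymorphic.Base using (⊤; tt)
open import Function.Base using (_∘_; id)
open import Function.Bundles using (_↔_; mk↔ₛ′; Inverse)
import Function.Construct.Composition as Composition
import Function.Construct.Symmetry as Symmetry
open import Level using (_⊔_)
open import Relation.Binary.Construct.Add.Supremum.NonStrict ℚ._≤_ using (_≤⁺_; [_]; [≤]-injective)
open import Relation.Binary.Construct.Add.Supremum.Strict ℚ._<_ using (_<⁺_; [_]; [_]<⊤⁺; [<]-injective)
open import Relation.Binary.Construct.Closure.ReflexiveTransitive as Star using (Star; ε; _◅_; _◅◅_)
import Relation.Binary.Construct.StrictToNonStrict as StrictToNonStrict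
open import Relation.Binary.Definitions using (tri<; tri≈; tri>)
open import Relation.Binary.PropositionalEquality as ≡ using (_≡_; _≢_)
import Relation.Binary.Reasoning.Setoid as SetoidReasoning
open import Relation.Binary.Structures using (IsStrictTotalOrder)
open import Relation.Nullary.Construct.Add.Supremum using (_⁺; [_]; ⊤⁺)
open import Relation.Nullary.Decidable using (Dec; yes; no; does; dec-true; dec-false)
open import Relation.Nullary.Negation.Core using (¬_; contradiction)

-- Outside the elimination the pivots a = `P` / `F` appear multiplied out, as relations between
-- values of `P` and `F`. The elimination divides by pivots, so χ = `P` is first known only beyond
-- the largest eigenvalue. Comparing integer coefficients then carries it to every commutative ring,
-- in particular to the complex and the dual numbers.
--
-- Attaching a branch and joining two roots are one operation `_⊕_`. So (a), (b) and the rerooting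
-- in (c) share one recursion, and moving the root along an edge exchanges the two arguments.
--
-- The field offers a decidable order and the intermediate value theorem for polynomials, and no
-- other analysis. Right continuity, the vanishing of a polynomial with too many zeros and the
-- impossibility of two consecutive ascending zeros all come from dividing out a root and induction
-- on the degree. Derivatives are coefficients of ε in dual numbers.
--
-- A term of `Tree` orders its branches and a graph does not, so two terms for one graph are
-- compared by way of the eigenvectors of the graph.

module Integers {κ ℓ} (K : CommutativeRing κ ℓ) where
  open CommutativeRing K hiding (zero)
  open SemiringMult semiring using (×1-homo-*) renaming (_×_ to _·_; ×-homo-+ to ·-homo-+)
  open OptimisedMult semiring using () renaming (_×_ to _·′_; ×ᵤ≈× to ·≈·′)
  open RingProperties ring
  open SetoidReasoning setoid

  ι : ℤ → Carrier
  ι (+ n)    = n · 1#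
  ι -[1+ n ] = - (suc n · 1#)

  private
    ι-⊖ : ∀ m n → ι (m ℤ.⊖ n) ≈ m · 1# - n · 1#
    ι-⊖ m       zero    = sym (trans (+-congˡ -0#≈0#) (+-identityʳ _))
    ι-⊖ zero    (suc n) = sym (+-identityˡ _)
    ι-⊖ (suc m) (suc n) = begin
      ι (suc m ℤ.⊖ suc n)              ≡⟨ ≡.cong ι (ℤ.[1+m]⊖[1+n]≡m⊖n m n) ⟩
      ι (m ℤ.⊖ n)                      ≈⟨ ι-⊖ m n ⟩
      a - b                            ≈⟨ +-congʳ (+-identityʳ a) ⟨
      a + 0# - b                       ≈⟨ +-congʳ (+-congˡ (-‿inverseʳ 1#)) ⟨
      a + (1# - 1#) - b                ≈⟨ +-congʳ (+-assoc a 1# _) ⟨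
      a + 1# - 1# - b                  ≈⟨ +-assoc _ _ _ ⟩
      a + 1# + (- 1# - b)              ≈⟨ +-cong (+-comm a 1#) (-‿+-comm 1# b) ⟩
      suc m · 1# - suc n · 1#          ∎
      where
      a = m · 1#
      b = n · 1#

  ι-neg : ∀ i → ι (ℤ.- i) ≈ - ι i
  ι-neg +0       = sym -0#≈0#
  ι-neg +[1+ n ] = refl
  ι-neg -[1+ n ] = sym (-‿involutive _)

  ι-+ : ∀ i j → ι (i ℤ.+ j) ≈ ι i + ι j
  ι-+ (+ m)    (+ n)    = ·-homo-+ 1# m n
  ι-+ (+ m)    -[1+ n ] = ι-⊖ m (suc n)
  ι-+ -[1+ m ] (+ n)    = trans (ι-⊖ n (suc m)) (+-comm _ _)
  ι-+ -[1+ m ] -[1+ n ] = begin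
    - (suc (suc (m ℕ.+ n)) · 1#)       ≡⟨ ≡.cong (λ k → - (suc k · 1#)) (ℕ.+-suc m n) ⟨
    - ((suc m ℕ.+ suc n) · 1#)         ≈⟨ -‿cong (·-homo-+ 1# (suc m) (suc n)) ⟩
    - (suc m · 1# + suc n · 1#)        ≈⟨ -‿+-comm _ _ ⟨
    - (suc m · 1#) - suc n · 1#        ∎

  private
    ι-*⁺ : ∀ i n → ι (i ℤ.* + n) ≈ ι i * ι (+ n)
    ι-*⁺ (+ m) n = begin
      ι (+ m ℤ.* + n)                    ≡⟨ ≡.cong ι (ℤ.pos-* m n) ⟨
      (m ℕ.* n) · 1#                     ≈⟨ ×1-homo-* m n ⟩
      ι (+ m) * ι (+ n)                  ∎
    ι-*⁺ -[1+ m ] n = begin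
      ι (-[1+ m ] ℤ.* + n)               ≡⟨ ≡.cong ι (ℤ.neg-distribˡ-* +[1+ m ] (+ n)) ⟨
      ι (ℤ.- (+[1+ m ] ℤ.* + n))         ≈⟨ ι-neg (+[1+ m ] ℤ.* + n) ⟩
      - ι (+[1+ m ] ℤ.* + n)             ≈⟨ -‿cong (ι-*⁺ +[1+ m ] n) ⟩
      - (ι +[1+ m ] * ι (+ n))           ≈⟨ -‿distribˡ-* _ _ ⟩
      ι -[1+ m ] * ι (+ n)               ∎
  ι-* : ∀ i j → ι (i ℤ.* j) ≈ ι i * ι j
  ι-* i (+ n)    = ι-*⁺ i n
  ι-* i -[1+ n ] = begin
    ι (i ℤ.* -[1+ n ])                 ≡⟨ ≡.cong ι (ℤ.neg-distribʳ-* i +[1+ n ]) ⟨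
    ι (ℤ.- (i ℤ.* +[1+ n ]))           ≈⟨ ι-neg (i ℤ.* +[1+ n ]) ⟩
    - ι (i ℤ.* +[1+ n ])               ≈⟨ -‿cong (ι-*⁺ i (suc n)) ⟩
    - (ι i * ι +[1+ n ])               ≈⟨ -‿distribʳ-* _ _ ⟩
    ι i * ι -[1+ n ]                   ∎

  ι-1 : ι (+ 1) ≈ 1#
  ι-1 = +-identityʳ 1#

  -- For the solver: unlike ι, this sends 1 to 1# and 2 to 1# + 1# on the nose.

  ι′ : ℤ → Carrier
  ι′ (+ n)    = n ·′ 1#
  ι′ -[1+ n ] = - (suc n ·′ 1#)

  private
    ι≈ι′ : ∀ i → ι i ≈ ι′ i
    ι≈ι′ (+ n)    = ·≈·′ n 1#
    ι≈ι′ -[1+ n ] = -‿cong (·≈·′ (suc n) 1#)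

  ℤ⟶K : ℤ.+-*-rawRing -Raw-AlmostCommutative⟶ fromCommutativeRing K
  ℤ⟶K = record
    { ⟦_⟧    = ι′
    ; +-homo = λ i j → trans (sym (ι≈ι′ (i ℤ.+ j))) (trans (ι-+ i j) (+-cong (ι≈ι′ i) (ι≈ι′ j)))
    ; *-homo = λ i j → trans (sym (ι≈ι′ (i ℤ.* j))) (trans (ι-* i j) (*-cong (ι≈ι′ i) (ι≈ι′ j)))
    ; -‿homo = λ i → trans (sym (ι≈ι′ (ℤ.- i))) (trans (ι-neg i) (-‿cong (ι≈ι′ i)))
    ; 0-homo = refl
    ; 1-homo = refl
    }

  private
    decide : ∀ i j → Maybe (ι′ i ≈ ι′ j)
    decide i j with i ℤ.≟ j
    ... | yes i≡j = just (reflexive (≡.cong ι′ i≡j))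
    ... | no _    = nothing

  open RingSolver ℤ.+-*-rawRing (fromCommutativeRing K) ℤ⟶K decide public
    using (solve; _:=_; _:+_; _:*_; _:-_; :-_; con)

-- Determinants by row operations and triangular matrices.

module Determinants {κ ℓ} (K : CommutativeRing κ ℓ) where
  open CommutativeRing K hiding (zero)
  open Integers K
  open Matrices rawRing
  open RawSemiringDefs (RawRing.rawSemiring rawRing) using (_^_)
  open SemiringSum semiring
    using (sum-cong-≋; *-distribˡ-sum; *-distribʳ-sum; ∑-distrib-+; ∑-comm; sum-remove; sum-replicate-zero)
  open SetoidReasoning setoid

  sum-zero : ∀ {n} (f : Fin n → Carrier) → (∀ i → f i ≈ 0#) → sum f ≈ 0#
  sum-zero {n} f f≈0 = trans (sum-cong-≋ f≈0) (sum-replicate-zero n)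

  sum-single : ∀ {n} (f : Fin n → Carrier) u → (∀ w → w ≢ u → f w ≈ 0#) → sum f ≈ f u
  sum-single {suc n} f u f≈0 = begin
    sum f                            ≈⟨ sum-remove f ⟩
    f u + sum (f ∘ punchIn u)        ≈⟨ +-congˡ (sum-zero (f ∘ punchIn u) (λ i → f≈0 _ (Fin.punchInᵢ≢i u i))) ⟩
    f u + 0#                         ≈⟨ +-identityʳ _ ⟩
    f u                              ∎

  sgn : ∀ {n} → Fin n → Carrier
  sgn j = (- 1#) ^ toℕ j

  minor : ∀ {n} → Fin (suc n) → Matrix (suc n) → Matrix n
  minor j M i k = M (suc i) (punchIn j k)

  det-cong : ∀ {n} {M N : Matrix n} → (∀ i j → M i j ≈ N i j) → det M ≈ det N
  det-cong {zero}  M≈N = refl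
  det-cong {suc n} M≈N = sum-cong-≋ λ j →
    *-congˡ {sgn j} (*-cong (M≈N zero j) (det-cong λ i k → M≈N (suc i) (punchIn j k)))

  -- Recursive in the row index, so that row zero is left alone by computation and minors reduce
  -- through `set-map`.
  set : ∀ {a} {A : Set a} {m} → Fin m → A → (Fin m → A) → Fin m → A
  set zero    v M zero    = v
  set zero    v M (suc i) = M (suc i)
  set (suc u) v M zero    = M zero
  set (suc u) v M (suc i) = set u v (M ∘ suc) i

  set-map : ∀ {a b} {A : Set a} {B : Set b} {m} (f : A → B) (u : Fin m) v M i →
            f (set u v M i) ≡ set u (f v) (f ∘ M) i
  set-map f zero    v M zero    = ≡.refl
  set-map f zero    v M (suc i) = ≡.refl
  set-map f (suc u) v M zero    = ≡.refl
  set-map f (suc u) v M (suc i) = set-map f u v (M ∘ suc) i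

  set-same : ∀ {a} {A : Set a} {m} (u : Fin m) (v : A) M → set u v M u ≡ v
  set-same zero    v M = ≡.refl
  set-same (suc u) v M = set-same u v (M ∘ suc)

  set-other : ∀ {a} {A : Set a} {m} (u : Fin m) (v : A) M i → i ≢ u → set u v M i ≡ M i
  set-other zero    v M zero    i≢u = contradiction ≡.refl i≢u
  set-other zero    v M (suc i) i≢u = ≡.refl
  set-other (suc u) v M zero    i≢u = ≡.refl
  set-other (suc u) v M (suc i) i≢u = set-other u v (M ∘ suc) i (i≢u ∘ ≡.cong suc)

  -- Stated for a combination of m vectors: later `V` is the family of rows of `M` itself, and m = 2
  -- gives additivity.
  det-linear : ∀ {n m} (M : Matrix n) (u : Fin n) (a : Fin m → Carrier) (V : Fin m → Fin n → Carrier) →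
    det (set u (λ k → sum λ w → a w * V w k) M) ≈ sum λ w → a w * det (set u (V w) M)
  det-linear {suc n} M zero a V = begin
    sum (λ j → sgn j * (sum (λ w → a w * V w j) * D j))
      ≈⟨ sum-cong-≋ (λ j → trans (*-congˡ (*-distribʳ-sum (D j) (λ w → a w * V w j))) (*-distribˡ-sum (sgn j) (λ w → a w * V w j * D j))) ⟩
    sum (λ j → sum λ w → sgn j * (a w * V w j * D j))
      ≈⟨ sum-cong-≋ (λ j → sum-cong-≋ λ w → solve 4 (λ s x v d → s :* (x :* v :* d) := x :* (s :* (v :* d))) refl (sgn j) (a w) (V w j) (D j)) ⟩
    sum (λ j → sum λ w → a w * (sgn j * (V w j * D j)))
      ≈⟨ ∑-comm (λ j w → a w * (sgn j * (V w j * D j))) ⟩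
    sum (λ w → sum λ j → a w * (sgn j * (V w j * D j)))
      ≈⟨ sum-cong-≋ (λ w → sym (*-distribˡ-sum (a w) (λ j → sgn j * (V w j * D j)))) ⟩
    sum (λ w → a w * sum (λ j → sgn j * (V w j * D j))) ∎
    where
    D : Fin (suc n) → Carrier
    D j = det (minor j M)
  det-linear {suc n} M (suc u) a V = begin
    sum (λ j → sgn j * (M zero j * det (minor j (set (suc u) (λ k → sum λ w → a w * V w k) M))))
      ≈⟨ sum-cong-≋ (λ j → *-congˡ {sgn j} (*-congˡ {M zero j} (trans
           (det-cong λ i k → reflexive (≡.cong (λ f → f k) (set-map (_∘ punchIn j) u (λ k → sum λ w → a w * V w k) (M ∘ suc) i)))
           (det-linear (minor j M) u a (λ w → V w ∘ punchIn j))))) ⟩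
    sum (λ j → sgn j * (M zero j * sum (λ w → a w * det (set u (V w ∘ punchIn j) (minor j M)))))
      ≈⟨ sum-cong-≋ (λ j → *-congˡ {sgn j} (*-congˡ {M zero j} (sum-cong-≋ λ w → *-congˡ {a w}
           (det-cong λ i k → reflexive (≡.sym (≡.cong (λ f → f k) (set-map (_∘ punchIn j) u (V w) (M ∘ suc) i))))))) ⟩
    sum (λ j → sgn j * (M zero j * sum (λ w → a w * D w j)))
      ≈⟨ sum-cong-≋ (λ j → trans (*-congˡ (*-distribˡ-sum (M zero j) (λ w → a w * D w j))) (*-distribˡ-sum (sgn j) (λ w → M zero j * (a w * D w j)))) ⟩
    sum (λ j → sum λ w → sgn j * (M zero j * (a w * D w j)))
      ≈⟨ sum-cong-≋ (λ j → sum-cong-≋ λ w → solve 4 (λ s x v d → s :* (v :* (x :* d)) := x :* (s :* (v :* d))) refl (sgn j) (a w) (M zero j) (D w j)) ⟩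
    sum (λ j → sum λ w → a w * (sgn j * (M zero j * D w j)))
      ≈⟨ ∑-comm (λ j w → a w * (sgn j * (M zero j * D w j))) ⟩
    sum (λ w → sum λ j → a w * (sgn j * (M zero j * D w j)))
      ≈⟨ sum-cong-≋ (λ w → sym (*-distribˡ-sum (a w) (λ j → sgn j * (M zero j * D w j)))) ⟩
    sum (λ w → a w * sum (λ j → sgn j * (M zero j * D w j))) ∎
    where
    D = λ w j → det (minor j (set (suc u) (V w) M))

  det-+ : ∀ {n} (M : Matrix n) u a b → det (set u (λ k → a k + b k) M) ≈ det (set u a M) + det (set u b M)
  det-+ {n} M u a b = begin
    det (set u (λ k → a k + b k) M)                   ≈⟨ det-cong set-cong ⟩
    det (set u (λ k → sum λ w → 1# * V w k) M)        ≈⟨ det-linear M u (λ _ → 1#) V ⟩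
    1# * det (set u a M) + (1# * det (set u b M) + 0#)
      ≈⟨ solve 2 (λ x y → con (+ 1) :* x :+ (con (+ 1) :* y :+ con (+ 0)) := x :+ y) refl _ _ ⟩
    det (set u a M) + det (set u b M)                 ∎
    where
    V : Fin 2 → Fin n → Carrier
    V zero    = a
    V (suc _) = b
    set-cong : ∀ i k → set u (λ k → a k + b k) M i k ≈ set u (λ k → sum λ w → 1# * V w k) M i k
    set-cong i k with i Fin.≟ u
    ... | yes ≡.refl = begin
      set u (λ k → a k + b k) M u k              ≡⟨ ≡.cong (λ f → f k) (set-same u _ M) ⟩
      a k + b k                                  ≈⟨ solve 2 (λ x y → con (+ 1) :* x :+ (con (+ 1) :* y :+ con (+ 0)) := x :+ y) refl _ _ ⟨
      (sum λ w → 1# * V w k)                     ≡⟨ ≡.cong (λ f → f k) (set-same u _ M) ⟨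
      set u (λ k → sum λ w → 1# * V w k) M u k   ∎
    ... | no i≢u = reflexive (≡.cong (λ f → f k) (≡.trans (set-other u _ M i i≢u) (≡.sym (set-other u _ M i i≢u))))

  private
    lift : ∀ {m n} → (Fin m → Fin n) → Fin (suc m) → Fin (suc n)
    lift g zero    = zero
    lift g (suc i) = suc (g i)

    lift-cong : ∀ {m n} {f g : Fin m → Fin n} → (∀ i → f i ≡ g i) → ∀ i → lift f i ≡ lift g i
    lift-cong f≗g zero    = ≡.refl
    lift-cong f≗g (suc i) = ≡.cong suc (f≗g i)

  -- Double Laplace expansion along two equal rows: the pairs (j , k) and (k , j) of columns cancel.

  double-expansion : ∀ n (u : Fin (2 ℕ.+ n) → Carrier) (E : (Fin n → Fin (2 ℕ.+ n)) → Carrier) →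
    (∀ {f g} → (∀ i → f i ≡ g i) → E f ≈ E g) →
    sum (λ j → sum λ k → (sgn j * sgn k) * (u j * u (punchIn j k)) * E (punchIn j ∘ punchIn k)) ≈ 0#
  double-expansion n u E E-cong = begin
    sum (c zero) + sum (λ j → c (suc j) zero + sum (c′ n u E j))
      ≈⟨ +-congˡ (∑-distrib-+ (λ j → c (suc j) zero) (λ j → sum (c′ n u E j))) ⟩
    sum (c zero) + (sum (λ j → c (suc j) zero) + sum (λ j → sum (c′ n u E j)))
      ≈⟨ +-assoc _ _ _ ⟨
    sum (c zero) + sum (λ j → c (suc j) zero) + sum (λ j → sum (c′ n u E j))
      ≈⟨ +-cong (trans (sym (∑-distrib-+ (c zero) (λ j → c (suc j) zero))) (sum-zero (λ k → c zero k + c (suc k) zero) cancel)) (rest n u E E-cong) ⟩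
    0# + 0#
      ≈⟨ +-identityˡ 0# ⟩
    0# ∎
    where
    c : Fin (2 ℕ.+ n) → Fin (suc n) → Carrier
    c j k = (sgn j * sgn k) * (u j * u (punchIn j k)) * E (punchIn j ∘ punchIn k)
    c′ : ∀ n (u : Fin (2 ℕ.+ n) → Carrier) (E : (Fin n → Fin (2 ℕ.+ n)) → Carrier) → Fin (suc n) → Fin n → Carrier
    c′ n u E j k = (sgn (suc j) * sgn (suc k)) * (u (suc j) * u (suc (punchIn j k))) * E (punchIn (suc j) ∘ punchIn (suc k))
    cancel : ∀ k → c zero k + c (suc k) zero ≈ 0#
    cancel k = trans
      (+-congˡ (*-congˡ (E-cong {punchIn (suc k) ∘ suc} {suc ∘ punchIn k} λ _ → ≡.refl)))
      (solve 4 (λ s x y e → con (+ 1) :* s :* (x :* y) :* e :+ (:- con (+ 1) :* s) :* con (+ 1) :* (y :* x) :* e := con (+ 0))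
        refl (sgn k) (u zero) (u (suc k)) (E (suc ∘ punchIn k)))
    rest : ∀ n (u : Fin (2 ℕ.+ n) → Carrier) (E : (Fin n → Fin (2 ℕ.+ n)) → Carrier) →
      (∀ {f g} → (∀ i → f i ≡ g i) → E f ≈ E g) → sum (λ j → sum (c′ n u E j)) ≈ 0#
    rest zero    u E E-cong = sum-zero {1} (λ _ → 0#) λ _ → refl
    rest (suc n) u E E-cong = trans
      (sum-cong-≋ λ j → sum-cong-≋ λ k → *-cong
        (*-congʳ {u (suc j) * u (suc (punchIn j k))} (solve 2 (λ s t → (:- con (+ 1) :* s) :* (:- con (+ 1) :* t) := s :* t) refl (sgn j) (sgn k)))
        (E-cong {punchIn (suc j) ∘ punchIn (suc k)} {lift (punchIn j ∘ punchIn k)} λ { zero → ≡.refl ; (suc i) → ≡.refl }))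
      (double-expansion n (u ∘ suc) (E ∘ lift) (E-cong ∘ lift-cong))

  det-equal-rows₀₁ : ∀ {n} (M : Matrix (2 ℕ.+ n)) → (∀ k → M zero k ≈ M (suc zero) k) → det M ≈ 0#
  det-equal-rows₀₁ {n} M M₀≈M₁ = trans
    (sum-cong-≋ λ j → begin
      sgn j * (M zero j * sum (λ k → sgn k * (M (suc zero) (punchIn j k) * D j k)))
        ≈⟨ *-assoc _ _ _ ⟨
      sgn j * M zero j * sum (λ k → sgn k * (M (suc zero) (punchIn j k) * D j k))
        ≈⟨ *-distribˡ-sum (sgn j * M zero j) (λ k → sgn k * (M (suc zero) (punchIn j k) * D j k)) ⟩
      sum (λ k → sgn j * M zero j * (sgn k * (M (suc zero) (punchIn j k) * D j k)))
        ≈⟨ sum-cong-≋ (λ k → trans (*-congˡ {sgn j * M zero j} (*-congˡ {sgn k} (*-congʳ {D j k} (sym (M₀≈M₁ (punchIn j k))))))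
             (solve 5 (λ s t x y d → s :* x :* (t :* (y :* d)) := s :* t :* (x :* y) :* d) refl (sgn j) (sgn k) (M zero j) (M zero (punchIn j k)) (D j k))) ⟩
      sum (λ k → (sgn j * sgn k) * (M zero j * M zero (punchIn j k)) * D j k) ∎)
    (double-expansion n (M zero) E λ {f} {g} f≗g → det-cong λ i l → reflexive (≡.cong (M (suc (suc i))) (f≗g l)))
    where
    E : (Fin n → Fin (2 ℕ.+ n)) → Carrier
    E g = det λ i l → M (suc (suc i)) (g l)
    D : Fin (2 ℕ.+ n) → Fin (suc n) → Carrier
    D j k = E (punchIn j ∘ punchIn k)

  private
    Alternating : ℕ → Set _
    Alternating n = (M : Matrix n) (i j : Fin n) → i ≢ j → (∀ k → M i k ≈ M j k) → det M ≈ 0#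

    -- Polarisation: with the sum of the two rows in both places the determinant vanishes. It
    -- expands into four terms, and the two with a repeated row vanish as well.
    antisymmetric : ∀ {n} → Alternating n → (M : Matrix n) (i j : Fin n) → i ≢ j →
      det M + det (set i (M j) (set j (M i) M)) ≈ 0#
    antisymmetric {n} alternating M i j i≢j = begin
      det M + det (at (M j) (M i))
        ≈⟨ +-congʳ (det-cong unchanged) ⟩
      det (at (M i) (M j)) + det (at (M j) (M i))
        ≈⟨ solve 2 (λ x y → x :+ y := (con (+ 0) :+ x) :+ (y :+ con (+ 0))) refl _ _ ⟩
      (0# + det (at (M i) (M j))) + (det (at (M j) (M i)) + 0#)
        ≈⟨ +-cong (+-congʳ (sym (vanishes (M i)))) (+-congˡ (sym (vanishes (M j)))) ⟩
      (det (at (M i) (M i)) + det (at (M i) (M j))) + (det (at (M j) (M i)) + det (at (M j) (M j)))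
        ≈⟨ +-cong (sym (additiveʳ (M i) (M i) (M j))) (sym (additiveʳ (M j) (M i) (M j))) ⟩
      det (at (M i) s) + det (at (M j) s)
        ≈⟨ det-+ (set j s M) i (M i) (M j) ⟨
      det (at s s)
        ≈⟨ vanishes s ⟩
      0# ∎
      where
      s : Fin n → Carrier
      s k = M i k + M j k
      at : (a b : Fin n → Carrier) → Matrix n
      at a b = set i a (set j b M)
      at-i : ∀ a b → at a b i ≡ a
      at-i a b = set-same i a _
      at-j : ∀ a b → at a b j ≡ b
      at-j a b = ≡.trans (set-other i a _ j (i≢j ∘ ≡.sym)) (set-same j b M)
      at-other : ∀ a b k → k ≢ i → k ≢ j → at a b k ≡ M k
      at-other a b k k≢i k≢j = ≡.trans (set-other i a _ k k≢i) (set-other j b M k k≢j)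
      vanishes : ∀ a → det (at a a) ≈ 0#
      vanishes a = alternating (at a a) i j i≢j λ k → reflexive (≡.cong (λ f → f k) (≡.trans (at-i a a) (≡.sym (at-j a a))))
      swapped : ∀ a b k → at a b k ≡ set j b (set i a M) k
      swapped a b k with k Fin.≟ i | k Fin.≟ j
      ... | yes ≡.refl | _ = ≡.trans (at-i a b) (≡.sym (≡.trans (set-other j b _ k i≢j) (set-same k a M)))
      ... | no _ | yes ≡.refl = ≡.trans (at-j a b) (≡.sym (set-same k b _))
      ... | no k≢i | no k≢j = ≡.trans (at-other a b k k≢i k≢j)
              (≡.sym (≡.trans (set-other j b _ k k≢j) (set-other i a M k k≢i)))
      unchanged : ∀ k l → M k l ≈ at (M i) (M j) k l
      unchanged k l with k Fin.≟ i | k Fin.≟ j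
      ... | yes ≡.refl | _ = reflexive (≡.cong (λ f → f l) (≡.sym (at-i (M k) (M j))))
      ... | no _ | yes ≡.refl = reflexive (≡.cong (λ f → f l) (≡.sym (at-j (M i) (M k))))
      ... | no k≢i | no k≢j = reflexive (≡.cong (λ f → f l) (≡.sym (at-other (M i) (M j) k k≢i k≢j)))
      additiveʳ : ∀ a b b′ → det (at a (λ k → b k + b′ k)) ≈ det (at a b) + det (at a b′)
      additiveʳ a b b′ = begin
        det (at a (λ k → b k + b′ k))                     ≈⟨ det-cong (λ k l → reflexive (≡.cong (λ f → f l) (swapped a _ k))) ⟩
        det (set j (λ k → b k + b′ k) (set i a M))        ≈⟨ det-+ (set i a M) j b b′ ⟩
        det (set j b (set i a M)) + det (set j b′ (set i a M))
          ≈⟨ +-cong (det-cong λ k l → reflexive (≡.cong (λ f → f l) (swapped a b k)))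
                    (det-cong λ k l → reflexive (≡.cong (λ f → f l) (swapped a b′ k))) ⟨
        det (at a b) + det (at a b′)                      ∎

  private
    -- `M*` exchanges row one with the row that equals row zero, so its determinant vanishes. In the
    -- expansions along row zero, the minors of `M` and `M*` cancel in pairs by antisymmetry in the
    -- smaller size.
    equal-to-first : ∀ {n} → Alternating n → (M : Matrix (suc n)) (j : Fin n) → (∀ k → M zero k ≈ M (suc j) k) → det M ≈ 0#
    equal-to-first {suc n} alternating M zero eq = det-equal-rows₀₁ M eq
    equal-to-first {suc n} alternating M (suc j) eq = begin
      det M           ≈⟨ +-identityʳ _ ⟨
      det M + 0#      ≈⟨ +-congˡ (det-equal-rows₀₁ M* eq) ⟨
      det M + det M*  ≈⟨ ∑-distrib-+ (λ k → sgn k * (M zero k * det (minor k M))) (λ k → sgn k * (M zero k * det (minor k M*))) ⟨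
      sum (λ k → sgn k * (M zero k * det (minor k M)) + sgn k * (M zero k * det (minor k M*)))
        ≈⟨ sum-zero (λ k → sgn k * (M zero k * det (minor k M)) + sgn k * (M zero k * det (minor k M*))) (λ k → trans
             (solve 4 (λ s a x y → s :* (a :* x) :+ s :* (a :* y) := s :* a :* (x :+ y)) refl (sgn k) (M zero k) (det (minor k M)) (det (minor k M*)))
             (trans (*-congˡ (cancel k)) (zeroʳ _))) ⟩
      0# ∎
      where
      M* : Matrix (2 ℕ.+ n)
      M* zero    = M zero
      M* (suc i) = set zero (M (suc (suc j))) (set (suc j) (M (suc zero)) (M ∘ suc)) i
      cancel : ∀ k → det (minor k M) + det (minor k M*) ≈ 0#
      cancel k = trans
        (+-congˡ (det-cong {M = minor k M*} {N = set zero (minor k M (suc j)) (set (suc j) (minor k M zero) (minor k M))} λ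
          { zero    l → refl
          ; (suc i) l → reflexive (≡.cong (λ f → f l) (set-map (_∘ punchIn k) j _ _ i)) }))
        (antisymmetric alternating (minor k M) zero (suc j) λ ())

  det-alternating : ∀ n → Alternating n
  det-alternating (suc n) M zero zero i≢j eq = contradiction ≡.refl i≢j
  det-alternating (suc n) M zero (suc j) i≢j eq = equal-to-first (det-alternating n) M j eq
  det-alternating (suc n) M (suc i) zero i≢j eq = equal-to-first (det-alternating n) M i (sym ∘ eq)
  det-alternating (suc n) M (suc i) (suc j) i≢j eq = sum-zero (λ k → sgn k * (M zero k * det (minor k M))) λ k → trans
    (*-congˡ (trans (*-congˡ (det-alternating n (minor k M) i j (i≢j ∘ ≡.cong suc) (eq ∘ punchIn k))) (zeroʳ _)))
    (zeroʳ _)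

  det-row-combination : ∀ {n} (M : Matrix n) u (a : Fin n → Carrier) →
    det (set u (λ k → sum λ w → a w * M w k) M) ≈ a u * det M
  det-row-combination M u a = begin
    det (set u (λ k → sum λ w → a w * M w k) M)        ≈⟨ det-linear M u a M ⟩
    sum (λ w → a w * det (set u (M w) M))              ≈⟨ sum-single _ u (λ w w≢u → trans (*-congˡ (vanishes w w≢u)) (zeroʳ _)) ⟩
    a u * det (set u (M u) M)                          ≈⟨ *-congˡ (det-cong same) ⟩
    a u * det M                                        ∎
    where
    vanishes : ∀ w → w ≢ u → det (set u (M w) M) ≈ 0#
    vanishes w w≢u = det-alternating _ _ u w (w≢u ∘ ≡.sym) λ k → reflexive (≡.cong (λ f → f k)
      (≡.trans (set-same u (M w) M) (≡.sym (set-other u (M w) M w w≢u))))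
    same : ∀ i k → set u (M u) M i k ≈ M i k
    same i k with i Fin.≟ u
    ... | yes ≡.refl = reflexive (≡.cong (λ f → f k) (set-same u (M u) M))
    ... | no i≢u     = reflexive (≡.cong (λ f → f k) (set-other u (M u) M i i≢u))

  module _ {n} (h : Fin n → ℕ) (h-injective : ∀ {i j} → h i ≡ h j → i ≡ j) (b : ℕ) (h<b : ∀ i → h i ℕ.< b) where

    -- Instead of multiplicativity of the determinant: the rows of `N` are replaced by those of `M`
    -- in increasing order of `h`. When the turn of u comes, row u of `C` involves only rows that
    -- are not yet replaced, so the replacement is a row combination with coefficient 1.
    det-unitriangular : (M N C : Matrix n) → (∀ u → C u u ≈ 1#) → (∀ u w → u ≢ w → ¬ h u ℕ.< h w → C u w ≈ 0#) →
      (∀ u k → M u k ≈ sum λ w → C u w * N w k) → det M ≈ det N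
    det-unitriangular M N C C-diagonal C-triangular M≈CN = trans (det-cong λ i k → sym (mix-done i k)) (unmix b)
      where
      mix : ℕ → Matrix n
      mix m i = if does (h i ℕ.<? m) then M i else N i
      mix-M : ∀ m i → h i ℕ.< m → mix m i ≡ M i
      mix-M m i hi<m rewrite dec-true (h i ℕ.<? m) hi<m = ≡.refl
      mix-N : ∀ m i → ¬ h i ℕ.< m → mix m i ≡ N i
      mix-N m i hi≮m rewrite dec-false (h i ℕ.<? m) hi≮m = ≡.refl
      mix-suc : ∀ m i → h i ≢ m → mix (suc m) i ≡ mix m i
      mix-suc m i hi≢m with ℕ.<-cmp (h i) m
      ... | tri< hi<m _ _ = ≡.trans (mix-M (suc m) i (ℕ.m≤n⇒m≤1+n hi<m)) (≡.sym (mix-M m i hi<m))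
      ... | tri≈ _ hi≡m _ = contradiction hi≡m hi≢m
      ... | tri> _ _ m<hi = ≡.trans (mix-N (suc m) i (ℕ.≤⇒≯ m<hi)) (≡.sym (mix-N m i (ℕ.<⇒≯ m<hi)))
      mix-done : ∀ i k → mix b i k ≈ M i k
      mix-done i k = reflexive (≡.cong (λ f → f k) (mix-M b i (h<b i)))
      step : ∀ m u → h u ≡ m → det (mix (suc m)) ≈ det (mix m)
      step m u ≡.refl = begin
        det (mix (suc m))                                          ≈⟨ det-cong replaced ⟩
        det (set u (λ k → sum λ w → C u w * mix m w k) (mix m))    ≈⟨ det-row-combination (mix m) u (C u) ⟩
        C u u * det (mix m)                                        ≈⟨ *-congʳ (C-diagonal u) ⟩
        1# * det (mix m)                                           ≈⟨ *-identityˡ _ ⟩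
        det (mix m)                                                ∎
        where
        entry : ∀ w k → C u w * N w k ≈ C u w * mix m w k
        entry w k with h w ℕ.<? h u
        ... | no hw≮hu = *-congˡ (reflexive (≡.cong (λ f → f k) (≡.sym (mix-N (h u) w hw≮hu))))
        ... | yes hw<hu = trans (*-congʳ C≈0) (trans (zeroˡ _) (sym (trans (*-congʳ C≈0) (zeroˡ _))))
          where
          C≈0 : C u w ≈ 0#
          C≈0 = C-triangular u w (λ u≡w → ℕ.<⇒≢ hw<hu (≡.cong h (≡.sym u≡w))) (ℕ.<⇒≯ hw<hu)
        replaced : ∀ i k → mix (suc m) i k ≈ set u (λ k → sum λ w → C u w * mix m w k) (mix m) i k
        replaced i k with i Fin.≟ u
        ... | yes ≡.refl = begin
          mix (suc m) u k                   ≡⟨ ≡.cong (λ f → f k) (mix-M (suc m) u ℕ.≤-refl) ⟩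
          M u k                             ≈⟨ M≈CN u k ⟩
          (sum λ w → C u w * N w k)         ≈⟨ sum-cong-≋ (λ w → entry w k) ⟩
          (sum λ w → C u w * mix m w k)     ≡⟨ ≡.cong (λ f → f k) (set-same u _ (mix m)) ⟨
          set u (λ k → sum λ w → C u w * mix m w k) (mix m) u k ∎
        ... | no i≢u = reflexive (≡.cong (λ f → f k) (≡.trans (mix-suc m i (i≢u ∘ h-injective)) (≡.sym (set-other u _ (mix m) i i≢u))))
      unmix : ∀ m → det (mix m) ≈ det N
      unmix zero    = det-cong λ i k → reflexive (≡.cong (λ f → f k) (mix-N zero i λ ()))
      unmix (suc m) with Fin.any? (λ i → h i ℕ.≟ m)
      ... | no none = trans (det-cong λ i k → reflexive (≡.cong (λ f → f k) (mix-suc m i λ hi≡m → none (i , hi≡m)))) (unmix m)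
      ... | yes (u , hu≡m) = trans (step m u hu≡m) (unmix m)

  private
    module ℕΣ = MonoidSum ℕ.+-0-commutativeMonoid

  -- Since Σ r < Σ s, every permutation π has some i with r i < s (π i), so every term of the
  -- Leibniz formula contains a zero entry. The induction finds it row by row: either the entry
  -- vanishes or the minor is still unbalanced.
  det-unbalanced : ∀ {n} (M : Matrix n) (r s : Fin n → ℕ) → (∀ i j → r i ℕ.< s j → M i j ≈ 0#) →
    ℕΣ.sum r ℕ.< ℕΣ.sum s → det M ≈ 0#
  det-unbalanced {zero}  M r s M≈0 ()
  det-unbalanced {suc n} M r s M≈0 Σr<Σs = sum-zero (λ j → sgn j * (M zero j * det (minor j M))) λ j → trans (*-congˡ (term j)) (zeroʳ _)
    where
    term : ∀ j → M zero j * det (minor j M) ≈ 0#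
    term j with r zero ℕ.<? s j
    ... | yes r₀<sj = trans (*-congʳ (M≈0 zero j r₀<sj)) (zeroˡ _)
    ... | no r₀≮sj = trans (*-congˡ (det-unbalanced (minor j M) (r ∘ suc) (s ∘ punchIn j) (λ i k → M≈0 (suc i) (punchIn j k))
        (ℕ.+-cancelˡ-< (s j) _ _ (ℕ.≤-<-trans (ℕ.+-monoˡ-≤ _ (ℕ.≮⇒≥ r₀≮sj)) (≡.subst (ℕΣ.sum r ℕ.<_) (ℕΣ.sum-remove {i = j} s) Σr<Σs)))))
      (zeroʳ _)

  open RawMonoidDefs (RawRing.*-rawMonoid rawRing) using () renaming (sum to product)

  -- Triangular for `h`, which need not follow the index order. A nonzero entry of row zero off the
  -- diagonal sits in a column with smaller `h`. Deleting that row and column leaves columns of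
  -- larger total `h` than rows, and `det-unbalanced` kills the minor.
  det-triangular : ∀ {n} (M : Matrix n) (h : Fin n → ℕ) → (∀ i j → i ≢ j → ¬ h j ℕ.< h i → M i j ≈ 0#) →
    det M ≈ product λ i → M i i
  det-triangular {zero}  M h M≈0 = refl
  det-triangular {suc n} M h M≈0 = begin
    sum (λ j → sgn j * (M zero j * det (minor j M)))   ≈⟨ sum-single _ zero off-diagonal ⟩
    1# * (M zero zero * det (minor zero M))            ≈⟨ *-identityˡ _ ⟩
    M zero zero * det (minor zero M)                   ≈⟨ *-congˡ (det-triangular (minor zero M) (h ∘ suc) (λ i j i≢j → M≈0 (suc i) (suc j) (i≢j ∘ Fin.suc-injective))) ⟩
    M zero zero * product (λ i → M (suc i) (suc i))    ∎
    where
    off-diagonal : ∀ j → j ≢ zero → sgn j * (M zero j * det (minor j M)) ≈ 0#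
    off-diagonal j j≢0 = trans (*-congˡ (term (h j ℕ.<? h zero))) (zeroʳ _)
      where
      minor-entry : ∀ i k → h (suc i) ℕ.< h (punchIn j k) → minor j M i k ≈ 0#
      minor-entry i k lt = M≈0 (suc i) (punchIn j k) (λ eq → ℕ.<⇒≢ lt (≡.cong h eq)) (ℕ.<⇒≯ lt)
      Σ-drop : h j ℕ.< h zero → ℕΣ.sum (h ∘ suc) ℕ.< ℕΣ.sum (h ∘ punchIn j)
      Σ-drop hj<h₀ = ℕ.+-cancelˡ-< (h j) _ _
        (≡.subst (h j ℕ.+ ℕΣ.sum (h ∘ suc) ℕ.<_) (ℕΣ.sum-remove {i = j} h) (ℕ.+-monoˡ-< _ hj<h₀))
      term : Dec (h j ℕ.< h zero) → M zero j * det (minor j M) ≈ 0#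
      term (yes hj<h₀) = trans (*-congˡ (det-unbalanced (minor j M) (h ∘ suc) (h ∘ punchIn j) minor-entry (Σ-drop hj<h₀))) (zeroʳ _)
      term (no hj≮h₀)  = trans (*-congʳ (M≈0 zero j (j≢0 ∘ ≡.sym) hj≮h₀)) (zeroˡ _)

-- Homomorphisms, evaluation and division of polynomials.

-- The source is a raw ring, so that `A [X]` qualifies without proofs of its ring laws.
record Hom {a ℓᵃ κ ℓ} (A : RawRing a ℓᵃ) (K : CommutativeRing κ ℓ) : Set (a ⊔ ℓᵃ ⊔ κ ⊔ ℓ) where
  private
    module A = RawRing A
    module K = CommutativeRing K
  field
    ⟦_⟧    : A.Carrier → K.Carrier
    cong   : ∀ {x y} → x A.≈ y → ⟦ x ⟧ K.≈ ⟦ y ⟧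
    +-homo : ∀ x y → ⟦ x A.+ y ⟧ K.≈ ⟦ x ⟧ K.+ ⟦ y ⟧
    *-homo : ∀ x y → ⟦ x A.* y ⟧ K.≈ ⟦ x ⟧ K.* ⟦ y ⟧
    -‿homo : ∀ x → ⟦ A.- x ⟧ K.≈ K.- ⟦ x ⟧
    0-homo : ⟦ A.0# ⟧ K.≈ K.0#
    1-homo : ⟦ A.1# ⟧ K.≈ K.1#

identity : ∀ {κ ℓ} (K : CommutativeRing κ ℓ) → Hom (CommutativeRing.rawRing K) K
identity K = record
  { ⟦_⟧ = id ; cong = id ; +-homo = λ _ _ → refl ; *-homo = λ _ _ → refl
  ; -‿homo = λ _ → refl ; 0-homo = refl ; 1-homo = refl }
  where open CommutativeRing K

fromIntegers : ∀ {κ ℓ} (K : CommutativeRing κ ℓ) → Hom ℤ.+-*-rawRing K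
fromIntegers K = record
  { ⟦_⟧ = ι ; cong = λ i≡j → reflexive (≡.cong ι i≡j) ; +-homo = ι-+ ; *-homo = ι-*
  ; -‿homo = ι-neg ; 0-homo = refl ; 1-homo = ι-1 }
  where
  open CommutativeRing K
  open Integers K

module Division {a ℓᵃ} (A : RawRing a ℓᵃ) where
  open RawRing A
  open Coefficients A

  -- Horner's scheme: the quotient on division by X - a, whose remainder is the value at a.
  quot : Carrier → List Carrier → List Carrier
  quot a []            = []
  quot a (b ∷ [])      = []
  quot a (b ∷ p@(_ ∷ _)) = eval p a ∷ quot a p

  length-quot : ∀ p a → length (quot a p) ≡ ℕ.pred (length p)
  length-quot []              a = ≡.refl
  length-quot (b ∷ [])        a = ≡.refl
  length-quot (b ∷ p@(_ ∷ _)) a = ≡.cong suc (length-quot p a)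

module Evaluation {a ℓᵃ κ ℓ} {A : RawRing a ℓᵃ} {K : CommutativeRing κ ℓ} (φ : Hom A K) where
  private
    module A = RawRing A
    module φ = Hom φ
  open CommutativeRing K hiding (zero)
  open Integers K
  open Coefficients A
  open Division A
  open SetoidReasoning setoid

  ev : List A.Carrier → Carrier → Carrier
  ev []      x = 0#
  ev (a ∷ p) x = φ.⟦ a ⟧ + x * ev p x

  eval-map : ∀ p x → Coefficients.eval rawRing (map φ.⟦_⟧ p) x ≡ ev p x
  eval-map []      x = ≡.refl
  eval-map (a ∷ p) x = ≡.cong (λ y → φ.⟦ a ⟧ + x * y) (eval-map p x)

  ev-cong₂ : ∀ p {x y} → x ≈ y → ev p x ≈ ev p y
  ev-cong₂ []      x≈y = refl
  ev-cong₂ (a ∷ p) x≈y = +-congˡ (*-cong x≈y (ev-cong₂ p x≈y))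

  ev-zero : ∀ p x → (∀ k → coeff p k A.≈ A.0#) → ev p x ≈ 0#
  ev-zero []      x p≈0 = refl
  ev-zero (a ∷ p) x p≈0 = trans (+-cong (trans (φ.cong (p≈0 zero)) φ.0-homo) (*-congˡ (ev-zero p x (p≈0 ∘ suc))))
    (solve 1 (λ x → con +0 :+ x :* con +0 := con +0) refl x)

  private
    ev-[] : ∀ q x → (∀ k → A.0# A.≈ coeff q k) → 0# ≈ ev q x
    ev-[] []      x eq = refl
    ev-[] (b ∷ q) x eq = begin
      0#                        ≈⟨ solve 1 (λ x → con +0 :+ x :* con +0 := con +0) refl x ⟨
      0# + x * 0#               ≈⟨ +-cong (trans (sym φ.0-homo) (φ.cong (eq zero))) (*-congˡ (ev-[] q x (eq ∘ suc))) ⟩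
      φ.⟦ b ⟧ + x * ev q x      ∎

  ev-cong : ∀ p q x → (∀ k → coeff p k A.≈ coeff q k) → ev p x ≈ ev q x
  ev-cong []      q       x p≈q = ev-[] q x p≈q
  ev-cong (a ∷ p) []      x p≈q = ev-zero (a ∷ p) x p≈q
  ev-cong (a ∷ p) (b ∷ q) x p≈q = +-cong (φ.cong (p≈q zero)) (*-congˡ (ev-cong p q x (p≈q ∘ suc)))

  ev-add : ∀ p q x → ev (add p q) x ≈ ev p x + ev q x
  ev-add []      q       x = sym (+-identityˡ _)
  ev-add (a ∷ p) []      x = sym (+-identityʳ _)
  ev-add (a ∷ p) (b ∷ q) x = begin
    φ.⟦ a A.+ b ⟧ + x * ev (add p q) x                    ≈⟨ +-cong (φ.+-homo a b) (*-congˡ (ev-add p q x)) ⟩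
    φ.⟦ a ⟧ + φ.⟦ b ⟧ + x * (ev p x + ev q x)             ≈⟨ solve 5 (λ a b x p q → a :+ b :+ x :* (p :+ q) := a :+ x :* p :+ (b :+ x :* q)) refl _ _ _ _ _ ⟩
    φ.⟦ a ⟧ + x * ev p x + (φ.⟦ b ⟧ + x * ev q x)         ∎

  ev-scale : ∀ a p x → ev (scale a p) x ≈ φ.⟦ a ⟧ * ev p x
  ev-scale a []      x = sym (zeroʳ _)
  ev-scale a (b ∷ p) x = begin
    φ.⟦ a A.* b ⟧ + x * ev (scale a p) x          ≈⟨ +-cong (φ.*-homo a b) (*-congˡ (ev-scale a p x)) ⟩
    φ.⟦ a ⟧ * φ.⟦ b ⟧ + x * (φ.⟦ a ⟧ * ev p x)    ≈⟨ solve 4 (λ a b x p → a :* b :+ x :* (a :* p) := a :* (b :+ x :* p)) refl _ _ _ _ ⟩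
    φ.⟦ a ⟧ * (φ.⟦ b ⟧ + x * ev p x)              ∎

  ev-mul : ∀ p q x → ev (mul p q) x ≈ ev p x * ev q x
  ev-mul []      q x = sym (zeroˡ _)
  ev-mul (a ∷ p) q x = begin
    ev (add (scale a q) (A.0# ∷ mul p q)) x                   ≈⟨ ev-add (scale a q) (A.0# ∷ mul p q) x ⟩
    ev (scale a q) x + (φ.⟦ A.0# ⟧ + x * ev (mul p q) x)      ≈⟨ +-cong (ev-scale a q x) (+-cong φ.0-homo (*-congˡ (ev-mul p q x))) ⟩
    φ.⟦ a ⟧ * ev q x + (0# + x * (ev p x * ev q x))           ≈⟨ solve 4 (λ a x p q → a :* q :+ (con +0 :+ x :* (p :* q)) := (a :+ x :* p) :* q) refl _ _ _ _ ⟩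
    (φ.⟦ a ⟧ + x * ev p x) * ev q x                           ∎

  ev-neg : ∀ p x → ev (map A.-_ p) x ≈ - ev p x
  ev-neg []      x = solve 0 (con +0 := :- con +0) refl
  ev-neg (a ∷ p) x = trans (+-cong (φ.-‿homo a) (*-congˡ (ev-neg p x)))
    (solve 3 (λ a x p → :- a :+ x :* :- p := :- (a :+ x :* p)) refl _ _ _)

  ev-X : ∀ x → ev X x ≈ x
  ev-X x = trans (+-cong φ.0-homo (*-congˡ (+-congʳ φ.1-homo)))
    (solve 1 (λ x → con +0 :+ x :* (con (+ 1) :+ x :* con +0) := x) refl x)

  at : Carrier → Hom (A [X]) K
  at x = record
    { ⟦_⟧    = λ p → ev p x
    ; cong   = λ {p} {q} → ev-cong p q x
    ; +-homo = λ p q → ev-add p q x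
    ; *-homo = λ p q → ev-mul p q x
    ; -‿homo = λ p → ev-neg p x
    ; 0-homo = refl
    ; 1-homo = trans (+-cong φ.1-homo (zeroʳ x)) (+-identityʳ 1#)
    }

  ev-eval : ∀ p a → φ.⟦ eval p a ⟧ ≈ ev p φ.⟦ a ⟧
  ev-eval []      a = φ.0-homo
  ev-eval (b ∷ p) a = trans (φ.+-homo b _) (+-congˡ (trans (φ.*-homo a _) (*-congˡ (ev-eval p a))))

  ev-quot : ∀ p a x → ev p x ≈ (x - φ.⟦ a ⟧) * ev (quot a p) x + ev p φ.⟦ a ⟧
  ev-quot []            a x = solve 2 (λ x a → con +0 := (x :- a) :* con +0 :+ con +0) refl x φ.⟦ a ⟧
  ev-quot (b ∷ [])      a x = solve 3 (λ x a b → b :+ x :* con +0 := (x :- a) :* con +0 :+ (b :+ a :* con +0)) refl x φ.⟦ a ⟧ φ.⟦ b ⟧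
  ev-quot (b ∷ p@(_ ∷ _)) a x = begin
    φ.⟦ b ⟧ + x * ev p x
      ≈⟨ +-congˡ (*-congˡ (ev-quot p a x)) ⟩
    φ.⟦ b ⟧ + x * ((x - φ.⟦ a ⟧) * ev (quot a p) x + ev p φ.⟦ a ⟧)
      ≈⟨ solve 5 (λ b x a q r → b :+ x :* ((x :- a) :* q :+ r) := (x :- a) :* (r :+ x :* q) :+ (b :+ a :* r)) refl
           φ.⟦ b ⟧ x φ.⟦ a ⟧ (ev (quot a p) x) (ev p φ.⟦ a ⟧) ⟩
    (x - φ.⟦ a ⟧) * (ev p φ.⟦ a ⟧ + x * ev (quot a p) x) + (φ.⟦ b ⟧ + φ.⟦ a ⟧ * ev p φ.⟦ a ⟧)
      ≈⟨ +-congʳ (*-congˡ (+-congʳ (ev-eval p a))) ⟨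
    (x - φ.⟦ a ⟧) * (φ.⟦ eval p a ⟧ + x * ev (quot a p) x) + (φ.⟦ b ⟧ + φ.⟦ a ⟧ * ev p φ.⟦ a ⟧) ∎

-- Rooted trees as terms and their characteristic polynomials.

-- t ⊕ s is t with one more branch s at its root.

infixl 6 _⊕_

data Tree : Set where
  •   : Tree
  _⊕_ : Tree → Tree → Tree

size : Tree → ℕ
size •       = 1
size (t ⊕ s) = size t ℕ.+ size s

-- P t is the characteristic polynomial of t and F t that of the forest t ′.

module Characteristic {a ℓᵃ} (A : RawRing a ℓᵃ) where
  open RawRing A

  P F : Tree → Carrier → Carrier
  P •       x = x
  P (t ⊕ s) x = P t x * P s x + - (F t x * F s x)
  F •       x = 1#
  F (t ⊕ s) x = F t x * P s x

module _ {a ℓᵃ κ ℓ} {A : RawRing a ℓᵃ} {K : CommutativeRing κ ℓ} (φ : Hom A K) where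
  private
    module A where
      open RawRing A public
      open Characteristic A public
      open Matrices A public
      open RawSemiringDefs (RawRing.rawSemiring A) public using (_^_)
    module K where
      open CommutativeRing K public
      open Characteristic rawRing public
      open Matrices rawRing public
      open RawSemiringDefs (RawRing.rawSemiring rawRing) public using (_^_)
  open Hom φ
  open CommutativeRing K hiding (zero)

  F-homo : ∀ t x → ⟦ A.F t x ⟧ ≈ K.F t ⟦ x ⟧
  P-homo : ∀ t x → ⟦ A.P t x ⟧ ≈ K.P t ⟦ x ⟧
  P-homo •       x = refl
  P-homo (t ⊕ s) x = trans (+-homo _ _) (+-cong (trans (*-homo _ _) (*-cong (P-homo t x) (P-homo s x)))
    (trans (-‿homo _) (-‿cong (trans (*-homo _ _) (*-cong (F-homo t x) (F-homo s x))))))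
  F-homo •       x = 1-homo
  F-homo (t ⊕ s) x = trans (*-homo _ _) (*-cong (F-homo t x) (P-homo s x))

  sum-homo : ∀ {n} (f : Fin n → A.Carrier) → ⟦ A.sum f ⟧ ≈ K.sum (⟦_⟧ ∘ f)
  sum-homo {zero}  f = 0-homo
  sum-homo {suc n} f = trans (+-homo _ _) (+-congˡ (sum-homo (f ∘ suc)))

  ^-homo : ∀ x n → ⟦ x A.^ n ⟧ ≈ ⟦ x ⟧ K.^ n
  ^-homo x zero    = 1-homo
  ^-homo x (suc n) = trans (*-homo _ _) (*-congˡ (^-homo x n))

  det-homo : ∀ {n} (M : A.Matrix n) → ⟦ A.det M ⟧ ≈ K.det (λ i j → ⟦ M i j ⟧)
  det-homo {zero}  M = 1-homo
  det-homo {suc n} M = trans (sum-homo λ j → (A.- A.1#) A.^ toℕ j A.* (M zero j A.* A.det λ i k → M (suc i) (punchIn j k)))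
    (SemiringSum.sum-cong-≋ K.semiring λ j → trans (*-homo ((A.- A.1#) A.^ toℕ j) _) (*-cong
      (trans (^-homo _ (toℕ j)) (pow-cong (toℕ j) (trans (-‿homo _) (-‿cong 1-homo))))
      (trans (*-homo (M zero j) _) (*-congˡ (det-homo λ i k → M (suc i) (punchIn j k))))))
    where
    pow-cong : ∀ n {x y} → x ≈ y → x K.^ n ≈ y K.^ n
    pow-cong zero    x≈y = refl
    pow-cong (suc n) x≈y = *-cong x≈y (pow-cong n x≈y)

  if-homo : ∀ (b : Bool) x y → ⟦ if b then x else y ⟧ ≈ (if b then ⟦ x ⟧ else ⟦ y ⟧)
  if-homo true  x y = refl
  if-homo false x y = refl

module _ {κ ℓ} (K : CommutativeRing κ ℓ) where
  open CommutativeRing K hiding (zero)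
  open Evaluation (fromIntegers K)
  open Matrices rawRing

  private
    if-cong : ∀ (b : Bool) {x x′ y y′} → x ≈ x′ → y ≈ y′ → (if b then x else y) ≈ (if b then x′ else y′)
    if-cong true  p q = p
    if-cong false p q = q

  ev-χ : ∀ G x → ev (χ G) x ≈ det λ u v → scalar x u v - adjacency rawRing G u v
  ev-χ G x = trans (det-homo (at x) λ u v → Matrices.scalar ℤ[X] (Coefficients.X ℤ.+-*-rawRing) u v RX.+ RX.- adjacency ℤ[X] G u v)
    (Determinants.det-cong K λ u v → trans (Hom.+-homo (at x) (Matrices.scalar ℤ[X] (Coefficients.X ℤ.+-*-rawRing) u v) _) (+-cong
      (trans (if-homo (at x) (does (u Fin.≟ v)) (Coefficients.X ℤ.+-*-rawRing) RX.0#) (if-cong (does (u Fin.≟ v)) (ev-X x) refl))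
      (trans (ev-neg (adjacency ℤ[X] G u v) x) (-‿cong
        (trans (if-homo (at x) (Graph.adj G u v) RX.1# RX.0#) (if-cong (Graph.adj G u v) (Hom.1-homo (at x)) refl))))))
    where module RX = RawRing ℤ[X]

-- Signs and polynomials over a real closed field.

module OrderedField {κ ℓ₁ ℓ₂} (ℝ : RealClosedField κ ℓ₁ ℓ₂) where
  open RealClosedField ℝ hiding (zero) renaming (commutativeRing to K)
  open IsStrictTotalOrder isStrictTotalOrder public
    using (compare; <-respˡ-≈; <-respʳ-≈) renaming (trans to <-trans; irrefl to <-irrefl; asym to <-asym)
  open Integers K
  open RingProperties ring public using (-‿involutive; -0#≈0#)
  open SetoidReasoning setoid

  infix 4 0<_ 0≤_

  0· : ∀ {x y} → x ≈ 0# → x * y ≈ 0#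
  0· x≈0 = trans (*-congʳ x≈0) (zeroˡ _)

  ·0 : ∀ {x y} → y ≈ 0# → x * y ≈ 0#
  ·0 y≈0 = trans (*-congˡ y≈0) (zeroʳ _)

  0<_ 0≤_ : Carrier → Set _
  0< x = 0# < x
  0≤ x = 0# < x ⊎ x ≈ 0#

  0<-resp : ∀ {x y} → x ≈ y → 0< x → 0< y
  0<-resp = <-respʳ-≈

  0≤-resp : ∀ {x y} → x ≈ y → 0≤ x → 0≤ y
  0≤-resp x≈y (inj₁ 0<x) = inj₁ (0<-resp x≈y 0<x)
  0≤-resp x≈y (inj₂ x≈0) = inj₂ (trans (sym x≈y) x≈0)

  <⇒0< : ∀ {x y} → x < y → 0< y - x
  <⇒0< {x} x<y = <-respˡ-≈ (-‿inverseʳ x) (+-monoˡ-< (- x) x<y)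

  0<⇒< : ∀ {x y} → 0< y - x → x < y
  0<⇒< {x} {y} 0<y-x = <-respˡ-≈ (+-identityˡ x)
    (<-respʳ-≈ (solve 2 (λ x y → y :- x :+ x := y) refl x y) (+-monoˡ-< x 0<y-x))

  <0⇒0<- : ∀ {x} → x < 0# → 0< - x
  <0⇒0<- x<0 = 0<-resp (+-identityˡ _) (<⇒0< x<0)

  0<-⇒<0 : ∀ {x} → 0< - x → x < 0#
  0<-⇒<0 0<-x = 0<⇒< (0<-resp (sym (+-identityˡ _)) 0<-x)

  +-pos : ∀ {x y} → 0< x → 0< y → 0< x + y
  +-pos {x} {y} 0<x 0<y = <-trans 0<y (<-respˡ-≈ (+-identityˡ y) (+-monoˡ-< y 0<x))

  +-pos-nonneg : ∀ {x y} → 0< x → 0≤ y → 0< x + y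
  +-pos-nonneg 0<x (inj₁ 0<y) = +-pos 0<x 0<y
  +-pos-nonneg 0<x (inj₂ y≈0) = 0<-resp (trans (sym (+-identityʳ _)) (+-congˡ (sym y≈0))) 0<x

  +-nonneg-pos : ∀ {x y} → 0≤ x → 0< y → 0< x + y
  +-nonneg-pos 0≤x 0<y = 0<-resp (+-comm _ _) (+-pos-nonneg 0<y 0≤x)

  +-nonneg : ∀ {x y} → 0≤ x → 0≤ y → 0≤ x + y
  +-nonneg 0≤x (inj₁ 0<y) = inj₁ (+-nonneg-pos 0≤x 0<y)
  +-nonneg 0≤x (inj₂ y≈0) = 0≤-resp (trans (sym (+-identityʳ _)) (+-congˡ (sym y≈0))) 0≤x

  *-nonneg : ∀ {x y} → 0≤ x → 0≤ y → 0≤ x * y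
  *-nonneg (inj₁ 0<x) (inj₁ 0<y) = inj₁ (*-pos 0<x 0<y)
  *-nonneg (inj₂ x≈0) _          = inj₂ (trans (*-congʳ x≈0) (zeroˡ _))
  *-nonneg _          (inj₂ y≈0) = inj₂ (trans (*-congˡ y≈0) (zeroʳ _))

  0<⇒≉0 : ∀ {x} → 0< x → x ≉ 0#
  0<⇒≉0 0<x x≈0 = <-irrefl (sym x≈0) 0<x

  0<-⇒≉0 : ∀ {x} → 0< - x → x ≉ 0#
  0<-⇒≉0 0<-x x≈0 = <-irrefl x≈0 (0<-⇒<0 0<-x)

  0<⇒¬0<- : ∀ {x} → 0< x → ¬ 0< - x
  0<⇒¬0<- 0<x 0<-x = <-asym 0<x (0<-⇒<0 0<-x)

  0≤⇒¬0<- : ∀ {x} → 0≤ x → ¬ 0< - x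
  0≤⇒¬0<- (inj₁ 0<x) = 0<⇒¬0<- 0<x
  0≤⇒¬0<- (inj₂ x≈0) 0<-x = 0<-⇒≉0 0<-x x≈0

  data Sign (x : Carrier) : Set (ℓ₁ ⊔ ℓ₂) where
    pos : 0< x → Sign x
    nul : x ≈ 0# → Sign x
    neg : 0< - x → Sign x

  sign : ∀ x → Sign x
  sign x with compare x 0#
  ... | tri< x<0 _ _ = neg (<0⇒0<- x<0)
  ... | tri≈ _ x≈0 _ = nul x≈0
  ... | tri> _ _ 0<x = pos 0<x

  neg*neg : ∀ {x y} → 0< - x → 0< - y → 0< x * y
  neg*neg {x} {y} 0<-x 0<-y = 0<-resp (solve 2 (λ x y → :- x :* :- y := x :* y) refl x y) (*-pos 0<-x 0<-y)

  neg*pos : ∀ {x y} → 0< - x → 0< y → 0< - (x * y)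
  neg*pos {x} {y} 0<-x 0<y = 0<-resp (solve 2 (λ x y → :- x :* y := :- (x :* y)) refl x y) (*-pos 0<-x 0<y)

  pos*neg : ∀ {x y} → 0< x → 0< - y → 0< - (x * y)
  pos*neg {x} {y} 0<x 0<-y = 0<-resp (solve 2 (λ x y → x :* :- y := :- (x :* y)) refl x y) (*-pos 0<x 0<-y)

  integral : ∀ {x y} → x * y ≈ 0# → x ≈ 0# ⊎ y ≈ 0#
  integral {x} {y} xy≈0 with sign x | sign y
  ... | nul x≈0 | _ = inj₁ x≈0
  ... | _ | nul y≈0 = inj₂ y≈0
  ... | pos a | pos b = contradiction xy≈0 (0<⇒≉0 (*-pos a b))
  ... | pos a | neg b = contradiction xy≈0 (0<-⇒≉0 (pos*neg a b))
  ... | neg a | pos b = contradiction xy≈0 (0<-⇒≉0 (neg*pos a b))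
  ... | neg a | neg b = contradiction xy≈0 (0<⇒≉0 (neg*neg a b))

  *-cancel-0 : ∀ {x y} → x ≉ 0# → x * y ≈ 0# → y ≈ 0#
  *-cancel-0 x≉0 xy≈0 with integral xy≈0
  ... | inj₁ x≈0 = contradiction x≈0 x≉0
  ... | inj₂ y≈0 = y≈0

  *-≉0 : ∀ {x y} → x ≉ 0# → y ≉ 0# → x * y ≉ 0#
  *-≉0 x≉0 y≉0 xy≈0 = y≉0 (*-cancel-0 x≉0 xy≈0)

  0<-cancelˡ : ∀ {x y} → 0< x → 0< x * y → 0< y
  0<-cancelˡ {x} {y} 0<x 0<xy with sign y
  ... | pos 0<y  = 0<y
  ... | nul y≈0  = contradiction (trans (*-congˡ y≈0) (zeroʳ x)) (0<⇒≉0 0<xy)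
  ... | neg 0<-y = contradiction (pos*neg 0<x 0<-y) (0<⇒¬0<- 0<xy)

  0≤-cancelˡ : ∀ {x y} → 0< x → 0≤ x * y → 0≤ y
  0≤-cancelˡ 0<x (inj₁ 0<xy) = inj₁ (0<-cancelˡ 0<x 0<xy)
  0≤-cancelˡ 0<x (inj₂ xy≈0) = inj₂ (*-cancel-0 (0<⇒≉0 0<x) xy≈0)

  square-pos : ∀ {x} → x ≉ 0# → 0< x * x
  square-pos {x} x≉0 with sign x
  ... | pos 0<x  = *-pos 0<x 0<x
  ... | nul x≈0  = contradiction x≈0 x≉0
  ... | neg 0<-x = neg*neg 0<-x 0<-x

  square-nonneg : ∀ x → 0≤ x * x
  square-nonneg x with sign x
  ... | pos 0<x  = inj₁ (*-pos 0<x 0<x)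
  ... | nul x≈0  = inj₂ (trans (*-congʳ x≈0) (zeroˡ x))
  ... | neg 0<-x = inj₁ (neg*neg 0<-x 0<-x)

  ≉0-or-≈0 : ∀ x → x ≉ 0# ⊎ x ≈ 0#
  ≉0-or-≈0 x with sign x
  ... | pos 0<x  = inj₁ (0<⇒≉0 0<x)
  ... | nul x≈0  = inj₂ x≈0
  ... | neg 0<-x = inj₁ (0<-⇒≉0 0<-x)

  x-y≈0⇒x≈y : ∀ {x y} → x - y ≈ 0# → x ≈ y
  x-y≈0⇒x≈y {x} {y} x-y≈0 = trans (solve 2 (λ x y → x := x :- y :+ y) refl x y) (trans (+-congʳ x-y≈0) (+-identityˡ y))

  <-or-≥ : ∀ x y → x < y ⊎ (y < x ⊎ y ≈ x)
  <-or-≥ x y with compare x y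
  ... | tri< x<y _ _ = inj₁ x<y
  ... | tri≈ _ x≈y _ = inj₂ (inj₂ (sym x≈y))
  ... | tri> _ _ y<x = inj₂ (inj₁ y<x)

  0<2 : 0< 1# + 1#
  0<2 = +-pos 0<1 0<1

  x<x+ : ∀ x {y} → 0< y → x < x + y
  x<x+ x {y} 0<y = 0<⇒< (0<-resp (solve 2 (λ x y → y := x :+ y :- x) refl x y) 0<y)

  half : Carrier
  half = proj₁ (inverse (0<⇒≉0 0<2))

  2*half : (1# + 1#) * half ≈ 1#
  2*half = proj₂ (inverse (0<⇒≉0 0<2))

  0<inverse : ∀ {x y} → 0< x → x * y ≈ 1# → 0< y
  0<inverse 0<x xy≈1 = 0<-cancelˡ 0<x (0<-resp (sym xy≈1) 0<1)

  between : ∀ {a b} → a < b → ∃[ m ] a < m × m < b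
  between {a} {b} a<b = (a + b) * half
    , 0<⇒< (0<-resp (trans (solve 3 (λ a b h → h :* (b :- a) := (a :+ b) :* h :- a :* (con (+ 2) :* h)) refl a b half)
        (trans (+-congˡ (-‿cong (*-congˡ 2*half))) (+-congˡ (-‿cong (*-identityʳ a))))) 0<m)
    , 0<⇒< (0<-resp (trans (solve 3 (λ a b h → h :* (b :- a) := b :* (con (+ 2) :* h) :- (a :+ b) :* h) refl a b half)
        (+-congʳ (trans (*-congˡ 2*half) (*-identityʳ b)))) 0<m)
    where
    0<m : 0< half * (b - a)
    0<m = *-pos (0<inverse 0<2 2*half) (<⇒0< a<b)

  0<ι : ∀ n → 0< ι +[1+ n ]
  0<ι zero    = 0<-resp (sym ι-1) 0<1
  0<ι (suc n) = +-pos 0<1 (0<ι n)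

  ι-injective₀ : ∀ i → ι i ≈ 0# → i ≡ +0
  ι-injective₀ +0       eq = ≡.refl
  ι-injective₀ +[1+ n ] eq = contradiction eq (0<⇒≉0 (0<ι n))
  ι-injective₀ -[1+ n ] eq = contradiction eq (0<-⇒≉0 (0<-resp (sym (-‿involutive (ι +[1+ n ]))) (0<ι n)))

  open Evaluation (identity K) public
  open Division rawRing public
  open Coefficients rawRing using (coeff; X) public

  IsPolynomial : (Carrier → Carrier) → Set _
  IsPolynomial f = ∃[ p ] (∀ x → ev p x ≈ f x)

  poly-id : IsPolynomial id
  poly-id = X , ev-X

  poly-const : ∀ a → IsPolynomial (λ _ → a)
  poly-const a = a ∷ [] , λ x → trans (+-congˡ (zeroʳ x)) (+-identityʳ a)

  poly-* : ∀ {f g} → IsPolynomial f → IsPolynomial g → IsPolynomial (λ x → f x * g x)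
  poly-* (p , p≈f) (q , q≈g) = Coefficients.mul rawRing p q , λ x → trans (ev-mul p q x) (*-cong (p≈f x) (q≈g x))

  poly-- : ∀ {f g} → IsPolynomial f → IsPolynomial g → IsPolynomial (λ x → f x - g x)
  poly-- (p , p≈f) (q , q≈g) = Coefficients.add rawRing p (map -_ q) ,
    λ x → trans (ev-add p (map -_ q) x) (+-cong (p≈f x) (trans (ev-neg q x) (-‿cong (q≈g x))))

  private
    eval≈ev : ∀ p x → Coefficients.eval rawRing p x ≈ ev p x
    eval≈ev []      x = refl
    eval≈ev (a ∷ p) x = +-congˡ (*-congˡ (eval≈ev p x))

  root-between : ∀ {f a b} → IsPolynomial f → a < b → 0< - f a → 0< f b → ∃[ x ] a < x × x < b × f x ≈ 0#
  root-between {f} {a} {b} (p , p≈f) a<b fa<0 0<fb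
    with x , a<x , x<b , px≈0 ← ivt p a<b
           (<-respˡ-≈ (trans (sym (p≈f a)) (sym (eval≈ev p a))) (0<-⇒<0 fa<0))
           (0<-resp (trans (sym (p≈f b)) (sym (eval≈ev p b))) 0<fb)
    = x , a<x , x<b , trans (sym (p≈f x)) (trans (sym (eval≈ev p x)) px≈0)

  factor : ∀ p a → ev p a ≈ 0# → ∀ x → ev p x ≈ (x - a) * ev (quot a p) x
  factor p a pa≈0 x = trans (ev-quot p a x) (trans (+-congˡ pa≈0) (+-identityʳ _))

  private
    length-quot-≤ : ∀ {n} p a → length p ℕ.≤ suc n → length (quot a p) ℕ.≤ n
    length-quot-≤ p a p≤n = ≡.subst (ℕ._≤ _) (≡.sym (length-quot p a)) (ℕ.pred-mono-≤ p≤n)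

    before-root : ∀ n p → length p ℕ.≤ suc n → ∀ {a b} → 0< ev p a → ∀ ξ → a < ξ → ξ < b → ev p ξ ≈ 0# →
      ∃[ x ] a < x × x < b × 0< ev p x

  -- Right continuity by algebra. If p fails to be positive at a midpoint m, it has a zero ξ in (a ,
  -- m]. Then p = (ξ - X) r with r of lower degree and positive at a, and any point before ξ that
  -- serves r serves p.
  stays-positive : ∀ n p → length p ℕ.≤ n → ∀ {a b} → a < b → 0< ev p a → ∃[ x ] a < x × x < b × 0< ev p x
  stays-positive n       []        p≤n a<b 0<pa = contradiction refl (0<⇒≉0 0<pa)
  stays-positive (suc n) p@(_ ∷ _) p≤n {a} {b} a<b 0<pa =
    let m , a<m , m<b = between a<b in by-sign m a<m m<b (sign (ev p m))
    where
    by-sign : ∀ m → a < m → m < b → Sign (ev p m) → ∃[ x ] a < x × x < b × 0< ev p x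
    by-sign m a<m m<b (pos 0<pm) = m , a<m , m<b , 0<pm
    by-sign m a<m m<b (nul pm≈0) = before-root n p p≤n 0<pa m a<m m<b pm≈0
    by-sign m a<m m<b (neg 0<-pm) =
      let ξ , a<ξ , ξ<m , -pξ≈0 = root-between {λ x → - ev p x} (map -_ p , ev-neg p) a<m (0<-resp (sym (-‿involutive _)) 0<pa) 0<-pm
      in before-root n p p≤n 0<pa ξ a<ξ (<-trans ξ<m m<b) (trans (sym (-‿involutive _)) (trans (-‿cong -pξ≈0) -0#≈0#))

  before-root n p p≤n {a} {b} 0<pa ξ a<ξ ξ<b pξ≈0 =
    let x , a<x , x<ξ , 0<-qx = stays-positive n (map -_ (quot ξ p)) length-≤ a<ξ (0<-cancelˡ (<⇒0< a<ξ) (0<-resp (flipped a) 0<pa))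
    in x , a<x , <-trans x<ξ ξ<b , 0<-resp (sym (flipped x)) (*-pos (<⇒0< x<ξ) 0<-qx)
    where
    length-≤ : length (map -_ (quot ξ p)) ℕ.≤ n
    length-≤ = ≡.subst (ℕ._≤ n) (≡.sym (List.length-map -_ (quot ξ p))) (length-quot-≤ p ξ p≤n)
    flipped : ∀ x → ev p x ≈ (ξ - x) * ev (map -_ (quot ξ p)) x
    flipped x = begin
      ev p x                                 ≈⟨ factor p ξ pξ≈0 x ⟩
      (x - ξ) * ev (quot ξ p) x              ≈⟨ solve 3 (λ x ξ q → (x :- ξ) :* q := (ξ :- x) :* :- q) refl x ξ (ev (quot ξ p) x) ⟩
      (ξ - x) * - ev (quot ξ p) x            ≈⟨ *-congˡ (ev-neg (quot ξ p) x) ⟨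
      (ξ - x) * ev (map -_ (quot ξ p)) x     ∎

  -- The set of zeros is a half-line so that the hypothesis survives division: the root a + 1 is
  -- divided out, and the quotient vanishes beyond a + 1.
  vanishes⇒0 : ∀ n p → length p ℕ.≤ n → ∀ a → (∀ x → a < x → ev p x ≈ 0#) → ∀ k → coeff p k ≈ 0#
  vanishes⇒0 n       []        p≤n a p≈0 k = refl
  vanishes⇒0 (suc n) p@(_ ∷ _) p≤n a p≈0 = quot-zero p (vanishes⇒0 n (quot b p) (length-quot-≤ p b p≤n) b quot≈0) pb≈0
    where
    b = a + 1#
    pb≈0 : ev p b ≈ 0#
    pb≈0 = p≈0 b (x<x+ a 0<1)
    quot≈0 : ∀ x → b < x → ev (quot b p) x ≈ 0#
    quot≈0 x b<x = *-cancel-0 (0<⇒≉0 (<⇒0< b<x)) (trans (sym (factor p b pb≈0 x)) (p≈0 x (<-trans (x<x+ a 0<1) b<x)))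
    quot-zero : ∀ p → (∀ k → coeff (quot b p) k ≈ 0#) → ev p b ≈ 0# → ∀ k → coeff p k ≈ 0#
    quot-zero []              q≈0 pb≈0 k       = refl
    quot-zero (c ∷ [])        q≈0 pb≈0 zero    = trans (solve 2 (λ c b → c := c :+ b :* con +0) refl c b) pb≈0
    quot-zero (c ∷ [])        q≈0 pb≈0 (suc k) = refl
    quot-zero (c ∷ p@(_ ∷ _)) q≈0 pb≈0 zero    = trans (solve 2 (λ c b → c := c :+ b :* con +0) refl c b)
      (trans (+-congˡ (*-congˡ (sym (trans (sym (eval≈ev p b)) (q≈0 zero))))) pb≈0)
    quot-zero (c ∷ p@(_ ∷ _)) q≈0 pb≈0 (suc k) = quot-zero p (q≈0 ∘ suc) (trans (sym (eval≈ev p b)) (q≈0 zero)) k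

module CharacteristicLaws {κ ℓ} (K : CommutativeRing κ ℓ) where
  open CommutativeRing K hiding (zero)
  open Characteristic rawRing public

  F-cong : ∀ t {x y} → x ≈ y → F t x ≈ F t y
  P-cong : ∀ t {x y} → x ≈ y → P t x ≈ P t y
  P-cong •       x≈y = x≈y
  P-cong (t ⊕ s) x≈y = +-cong (*-cong (P-cong t x≈y) (P-cong s x≈y)) (-‿cong (*-cong (F-cong t x≈y) (F-cong s x≈y)))
  F-cong •       x≈y = refl
  F-cong (t ⊕ s) x≈y = *-cong (F-cong t x≈y) (P-cong s x≈y)

-- Growth of the pivots and the largest eigenvalue.

module Monotonicity {κ ℓ₁ ℓ₂} (ℝ : RealClosedField κ ℓ₁ ℓ₂) where
  open RealClosedField ℝ hiding (zero) renaming (commutativeRing to K)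
  open OrderedField ℝ
  open Integers K
  open CharacteristicLaws K

  -- The pivots P / F of the elimination from the leaves are positive at every vertex but the root.

  Positive : Tree → Carrier → Set ℓ₂
  Positive •       x = ⊤
  Positive (t ⊕ s) x = Positive t x × Positive s x × 0< P s x

  -- Expresses that x is an upper bound of the spectrum; only the pivot at the root may be zero.
  Bounded : Tree → Carrier → Set (ℓ₁ ⊔ ℓ₂)
  Bounded t x = Positive t x × 0≤ P t x

  -- Weaker than `Positive`: x may be the largest eigenvalue of a branch. Then `F t x` is 0 and the
  -- pivot at the root has a pole, which at x = 2 is the case ν = ∞.
  Branches-bounded : Tree → Carrier → Set (ℓ₁ ⊔ ℓ₂)
  Branches-bounded •       x = ⊤
  Branches-bounded (t ⊕ s) x = Branches-bounded t x × Bounded s x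

  F-pos : ∀ t {x} → Positive t x → 0< F t x
  F-pos •       _              = 0<1
  F-pos (t ⊕ s) (pt , ps , 0<P) = *-pos (F-pos t pt) 0<P

  Positive-cong : ∀ t {x y} → x ≈ y → Positive t x → Positive t y
  Positive-cong •       x≈y _               = tt
  Positive-cong (t ⊕ s) x≈y (pt , ps , 0<P) = Positive-cong t x≈y pt , Positive-cong s x≈y ps , 0<-resp (P-cong s x≈y) 0<P

  -- F(x) F(y) times the increase a(x) - a(y) of the root pivot.
  wronskian : Tree → Carrier → Carrier → Carrier
  wronskian t y x = P t x * F t y - P t y * F t x

  private
    wronskian-⊕ : ∀ t s y x → wronskian (t ⊕ s) y x ≈ P s x * P s y * wronskian t y x + F t x * F t y * wronskian s y x
    wronskian-⊕ t s y x = solve 8 (λ pt ft ps fs pt′ ft′ ps′ fs′ →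
        (pt :* ps :- ft :* fs) :* (ft′ :* ps′) :- (pt′ :* ps′ :- ft′ :* fs′) :* (ft :* ps)
        := ps :* ps′ :* (pt :* ft′ :- pt′ :* ft) :+ ft :* ft′ :* (ps :* fs′ :- ps′ :* fs)) refl
      (P t x) (F t x) (P s x) (F s x) (P t y) (F t y) (P s y) (F s y)

  -- The root pivot satisfies a(x) - a(y) ≥ x - y, since each -1 / a(c) increases as well. The rate,
  -- and not only the monotonicity, is needed in `exceeds`.
  rises : ∀ t {x y} → Positive t y → y < x → Positive t x × 0≤ wronskian t y x - (x - y) * (F t x * F t y)
  rises-strictly : ∀ t {x y} → Positive t y → y < x → 0< wronskian t y x
  P-rises : ∀ t {x y} → Positive t y → y < x → 0≤ P t y → 0< P t x

  rises •       {x} {y} _ y<x = tt , inj₂ (solve 2 (λ x y → x :* con (+ 1) :- y :* con (+ 1) :- (x :- y) :* (con (+ 1) :* con (+ 1)) := con +0) refl x y)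
  rises (t ⊕ s) {x} {y} (pt , ps , 0<P) y<x =
    (proj₁ IH , proj₁ (rises s ps y<x) , 0<Px) ,
    0≤-resp
      (trans (solve 7 (λ px py w d fx fy v → px :* py :* (w :- d :* (fx :* fy)) :+ fx :* fy :* v
                := px :* py :* w :+ fx :* fy :* v :- d :* (fx :* px :* (fy :* py)))
              refl (P s x) (P s y) (wronskian t y x) (x - y) (F t x) (F t y) (wronskian s y x))
        (+-congʳ (sym (wronskian-⊕ t s y x))))
      (+-nonneg (*-nonneg (inj₁ (*-pos 0<Px 0<P)) (proj₂ IH))
                (inj₁ (*-pos (*-pos (F-pos t (proj₁ IH)) (F-pos t pt)) (rises-strictly s ps y<x))))
    where
    IH = rises t pt y<x
    0<Px : 0< P s x
    0<Px = P-rises s ps y<x (inj₁ 0<P)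

  rises-strictly t {x} {y} pt y<x = 0<-resp (solve 2 (λ a b → a :- b :+ b := a) refl _ ((x - y) * (F t x * F t y)))
    (+-nonneg-pos (proj₂ (rises t pt y<x)) (*-pos (<⇒0< y<x) (*-pos (F-pos t (proj₁ (rises t pt y<x))) (F-pos t pt))))

  P-rises t {x} {y} pt y<x 0≤P = 0<-cancelˡ (F-pos t pt)
    (0<-resp (solve 4 (λ px fy py fx → px :* fy :- py :* fx :+ py :* fx := fy :* px) refl (P t x) (F t y) (P t y) (F t x))
      (+-pos-nonneg (rises-strictly t pt y<x) (*-nonneg 0≤P (inj₁ (F-pos t (proj₁ (rises t pt y<x)))))))

  Bounded-weaken : ∀ t {x y} → Bounded t y → y < x ⊎ y ≈ x → Bounded t x
  Bounded-weaken t (pt , 0≤P) (inj₁ y<x) = proj₁ (rises t pt y<x) , inj₁ (P-rises t pt y<x 0≤P)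
  Bounded-weaken t (pt , 0≤P) (inj₂ y≈x) = Positive-cong t y≈x pt , 0≤-resp (P-cong t y≈x) 0≤P

  Branches-bounded⇒Positive : ∀ t {x y} → Branches-bounded t y → y < x → Positive t x
  Branches-bounded⇒Positive •       _               y<x = tt
  Branches-bounded⇒Positive (t ⊕ s) (bt , ps , 0≤P) y<x =
    Branches-bounded⇒Positive t bt y<x , proj₁ (rises s ps y<x) , P-rises s ps y<x 0≤P

  Branches-bounded∧F≉0⇒Positive : ∀ t {x} → Branches-bounded t x → F t x ≉ 0# → Positive t x
  Branches-bounded∧F≉0⇒Positive •       _                        F≉0 = tt
  Branches-bounded∧F≉0⇒Positive (t ⊕ s) (bt , ps , inj₁ 0<P) F≉0 =
    Branches-bounded∧F≉0⇒Positive t bt (λ F≈0 → F≉0 (0· F≈0)) , ps , 0<P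
  Branches-bounded∧F≉0⇒Positive (t ⊕ s) (bt , ps , inj₂ P≈0) F≉0 = contradiction (·0 P≈0) F≉0

  -- The root pivot is x minus reciprocals of positive pivots. Next to a pole this bounds the part
  -- of the pivot that stays finite.
  P≤xF : ∀ t {x} → Positive t x → 0≤ x * F t x - P t x
  P≤xF •       {x} _               = inj₂ (solve 1 (λ x → x :* con (+ 1) :- x := con +0) refl x)
  P≤xF (t ⊕ s) {x} (pt , ps , 0<P) = 0≤-resp
    (solve 5 (λ x ft pt ps fs → ps :* (x :* ft :- pt) :+ ft :* fs := x :* (ft :* ps) :- (pt :* ps :- ft :* fs)) refl
      x (F t x) (P t x) (P s x) (F s x))
    (+-nonneg (*-nonneg (inj₁ 0<P) (P≤xF t pt)) (inj₁ (*-pos (F-pos t pt) (F-pos s ps))))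

  private
    -- The pivot is nonnegative at y and grows by at least 2, hence exceeds 1 at y + 2. Two pivots
    -- above 1 have a product above 1, which makes `P` of the joined tree positive.
    exceeds : ∀ t {y} → Bounded t y → 0< P t (y + (1# + 1#)) - F t (y + (1# + 1#))
    exceeds t {y} (pt , 0≤P) = 0<-cancelˡ (F-pos t pt) (0<-resp
      (solve 5 (λ px fx py fy y → let x = y :+ (con (+ 1) :+ con (+ 1)) in
          (px :* fy :- py :* fx :- (x :- y) :* (fx :* fy)) :+ (py :* fx :+ fx :* fy) := fy :* (px :- fx))
        refl (P t x) (F t x) (P t y) (F t y) y)
      (+-nonneg-pos (proj₂ up) (+-nonneg-pos (*-nonneg 0≤P (inj₁ 0<F)) (*-pos 0<F (F-pos t pt)))))
      where
      x = y + (1# + 1#)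
      up = rises t pt (x<x+ y 0<2)
      0<F = F-pos t (proj₁ up)

  open Evaluation (identity K) using () renaming (at to evaluateAt)

  P-polynomial : ∀ t → IsPolynomial (P t)
  P-polynomial t = Characteristic.P (rawRing [X]) t X , λ x → trans (P-homo (evaluateAt x) t X) (P-cong t (ev-X x))

  F-polynomial : ∀ t → IsPolynomial (F t)
  F-polynomial t = Characteristic.F (rawRing [X]) t X , λ x → trans (F-homo (evaluateAt x) t X) (F-cong t (ev-X x))

  -- The index of t: its largest eigenvalue.

  Index : Tree → Carrier → Set (ℓ₁ ⊔ ℓ₂)
  Index t y = Positive t y × P t y ≈ 0#

  Exceeds : Tree → Carrier → Set (κ ⊔ ℓ₁ ⊔ ℓ₂)
  Exceeds t x = ∃[ y ] x < y × Index t y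

  private
    -- Applied at the larger of the two indices. There `P` of the join is -F F < 0, and at m + 2 it
    -- is positive. The zero between them lies beyond both indices, so all pivots below the root are
    -- positive at it.
    join-index : ∀ t s {m} → Bounded t m → Bounded s m → P t m * P s m ≈ 0# → ∃[ y ] Index (t ⊕ s) y
    join-index t s {m} bt@(pt , _) bs@(ps , 0≤Ps) PP≈0 =
      let y , m<y , y<M , Py≈0 = root-between (P-polynomial (t ⊕ s)) m<M
            (0<-resp (trans (solve 1 (λ f → f := :- (con +0 :- f)) refl _) (-‿cong (+-congʳ (sym PP≈0)))) (*-pos (F-pos t pt) (F-pos s ps)))
            (0<-resp (solve 4 (λ pt ft ps fs → (pt :- ft) :* ps :+ ft :* (ps :- fs) := pt :* ps :- ft :* fs) refl _ _ _ _)
              (+-pos (*-pos (exceeds t bt) (P-rises s ps m<M 0≤Ps)) (*-pos (F-pos t (proj₁ (rises t pt m<M))) (exceeds s bs))))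
      in y , (proj₁ (rises t pt m<y) , proj₁ (rises s ps m<y) , P-rises s ps m<y 0≤Ps) , Py≈0
      where
      m<M : m < m + (1# + 1#)
      m<M = x<x+ m 0<2

  index : ∀ t → ∃[ y ] Index t y
  index •       = 0# , tt , refl
  index (t ⊕ s) =
    let y , py , Py≈0 = index t
        z , pz , Pz≈0 = index s
    in larger y z (py , inj₂ Py≈0) (pz , inj₂ Pz≈0) Py≈0 Pz≈0
    where
    larger : ∀ y z → Bounded t y → Bounded s z → P t y ≈ 0# → P s z ≈ 0# → ∃[ w ] Index (t ⊕ s) w
    larger y z bt bs Py≈0 Pz≈0 with <-or-≥ y z
    ... | inj₁ y<z = join-index t s (Bounded-weaken t bt (inj₁ y<z)) bs (·0 Pz≈0)
    ... | inj₂ z≤y = join-index t s bt (Bounded-weaken s bs z≤y) (0· Py≈0)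

  bounded-or-exceeds : ∀ t x → Bounded t x ⊎ Exceeds t x
  bounded-or-exceeds t x =
    let y , py , Py≈0 = index t in by-order y (py , Py≈0) (<-or-≥ x y)
    where
    by-order : ∀ y → Index t y → x < y ⊎ (y < x ⊎ y ≈ x) → Bounded t x ⊎ Exceeds t x
    by-order y i (inj₁ x<y) = inj₂ (y , x<y , i)
    by-order y (py , Py≈0) (inj₂ y≤x) = inj₁ (Bounded-weaken t (py , inj₂ Py≈0) y≤x)

  index-unique : ∀ t {x y} → Index t x → Index t y → x ≈ y
  index-unique t {x} {y} (px , Px≈0) (py , Py≈0) with compare x y
  ... | tri< x<y _ _ = contradiction Py≈0 (0<⇒≉0 (P-rises t px x<y (inj₂ Px≈0)))
  ... | tri≈ _ x≈y _ = x≈y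
  ... | tri> _ _ y<x = contradiction Px≈0 (0<⇒≉0 (P-rises t py y<x (inj₂ Py≈0)))

-- Dual numbers, derivatives and the zeros of F.

module DualNumbers {κ ℓ} (K : CommutativeRing κ ℓ) where
  open CommutativeRing K hiding (zero)
  open Integers K

  dual : CommutativeRing κ ℓ
  dual = record
    { Carrier = Carrier × Carrier
    ; _≈_     = λ (a , b) (a′ , b′) → a ≈ a′ × b ≈ b′
    ; _+_     = λ (a , b) (a′ , b′) → a + a′ , b + b′
    ; _*_     = λ (a , b) (a′ , b′) → a * a′ , a * b′ + b * a′
    ; -_      = λ (a , b) → - a , - b
    ; 0#      = 0# , 0#
    ; 1#      = 1# , 0#
    ; isCommutativeRing = record
      { isRing = record
        { +-isAbelianGroup = AbelianGroup.isAbelianGroup (DirectProduct.abelianGroup +-abelianGroup +-abelianGroup)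
        ; *-cong = λ (a , b) (a′ , b′) → *-cong a a′ , +-cong (*-cong a b′) (*-cong b a′)
        ; *-assoc = λ (a , b) (a′ , b′) (a″ , b″) → *-assoc a a′ a″ ,
            solve 6 (λ a b a′ b′ a″ b″ → a :* a′ :* b″ :+ (a :* b′ :+ b :* a′) :* a″ := a :* (a′ :* b″ :+ b′ :* a″) :+ b :* (a′ :* a″)) refl a b a′ b′ a″ b″
        ; *-identity =
            (λ (a , b) → *-identityˡ a , solve 2 (λ a b → con (+ 1) :* b :+ con +0 :* a := b) refl a b) ,
            (λ (a , b) → *-identityʳ a , solve 2 (λ a b → a :* con +0 :+ b :* con (+ 1) := b) refl a b)
        ; distrib =
            (λ (a , b) (a′ , b′) (a″ , b″) → distribˡ a a′ a″ ,
              solve 6 (λ a b a′ b′ a″ b″ → a :* (b′ :+ b″) :+ b :* (a′ :+ a″) := a :* b′ :+ b :* a′ :+ (a :* b″ :+ b :* a″)) refl a b a′ b′ a″ b″) ,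
            (λ (a , b) (a′ , b′) (a″ , b″) → distribʳ a a′ a″ ,
              solve 6 (λ a b a′ b′ a″ b″ → (a′ :+ a″) :* b :+ (b′ :+ b″) :* a := a′ :* b :+ b′ :* a :+ (a″ :* b :+ b″ :* a)) refl a b a′ b′ a″ b″)
        }
      ; *-comm = λ (a , b) (a′ , b′) → *-comm a a′ ,
          solve 4 (λ a b a′ b′ → a :* b′ :+ b :* a′ := a′ :* b :+ b′ :* a) refl a b a′ b′
      }
    }

  constant : Hom rawRing dual
  constant = record
    { ⟦_⟧    = λ a → a , 0#
    ; cong   = λ a≈b → a≈b , refl
    ; +-homo = λ a b → refl , sym (+-identityˡ 0#)
    ; *-homo = λ a b → refl , solve 2 (λ a b → con +0 := a :* con +0 :+ con +0 :* b) refl a b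
    ; -‿homo = λ a → refl , solve 0 (con +0 := :- con +0) refl
    ; 0-homo = refl , refl
    ; 1-homo = refl , refl
    }

module DualLaws {κ ℓ₁ ℓ₂} (ℝ : RealClosedField κ ℓ₁ ℓ₂) where
  open RealClosedField ℝ hiding (zero) renaming (commutativeRing to K)
  open OrderedField ℝ
  open Monotonicity ℝ
  open Integers K
  open CharacteristicLaws K
  open DualNumbers K
  module ε = CharacteristicLaws dual
  open SetoidReasoning setoid

  -- Coefficients of ε at x + c ε. The speed c is 1 for ordinary derivatives and 1 - 1 / σ² when x
  -- is σ + 1 / σ and σ varies.
  P′ F′ : Tree → Carrier → Carrier → Carrier
  P′ t x c = proj₂ (ε.P t (x , c))
  F′ t x c = proj₂ (ε.F t (x , c))

  P-real : ∀ t x c → proj₁ (ε.P t (x , c)) ≡ P t x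
  F-real : ∀ t x c → proj₁ (ε.F t (x , c)) ≡ F t x
  P-real •       x c = ≡.refl
  P-real (t ⊕ s) x c = ≡.cong₂ _-_ (≡.cong₂ _*_ (P-real t x c) (P-real s x c)) (≡.cong₂ _*_ (F-real t x c) (F-real s x c))
  F-real •       x c = ≡.refl
  F-real (t ⊕ s) x c = ≡.cong₂ _*_ (F-real t x c) (P-real s x c)

  -- F² times the derivative of the root pivot. In contrast to `wronskian`, its recursion has
  -- squares as coefficients, so its sign is known at every x, whatever the signs of the pivots.
  W : Tree → Carrier → Carrier → Carrier
  W t x c = P′ t x c * F t x - P t x * F′ t x c

  private
    W-⊕ : ∀ t s x c → W (t ⊕ s) x c ≈ P s x * P s x * W t x c + F t x * F t x * W s x c
    W-⊕ t s x c rewrite P-real t x c | F-real t x c | P-real s x c | F-real s x c =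
      solve 8 (λ pt ft ps fs pt′ ft′ ps′ fs′ →
          (pt :* ps′ :+ pt′ :* ps :- (ft :* fs′ :+ ft′ :* fs)) :* (ft :* ps) :- (pt :* ps :- ft :* fs) :* (ft :* ps′ :+ ft′ :* ps)
          := ps :* ps :* (pt′ :* ft :- pt :* ft′) :+ ft :* ft :* (ps′ :* fs :- ps :* fs′)) refl
        (P t x) (F t x) (P s x) (F s x) (P′ t x c) (F′ t x c) (P′ s x c) (F′ s x c)

    W-• : ∀ x c → W • x c ≈ c
    W-• x c = solve 2 (λ x c → c :* con (+ 1) :- x :* con +0 := c) refl x c

  W-nonneg : ∀ t {x c} → 0< c → 0≤ W t x c
  W-nonneg •       {x} {c} 0<c = inj₁ (0<-resp (sym (W-• x c)) 0<c)
  W-nonneg (t ⊕ s) {x} {c} 0<c = 0≤-resp (sym (W-⊕ t s x c))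
    (+-nonneg (*-nonneg (square-nonneg (P s x)) (W-nonneg t 0<c)) (*-nonneg (square-nonneg (F t x)) (W-nonneg s 0<c)))

  -- By cases on which of `P s` and `F t` vanish: either a nonzero square multiplies a part without
  -- a common zero of its `P` and `F`, or `P` and `F` of `t ⊕ s` both vanish, against the
  -- hypothesis.
  W-pos : ∀ t {x c} → 0< c → P t x ≉ 0# ⊎ F t x ≉ 0# → 0< W t x c
  W-pos •       {x} {c} 0<c _  = 0<-resp (sym (W-• x c)) 0<c
  W-pos (t ⊕ s) {x} {c} 0<c ne = 0<-resp (sym (W-⊕ t s x c)) (by-cases (≉0-or-≈0 (P s x)) (≉0-or-≈0 (F t x)) (≉0-or-≈0 (P t x)))
    where
    both-zero : P (t ⊕ s) x ≈ 0# → F (t ⊕ s) x ≈ 0# → ∀ {a} {A : Set a} → A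
    both-zero P≈0 F≈0 = ⊥-elim (Sum.[ (λ P≉0 → P≉0 P≈0) , (λ F≉0 → F≉0 F≈0) ]′ ne)
    difference : ∀ {a b} → a ≈ 0# → b ≈ 0# → a - b ≈ 0#
    difference a≈0 b≈0 = trans (+-cong a≈0 (-‿cong b≈0)) (-‿inverseʳ 0#)
    by-cases : P s x ≉ 0# ⊎ P s x ≈ 0# → F t x ≉ 0# ⊎ F t x ≈ 0# → P t x ≉ 0# ⊎ P t x ≈ 0# →
               0< P s x * P s x * W t x c + F t x * F t x * W s x c
    by-cases (inj₁ Ps≉0) (inj₁ Ft≉0) _ =
      +-pos-nonneg (*-pos (square-pos Ps≉0) (W-pos t 0<c (inj₂ Ft≉0))) (*-nonneg (square-nonneg (F t x)) (W-nonneg s 0<c))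
    by-cases (inj₁ Ps≉0) (inj₂ _) (inj₁ Pt≉0) =
      +-pos-nonneg (*-pos (square-pos Ps≉0) (W-pos t 0<c (inj₁ Pt≉0))) (*-nonneg (square-nonneg (F t x)) (W-nonneg s 0<c))
    by-cases (inj₁ Ps≉0) (inj₂ Ft≈0) (inj₂ Pt≈0) = both-zero (difference (0· Pt≈0) (0· Ft≈0)) (0· Ft≈0)
    by-cases (inj₂ Ps≈0) (inj₂ Ft≈0) _ = both-zero (difference (·0 Ps≈0) (0· Ft≈0)) (0· Ft≈0)
    by-cases (inj₂ Ps≈0) (inj₁ Ft≉0) _ =
      +-nonneg-pos (*-nonneg (square-nonneg (P s x)) (W-nonneg t 0<c)) (*-pos (square-pos Ft≉0) (W-pos s 0<c (inj₂ Fs≉0)))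
      where
      Fs≉0 : F s x ≉ 0#
      Fs≉0 Fs≈0 = both-zero (difference (·0 Ps≈0) (·0 Fs≈0)) (·0 Ps≈0)

  module D = Evaluation constant

  derivative : List Carrier → Carrier → Carrier
  derivative p x = proj₂ (D.ev p (x , 1#))

  D-real : ∀ p x c → proj₁ (D.ev p (x , c)) ≡ ev p x
  D-real []      x c = ≡.refl
  D-real (a ∷ p) x c = ≡.cong (λ y → a + x * y) (D-real p x c)

  derivative-factor : ∀ p a → ev p a ≈ 0# → ∀ x → derivative p x ≈ (x - a) * derivative (quot a p) x + ev (quot a p) x
  derivative-factor p a pa≈0 x = begin
    derivative p x
      ≈⟨ proj₂ (D.ev-quot p a (x , 1#)) ⟩
    (x - a) * derivative (quot a p) x + (1# - 0#) * proj₁ (D.ev (quot a p) (x , 1#)) + proj₂ (D.ev p (a , 0#))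
      ≈⟨ +-cong (+-congˡ (*-congˡ (reflexive (D-real (quot a p) x 1#)))) (sym (proj₂ (D.ev-eval p a))) ⟩
    (x - a) * derivative (quot a p) x + (1# - 0#) * ev (quot a p) x + 0#
      ≈⟨ solve 3 (λ d q′ q → d :* q′ :+ (con (+ 1) :- con +0) :* q :+ con +0 := d :* q′ :+ q) refl (x - a) (derivative (quot a p) x) (ev (quot a p) x) ⟩
    (x - a) * derivative (quot a p) x + ev (quot a p) x ∎

  -- Between two zeros with positive derivatives there is a third; divide by the leftmost and repeat.

  no-two-ascending-roots : ∀ n p → length p ℕ.≤ n → ∀ {a b} → a < b → ev p a ≈ 0# → ev p b ≈ 0# →
    (∀ x → ¬ x < a → ¬ b < x → ev p x ≈ 0# → 0< derivative p x) → ⊥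
  no-two-ascending-roots n []        p≤n {a} a<b pa≈0 pb≈0 ascending = 0<⇒≉0 (ascending a (<-irrefl refl) (<-asym a<b) refl) refl
  no-two-ascending-roots (suc n) p@(_ ∷ _) p≤n {a} {b} a<b pa≈0 pb≈0 ascending =
    let z , a<z , z<b , rz≈0 = root-between {ev r} (r , λ _ → refl) a<b 0<-ra 0<rb
    in no-two-ascending-roots n q (length-≤ p a p≤n) z<b
         (trans (factor q b qb≈0 z) (·0 rz≈0)) qb≈0
         λ x x≮z b≮x qx≈0 → let a<x = beyond a<z x≮z in
           0<-cancelˡ (<⇒0< a<x) (0<-resp (trans (derivative-factor p a pa≈0 x) (trans (+-congˡ qx≈0) (+-identityʳ _)))
             (ascending x (<-asym a<x) b≮x (trans (factor p a pa≈0 x) (·0 qx≈0))))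
    where
    q = quot a p
    length-≤ : ∀ {n} p a → length p ℕ.≤ suc n → length (quot a p) ℕ.≤ n
    length-≤ p a p≤n = ≡.subst (ℕ._≤ _) (≡.sym (length-quot p a)) (ℕ.pred-mono-≤ p≤n)
    beyond : ∀ {x z} → a < z → ¬ x < z → a < x
    beyond {x} {z} a<z x≮z with compare x z
    ... | tri< x<z _ _ = contradiction x<z x≮z
    ... | tri≈ _ x≈z _ = <-respʳ-≈ (sym x≈z) a<z
    ... | tri> _ _ z<x = <-trans a<z z<x
    qb≈0 : ev q b ≈ 0#
    qb≈0 = *-cancel-0 (0<⇒≉0 (<⇒0< a<b)) (trans (sym (factor p a pa≈0 b)) pb≈0)
    r = quot b q
    0<qa : 0< ev q a
    0<qa = 0<-resp (trans (derivative-factor p a pa≈0 a) (solve 3 (λ a d q → (a :- a) :* d :+ q := q) refl a (derivative q a) (ev q a)))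
      (ascending a (<-irrefl refl) (<-asym a<b) pa≈0)
    0<-ra : 0< - ev r a
    0<-ra = 0<-cancelˡ (<⇒0< a<b) (0<-resp (trans (factor q b qb≈0 a) (solve 3 (λ a b r → (a :- b) :* r := (b :- a) :* :- r) refl a b (ev r a))) 0<qa)
    0<q′b : 0< derivative q b
    0<q′b = 0<-cancelˡ (<⇒0< a<b) (0<-resp (trans (derivative-factor p a pa≈0 b) (trans (+-congˡ qb≈0) (+-identityʳ _)))
      (ascending b (<-asym a<b) (<-irrefl refl) pb≈0))
    0<rb : 0< ev r b
    0<rb = 0<-resp (trans (derivative-factor q b qb≈0 b) (solve 3 (λ b d q → (b :- b) :* d :+ q := q) refl b (derivative r b) (ev r b))) 0<q′b

  private
    F-list : Tree → List Carrier
    F-list t = proj₁ (F-polynomial t)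

    F-derivative : ∀ t x → derivative (F-list t) x ≈ F′ t x 1#
    F-derivative t x = proj₂ (CommutativeRing.trans dual (F-homo (D.at (x , 1#)) t X) (ε.F-cong t (D.ev-X (x , 1#))))

  -- W = P′ F − P F′ > 0 forces F′ to have the sign of − P at every zero of F.

  two-zeros-of-F : ∀ t {a b} → a < b → F t a ≈ 0# → F t b ≈ 0# → (∀ x → ¬ x < a → ¬ b < x → P t x ≉ 0#) → ⊥
  two-zeros-of-F t {a} {b} a<b Fa≈0 Fb≈0 P≉0 = by-sign (sign (P t a))
    where
    F-value : ∀ x → ev (F-list t) x ≈ F t x
    F-value = proj₂ (F-polynomial t)
    a-to-x : ∀ {x} → ¬ x < a → a < x ⊎ a ≈ x
    a-to-x {x} x≮a with compare x a
    ... | tri< x<a _ _ = contradiction x<a x≮a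
    ... | tri≈ _ x≈a _ = inj₂ (sym x≈a)
    ... | tri> _ _ a<x = inj₁ a<x
    0<-PF′ : ∀ x → P t x ≉ 0# → F t x ≈ 0# → 0< - (P t x * F′ t x 1#)
    0<-PF′ x Px≉0 Fx≈0 = 0<-resp (trans (+-congʳ (·0 Fx≈0)) (+-identityˡ _)) (W-pos t 0<1 (inj₁ Px≉0))
    by-sign : Sign (P t a) → ⊥
    by-sign (nul Pa≈0) = P≉0 a (<-irrefl refl) (<-asym a<b) Pa≈0
    by-sign (pos 0<Pa) = no-two-ascending-roots _ (map -_ (F-list t)) ℕ.≤-refl a<b (root a Fa≈0) (root b Fb≈0)
      λ x x≮a b≮x Fx≈0 → 0<-resp (sym (derivative-neg x))
        (0<-cancelˡ (0<P x x≮a b≮x) (0<-resp (trans (solve 2 (λ p f → :- (p :* f) := p :* :- f) refl (P t x) (F′ t x 1#)) refl)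
          (0<-PF′ x (P≉0 x x≮a b≮x) (trans (trans (sym (F-value x)) (trans (solve 1 (λ f → f := :- :- f) refl (ev (F-list t) x))
            (-‿cong (trans (sym (ev-neg (F-list t) x)) Fx≈0)))) -0#≈0#))))
      where
      root : ∀ x → F t x ≈ 0# → ev (map -_ (F-list t)) x ≈ 0#
      root x Fx≈0 = trans (ev-neg (F-list t) x) (trans (-‿cong (trans (F-value x) Fx≈0)) -0#≈0#)
      derivative-neg : ∀ x → derivative (map -_ (F-list t)) x ≈ - F′ t x 1#
      derivative-neg x = trans (proj₂ (D.ev-neg (F-list t) (x , 1#))) (-‿cong (F-derivative t x))
      0<P : ∀ x → ¬ x < a → ¬ b < x → 0< P t x
      0<P x x≮a b≮x with sign (P t x) | a-to-x x≮a
      ... | pos 0<Px  | _ = 0<Px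
      ... | nul Px≈0  | _ = contradiction Px≈0 (P≉0 x x≮a b≮x)
      ... | neg 0<-Px | inj₂ a≈x = contradiction 0<-Px (0<⇒¬0<- (0<-resp (P-cong t a≈x) 0<Pa))
      ... | neg 0<-Px | inj₁ a<x =
        let ξ , a<ξ , ξ<x , -Pξ≈0 = root-between (poly-- (poly-const 0#) (P-polynomial t)) a<x
              (0<-resp (solve 1 (λ p → p := :- (con +0 :- p)) refl (P t a)) 0<Pa) (0<-resp (sym (+-identityˡ _)) 0<-Px)
        in contradiction (trans (solve 1 (λ p → p := :- (con +0 :- p)) refl (P t ξ)) (trans (-‿cong -Pξ≈0) -0#≈0#))
             (P≉0 ξ (<-asym a<ξ) (λ b<ξ → b≮x (<-trans b<ξ ξ<x)))
    by-sign (neg 0<-Pa) = no-two-ascending-roots _ (F-list t) ℕ.≤-refl a<b (trans (F-value a) Fa≈0) (trans (F-value b) Fb≈0)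
      λ x x≮a b≮x Fx≈0 → 0<-resp (sym (F-derivative t x))
        (0<-cancelˡ (0<-P x x≮a b≮x) (0<-resp (solve 2 (λ p f → :- (p :* f) := :- p :* f) refl (P t x) (F′ t x 1#))
          (0<-PF′ x (P≉0 x x≮a b≮x) (trans (sym (F-value x)) Fx≈0))))
      where
      0<-P : ∀ x → ¬ x < a → ¬ b < x → 0< - P t x
      0<-P x x≮a b≮x with sign (P t x) | a-to-x x≮a
      ... | neg 0<-Px | _ = 0<-Px
      ... | nul Px≈0  | _ = contradiction Px≈0 (P≉0 x x≮a b≮x)
      ... | pos 0<Px  | inj₂ a≈x = contradiction (0<-resp (-‿cong (P-cong t a≈x)) 0<-Pa) (0<⇒¬0<- 0<Px)
      ... | pos 0<Px  | inj₁ a<x =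
        let ξ , a<ξ , ξ<x , Pξ≈0 = root-between (P-polynomial t) a<x 0<-Pa 0<Px
        in contradiction Pξ≈0 (P≉0 ξ (<-asym a<ξ) (λ b<ξ → b≮x (<-trans b<ξ ξ<x)))

-- Positions in a term and the graphs it represents.

Pos : Tree → Set
Pos •       = ⊤
Pos (t ⊕ s) = Pos t ⊎ Pos s

top : ∀ t → Pos t
top •       = tt
top (t ⊕ s) = inj₁ (top t)

isTop : ∀ t → Pos t → Bool
isTop •       _        = true
isTop (t ⊕ s) (inj₁ p) = isTop t p
isTop (t ⊕ s) (inj₂ q) = false

edge : ∀ t → Pos t → Pos t → Bool
edge •       _        _        = false
edge (t ⊕ s) (inj₁ p) (inj₁ q) = edge t p q
edge (t ⊕ s) (inj₁ p) (inj₂ q) = isTop t p ∧ isTop s q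
edge (t ⊕ s) (inj₂ p) (inj₁ q) = isTop t q ∧ isTop s p
edge (t ⊕ s) (inj₂ p) (inj₂ q) = edge s p q

isTop-top : ∀ t → isTop t (top t) ≡ true
isTop-top •       = ≡.refl
isTop-top (t ⊕ s) = isTop-top t

isTop⇒top : ∀ t p → isTop t p ≡ true → p ≡ top t
isTop⇒top •       tt       eq = ≡.refl
isTop⇒top (t ⊕ s) (inj₁ p) eq = ≡.cong inj₁ (isTop⇒top t p eq)

order : RootedGraph → ℕ
order T = Graph.order (RootedGraph.graph T)

-- An isomorphism of rooted graphs. As t fixes an order of the branches, one T can be represented by
-- several t.
record Represents (T : RootedGraph) (t : Tree) : Set where
  open Graph (RootedGraph.graph T) using (Vertex; adj)
  field
    place        : Pos t → Vertex
    locate       : Vertex → Pos t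
    place-locate : ∀ v → place (locate v) ≡ v
    locate-place : ∀ p → locate (place p) ≡ p
    edges        : ∀ p q → adj (place p) (place q) ≡ edge t p q
    roots        : place (top t) ≡ RootedGraph.root T

  isTop-locate : ∀ v → does (v Fin.≟ RootedGraph.root T) ≡ isTop t (locate v)
  isTop-locate v with v Fin.≟ RootedGraph.root T
  ... | yes v≡r = ≡.sym (≡.trans (≡.cong (isTop t) (≡.trans (≡.cong locate (≡.trans v≡r (≡.sym roots))) (locate-place (top t)))) (isTop-top t))
  ... | no  v≢r with isTop t (locate v) in eq
  ...   | false = ≡.refl
  ...   | true  = contradiction (≡.trans (≡.sym (place-locate v)) (≡.trans (≡.cong place (isTop⇒top t (locate v) eq)) roots)) v≢r

enumerate : ∀ t → Pos t ↔ Fin (size t)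
enumerate •       = mk↔ₛ′ (λ _ → zero) (λ _ → tt) (λ { zero → ≡.refl }) (λ _ → ≡.refl)
enumerate (t ⊕ s) = Composition.inverse (enumerate t ⊎-↔ enumerate s) (Symmetry.inverse Fin.+↔⊎)

module PositionFold {κ ℓ} (M : CommutativeMonoid κ ℓ) where
  open CommutativeMonoid M
  open RawMonoidDefs rawMonoid using (sum)
  open MonoidSum M using (sum-permute)
  open SetoidReasoning setoid

  -- For any commutative monoid: addition gives the sums over neighbours, multiplication the product
  -- of the pivots.
  fold : ∀ t → (Pos t → Carrier) → Carrier
  fold •       f = f tt
  fold (t ⊕ s) f = fold t (f ∘ inj₁) ∙ fold s (f ∘ inj₂)

  fold-cong : ∀ t {f g} → (∀ p → f p ≈ g p) → fold t f ≈ fold t g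
  fold-cong •       f≈g = f≈g tt
  fold-cong (t ⊕ s) f≈g = ∙-cong (fold-cong t (f≈g ∘ inj₁)) (fold-cong s (f≈g ∘ inj₂))

  private
    sum-++ : ∀ m n (f : Fin (m ℕ.+ n) → Carrier) → sum f ≈ sum (λ i → f (i ↑ˡ n)) ∙ sum (λ j → f (m ↑ʳ j))
    sum-++ zero    n f = sym (identityˡ _)
    sum-++ (suc m) n f = trans (∙-congˡ (sum-++ m n (f ∘ suc))) (sym (assoc _ _ _))

    sum-enumerate : ∀ t (f : Fin (size t) → Carrier) → sum f ≈ fold t (f ∘ Inverse.to (enumerate t))
    sum-enumerate •       f = identityʳ _
    sum-enumerate (t ⊕ s) f = trans (sum-++ (size t) (size s) f)
      (∙-cong (sum-enumerate t (λ i → f (i ↑ˡ size s))) (sum-enumerate s (λ j → f (size t ↑ʳ j))))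

  sum-by-position : ∀ {T t} (ρ : Represents T t) (f : Fin (order T) → Carrier) → sum f ≈ fold t (f ∘ Represents.place ρ)
  sum-by-position {T} {t} ρ f = begin
    sum f                                                             ≈⟨ sum-permute f π ⟩
    sum (λ i → f (π ⟨$⟩ʳ i))                                          ≈⟨ sum-enumerate t (λ i → f (π ⟨$⟩ʳ i)) ⟩
    fold t (λ p → f (place (Inverse.from (enumerate t) (Inverse.to (enumerate t) p))))
      ≈⟨ fold-cong t (λ p → reflexive (≡.cong (f ∘ place) (Inverse.strictlyInverseʳ (enumerate t) p))) ⟩
    fold t (f ∘ place)                                                ∎
    where
    open Represents ρ
    π : Permutation (size t) (order T)
    π = Composition.inverse (Symmetry.inverse (enumerate t)) (mk↔ₛ′ place locate place-locate locate-place)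

-- The eigenvalue equation, read recursively along the tree.

module TreeSums {κ ℓ} (K : CommutativeRing κ ℓ) where
  open CommutativeRing K hiding (zero)
  open RawMonoidDefs +-rawMonoid using (sum)
  open PositionFold +-commutativeMonoid public using (sum-by-position) renaming (fold to ΣPos; fold-cong to ΣPos-cong)
  open SetoidReasoning setoid

  ΣPos-zero : ∀ t → ΣPos t (λ _ → 0#) ≈ 0#
  ΣPos-zero •       = refl
  ΣPos-zero (t ⊕ s) = trans (+-cong (ΣPos-zero t) (ΣPos-zero s)) (+-identityˡ 0#)

  δ : Bool → Carrier → Carrier
  δ b c = if b then c else 0#

  private
    indicator : Bool → Carrier
    indicator b = if b then 1# else 0#

    δ-+ : ∀ b c d → δ b c + δ b d ≈ δ b (c + d)
    δ-+ true  c d = refl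
    δ-+ false c d = +-identityˡ 0#

    δ-cong : ∀ b {c d} → c ≈ d → δ b c ≈ δ b d
    δ-cong true  c≈d = c≈d
    δ-cong false c≈d = refl

  -- f satisfies A f = x f, except that at the root c is added to A f.

  Solves : (t : Tree) → (Pos t → Carrier) → Carrier → Carrier → Set ℓ
  Solves •       f x c = c ≈ x * f tt
  Solves (t ⊕ s) f x c = Solves t (f ∘ inj₁) x (c + f (inj₂ (top s))) × Solves s (f ∘ inj₂) x (f (inj₁ (top t)))

  Solves-cong : ∀ t {f g x c d} → (∀ p → f p ≈ g p) → c ≈ d → Solves t f x c → Solves t g x d
  Solves-cong •       f≈g c≈d eq        = trans (sym c≈d) (trans eq (*-congˡ (f≈g tt)))
  Solves-cong (t ⊕ s) f≈g c≈d (eq , eq′) =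
    Solves-cong t (f≈g ∘ inj₁) (+-cong c≈d (f≈g (inj₂ (top s)))) eq ,
    Solves-cong s (f≈g ∘ inj₂) (f≈g (inj₁ (top t))) eq′

  neighbourSum : (t : Tree) → (Pos t → Carrier) → Pos t → Carrier
  neighbourSum t f p = ΣPos t λ q → indicator (edge t p q) * f q

  private
    ΣPos-top : ∀ t b (f : Pos t → Carrier) → ΣPos t (λ q → indicator (b ∧ isTop t q) * f q) ≈ δ b (f (top t))
    ΣPos-top t       false f = trans (ΣPos-cong t λ q → zeroˡ (f q)) (ΣPos-zero t)
    ΣPos-top •       true  f = *-identityˡ _
    ΣPos-top (t ⊕ s) true  f = trans (+-cong (ΣPos-top t true (f ∘ inj₁)) (trans (ΣPos-cong s λ q → zeroˡ (f (inj₂ q))) (ΣPos-zero s))) (+-identityʳ _)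

    branch-sum : ∀ t s f p c → neighbourSum (t ⊕ s) f (inj₁ p) + δ (isTop t p) c ≈ neighbourSum t (f ∘ inj₁) p + δ (isTop t p) (c + f (inj₂ (top s)))
    branch-sum t s f p c = begin
      neighbourSum t (f ∘ inj₁) p + ΣPos s (λ q → indicator (isTop t p ∧ isTop s q) * f (inj₂ q)) + δ (isTop t p) c
        ≈⟨ +-congʳ (+-congˡ (ΣPos-top s (isTop t p) (f ∘ inj₂))) ⟩
      neighbourSum t (f ∘ inj₁) p + δ (isTop t p) (f (inj₂ (top s))) + δ (isTop t p) c
        ≈⟨ +-assoc _ _ _ ⟩
      neighbourSum t (f ∘ inj₁) p + (δ (isTop t p) (f (inj₂ (top s))) + δ (isTop t p) c)
        ≈⟨ +-congˡ (trans (δ-+ (isTop t p) _ _) (δ-cong (isTop t p) (+-comm _ _))) ⟩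
      neighbourSum t (f ∘ inj₁) p + δ (isTop t p) (c + f (inj₂ (top s))) ∎

    stem-sum : ∀ t s f q → neighbourSum (t ⊕ s) f (inj₂ q) ≈ neighbourSum s (f ∘ inj₂) q + δ (isTop s q) (f (inj₁ (top t)))
    stem-sum t s f q = trans (+-comm _ _) (+-congˡ (trans
      (ΣPos-cong t λ p → reflexive (≡.cong (λ b → indicator b * f (inj₁ p)) (Bool.∧-comm (isTop t p) (isTop s q))))
      (ΣPos-top t (isTop s q) (f ∘ inj₁))))

  Solves⇒ : ∀ t {f x c} → Solves t f x c → ∀ p → neighbourSum t f p + δ (isTop t p) c ≈ x * f p
  Solves⇒ •       {f} eq         tt       = trans (+-congʳ (zeroˡ (f tt))) (trans (+-identityˡ _) eq)
  Solves⇒ (t ⊕ s) {f} (eq , eq′) (inj₁ p) = trans (branch-sum t s f p _) (Solves⇒ t eq p)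
  Solves⇒ (t ⊕ s) {f} (eq , eq′) (inj₂ q) = trans (+-identityʳ _) (trans (stem-sum t s f q) (Solves⇒ s eq′ q))

  ⇒Solves : ∀ t {f x c} → (∀ p → neighbourSum t f p + δ (isTop t p) c ≈ x * f p) → Solves t f x c
  ⇒Solves •       {f} eq = trans (sym (trans (+-congʳ (zeroˡ (f tt))) (+-identityˡ _))) (eq tt)
  ⇒Solves (t ⊕ s) {f} eq =
    ⇒Solves t (λ p → trans (sym (branch-sum t s f p _)) (eq (inj₁ p))) ,
    ⇒Solves s (λ q → trans (sym (stem-sum t s f q)) (trans (sym (+-identityʳ _)) (eq (inj₂ q))))

  SolvesGraph : (T : RootedGraph) → (Fin (order T) → Carrier) → Carrier → Carrier → Set ℓ
  SolvesGraph T v x c = ∀ i → sum (λ j → adjacency rawRing (RootedGraph.graph T) i j * v j) + δ (does (i Fin.≟ RootedGraph.root T)) c ≈ x * v i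

  module _ {T t} (ρ : Represents T t) where
    open Represents ρ

    private
      sum≈neighbourSum : ∀ v p → sum (λ j → adjacency rawRing (RootedGraph.graph T) (place p) j * v j) ≈ neighbourSum t (v ∘ place) p
      sum≈neighbourSum v p = trans (sum-by-position ρ (λ j → adjacency rawRing (RootedGraph.graph T) (place p) j * v j))
        (ΣPos-cong t λ q → reflexive (≡.cong (λ b → indicator b * v (place q)) (edges p q)))

      lhs : ∀ v c p → sum (λ j → adjacency rawRing (RootedGraph.graph T) (place p) j * v j) + δ (does (place p Fin.≟ RootedGraph.root T)) c
        ≈ neighbourSum t (v ∘ place) p + δ (isTop t p) c
      lhs v c p = +-cong (sum≈neighbourSum v p) (reflexive (≡.cong (λ b → δ b c) (≡.trans (isTop-locate (place p)) (≡.cong (isTop t) (locate-place p)))))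

    graph⇒tree : ∀ {v x c} → SolvesGraph T v x c → Solves t (v ∘ place) x c
    graph⇒tree {v} {x} {c} eq = ⇒Solves t λ p → trans (sym (lhs v c p)) (eq (place p))

    tree⇒graph : ∀ {f x c} → Solves t f x c → SolvesGraph T (f ∘ locate) x c
    tree⇒graph {f} {x} {c} eq i = ≡.subst
      (λ i → sum (λ j → adjacency rawRing (RootedGraph.graph T) i j * f (locate j)) + δ (does (i Fin.≟ RootedGraph.root T)) c ≈ x * f (locate i))
      (place-locate i) (trans (lhs (f ∘ locate) c (locate i)) (Solves⇒ t (Solves-cong t (λ p → reflexive (≡.cong f (≡.sym (locate-place p)))) refl eq) (locate i)))

module TreeEigenvectors {κ ℓ₁ ℓ₂} (ℝ : RealClosedField κ ℓ₁ ℓ₂) where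
  open RealClosedField ℝ hiding (zero) renaming (commutativeRing to K)
  open OrderedField ℝ
  open Integers K
  open CharacteristicLaws K
  open TreeSums K
  open SetoidReasoning setoid

  -- Cramer's rule: f solves (x - A) f = c e with e the unit vector of the root, and `F` is the
  -- corresponding minor of x - A. Multiplied out, it holds also where P = 0.
  root-value : ∀ t {f x c} → Solves t f x c → P t x * f (top t) ≈ F t x * c
  root-value •       {f} {x} {c} eq        = trans (sym eq) (sym (*-identityˡ c))
  root-value (t ⊕ s) {f} {x} {c} (eq , eq′) = begin
    (P t x * P s x - F t x * F s x) * a
      ≈⟨ solve 5 (λ pt ps ft fs a → (pt :* ps :- ft :* fs) :* a := ps :* (pt :* a) :- ft :* (fs :* a)) refl (P t x) (P s x) (F t x) (F s x) a ⟩
    P s x * (P t x * a) - F t x * (F s x * a)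
      ≈⟨ +-cong (*-congˡ (root-value t eq)) (-‿cong (*-congˡ (sym (root-value s eq′)))) ⟩
    P s x * (F t x * (c + b)) - F t x * (P s x * b)
      ≈⟨ solve 4 (λ ps ft c b → ps :* (ft :* (c :+ b)) :- ft :* (ps :* b) := ft :* ps :* c) refl (P s x) (F t x) c b ⟩
    F t x * P s x * c ∎
    where
    a = f (inj₁ (top t))
    b = f (inj₂ (top s))

  Solves-scale : ∀ t a {f x c} → Solves t f x c → Solves t (λ p → a * f p) x (a * c)
  Solves-scale •       a {f} {x} eq = trans (*-congˡ eq) (solve 3 (λ a x f → a :* (x :* f) := x :* (a :* f)) refl a x (f tt))
  Solves-scale (t ⊕ s) a (eq , eq′) =
    Solves-cong t (λ _ → refl) (distribˡ a _ _) (Solves-scale t a eq) , Solves-scale s a eq′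

  Solves-- : ∀ t {f g x c d} → Solves t f x c → Solves t g x d → Solves t (λ p → f p - g p) x (c - d)
  Solves-- •       {f} {g} {x} eq eq₁ = trans (+-cong eq (-‿cong eq₁)) (solve 3 (λ x f g → x :* f :- x :* g := x :* (f :- g)) refl x (f tt) (g tt))
  Solves-- (t ⊕ s) (eq , eq′) (eq₁ , eq₁′) =
    Solves-cong t (λ _ → refl) (solve 4 (λ a b c d → a :+ b :- (c :+ d) := a :- c :+ (b :- d)) refl _ _ _ _) (Solves-- t eq eq₁) , Solves-- s eq′ eq₁′

  Solves-zero : ∀ t x → Solves t (λ _ → 0#) x 0#
  Solves-zero •       x = sym (zeroʳ x)
  Solves-zero (t ⊕ s) x = Solves-cong t (λ _ → refl) (sym (+-identityˡ 0#)) (Solves-zero t x) , Solves-zero s x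

  -- The column of the root in the adjugate of x − A.

  φ : ∀ t → Carrier → Pos t → Carrier
  φ •       x _        = 1#
  φ (t ⊕ s) x (inj₁ p) = P s x * φ t x p
  φ (t ⊕ s) x (inj₂ q) = F t x * φ s x q

  φ-top : ∀ t x → φ t x (top t) ≈ F t x
  φ-top •       x = refl
  φ-top (t ⊕ s) x = trans (*-congˡ (φ-top t x)) (*-comm _ _)

  φ-solves : ∀ t x → Solves t (φ t x) x (P t x)
  φ-solves •       x = sym (*-identityʳ x)
  φ-solves (t ⊕ s) x =
    Solves-cong t (λ _ → refl) (trans (solve 4 (λ ps pt ft fs → ps :* pt := pt :* ps :- ft :* fs :+ ft :* fs) refl (P s x) (P t x) (F t x) (F s x))
      (+-congˡ (*-congˡ (sym (φ-top s x))))) (Solves-scale t (P s x) (φ-solves t x)) ,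
    Solves-cong s (λ _ → refl) (trans (*-comm _ _) (*-congˡ (sym (φ-top t x)))) (Solves-scale s (F t x) (φ-solves s x))

  -- Multiplication by the sign of the bipartition, which conjugates A into -A.
  flip : ∀ t → (Pos t → Carrier) → Pos t → Carrier
  flip •       f p        = f p
  flip (t ⊕ s) f (inj₁ p) = flip t (f ∘ inj₁) p
  flip (t ⊕ s) f (inj₂ q) = - flip s (f ∘ inj₂) q

  flip-top : ∀ t f → flip t f (top t) ≡ f (top t)
  flip-top •       f = ≡.refl
  flip-top (t ⊕ s) f = flip-top t (f ∘ inj₁)

  flip-cong : ∀ t {f g} → (∀ p → f p ≈ g p) → ∀ p → flip t f p ≈ flip t g p
  flip-cong •       f≈g p        = f≈g p
  flip-cong (t ⊕ s) f≈g (inj₁ p) = flip-cong t (f≈g ∘ inj₁) p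
  flip-cong (t ⊕ s) f≈g (inj₂ q) = -‿cong (flip-cong s (f≈g ∘ inj₂) q)

  flip-scale : ∀ t a f p → flip t (λ p → a * f p) p ≈ a * flip t f p
  flip-scale •       a f p        = refl
  flip-scale (t ⊕ s) a f (inj₁ p) = flip-scale t a (f ∘ inj₁) p
  flip-scale (t ⊕ s) a f (inj₂ q) = trans (-‿cong (flip-scale s a (f ∘ inj₂) q)) (solve 2 (λ a f → :- (a :* f) := a :* :- f) refl a _)

  flip-neg : ∀ t f p → flip t (λ p → - f p) p ≈ - flip t f p
  flip-neg t f p = trans (flip-cong t (λ p → solve 1 (λ f → :- f := :- con (+ 1) :* f) refl (f p)) p)
    (trans (flip-scale t (- 1#) f p) (solve 1 (λ f → :- con (+ 1) :* f := :- f) refl _))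

  flip-flip : ∀ t f p → flip t (flip t f) p ≈ f p
  flip-flip •       f p        = refl
  flip-flip (t ⊕ s) f (inj₁ p) = flip-flip t (f ∘ inj₁) p
  flip-flip (t ⊕ s) f (inj₂ q) = trans (-‿cong (flip-neg s (flip s (f ∘ inj₂)) q)) (trans (solve 1 (λ f → :- :- f := f) refl _) (flip-flip s (f ∘ inj₂) q))

  flip-solves : ∀ t {f x c} → Solves t f x c → Solves t (flip t f) (- x) (- c)
  flip-solves •       {f} {x} eq = trans (-‿cong eq) (solve 2 (λ x f → :- (x :* f) := :- x :* f) refl x (f tt))
  flip-solves (t ⊕ s) {f} {x} {c} (eq , eq′) =
    Solves-cong t (λ _ → refl) (trans (solve 2 (λ a b → :- (a :+ b) := :- a :+ :- b) refl _ _)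
      (+-congˡ (-‿cong (reflexive (≡.sym (flip-top s (f ∘ inj₂))))))) (flip-solves t eq) ,
    Solves-cong s (λ q → solve 1 (λ f → :- con (+ 1) :* f := :- f) refl _)
      (trans (solve 1 (λ f → :- con (+ 1) :* :- f := f) refl _) (reflexive (≡.sym (flip-top t (f ∘ inj₁)))))
      (Solves-scale s (- 1#) (flip-solves s eq′))

  private
    singular : ∀ t s {x} → P t x * P s x ≈ 0# → F t x * F s x ≈ 0# → P (t ⊕ s) x ≈ 0#
    singular t s PP≈0 FF≈0 = trans (+-cong PP≈0 (-‿cong FF≈0)) (-‿inverseʳ 0#)

  -- A nonzero value at the top of the branch s would, by `root-value`, force P s = 0 and F t = 0,
  -- hence a common zero of `P` and `F` at t ⊕ s. So this value is 0, and the induction applies to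
  -- both parts.
  solution-vanishes : ∀ t {f x} → Solves t f x 0# → f (top t) ≈ 0# → ¬ (P t x ≈ 0# × F t x ≈ 0#) → ∀ p → f p ≈ 0#
  solution-vanishes •       eq f≈0 ns tt = f≈0
  solution-vanishes (t ⊕ s) {f} {x} (eq , eq′) f≈0 ns = by-cases (≉0-or-≈0 (f (inj₂ (top s))))
    where
    by-cases : f (inj₂ (top s)) ≉ 0# ⊎ f (inj₂ (top s)) ≈ 0# → ∀ p → f p ≈ 0#
    by-cases (inj₁ b≉0) = contradiction (singular t s (·0 Ps≈0) (0· Ft≈0) , 0· Ft≈0) ns
      where
      Ps≈0 : P s x ≈ 0#
      Ps≈0 = *-cancel-0 b≉0 (trans (*-comm _ _) (trans (root-value s eq′) (·0 f≈0)))
      Ft≈0 : F t x ≈ 0#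
      Ft≈0 = *-cancel-0 b≉0 (trans (*-comm _ _) (trans (*-congˡ (sym (+-identityˡ _))) (trans (sym (root-value t eq)) (·0 f≈0))))
    by-cases (inj₂ b≈0) (inj₁ p) = solution-vanishes t (Solves-cong t (λ _ → refl) (trans (+-identityˡ _) b≈0) eq) f≈0
      (λ (Pt≈0 , Ft≈0) → ns (singular t s (0· Pt≈0) (0· Ft≈0) , 0· Ft≈0)) p
    by-cases (inj₂ b≈0) (inj₂ q) = solution-vanishes s (Solves-cong s (λ _ → refl) f≈0 eq′) b≈0
      (λ (Ps≈0 , Fs≈0) → ns (singular t s (·0 Ps≈0) (·0 Fs≈0) , ·0 Ps≈0)) q

  -- Converse to `solution-vanishes`: at a common zero of `P` and `F` either one part has such a
  -- solution already, extended by zero to the other, or two nonsingular parts are glued.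
  singular-solution : ∀ t {x} → P t x ≈ 0# → F t x ≈ 0# → ∃[ f ] Solves t f x 0# × f (top t) ≈ 0# × ∃[ p ] f p ≉ 0#
  singular-solution •       P≈0 F≈0 = contradiction F≈0 (0<⇒≉0 0<1)
  singular-solution (t ⊕ s) {x} P≈0 F≈0 = by-cases (≉0-or-≈0 (P s x)) (≉0-or-≈0 (F s x)) (≉0-or-≈0 (P t x))
    where
    Solution : Set _
    Solution = ∃[ f ] Solves (t ⊕ s) f x 0# × f (top (t ⊕ s)) ≈ 0# × ∃[ p ] f p ≉ 0#
    on-t : F t x ≈ 0# → P t x ≈ 0# → Solution
    on-t Ft≈0 Pt≈0 = let f , eq , f≈0 , p , f≉0 = singular-solution t Pt≈0 Ft≈0 in
      Sum.[ f , (λ _ → 0#) ] , (Solves-cong t (λ _ → refl) (sym (+-identityʳ 0#)) eq , Solves-cong s (λ _ → refl) (sym f≈0) (Solves-zero s x)) , f≈0 , inj₁ p , f≉0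
    by-cases : P s x ≉ 0# ⊎ P s x ≈ 0# → F s x ≉ 0# ⊎ F s x ≈ 0# → P t x ≉ 0# ⊎ P t x ≈ 0# → Solution
    by-cases (inj₁ Ps≉0) _ _ = on-t Ft≈0 (*-cancel-0 Ps≉0 (trans (*-comm _ _)
        (trans (trans (solve 2 (λ p f → p := p :- f :+ f) refl _ (F t x * F s x)) (+-congʳ P≈0)) (trans (+-identityˡ _) (0· Ft≈0)))))
      where
      Ft≈0 : F t x ≈ 0#
      Ft≈0 = *-cancel-0 Ps≉0 (trans (*-comm _ _) F≈0)
    by-cases (inj₂ Ps≈0) (inj₂ Fs≈0) _ = let f , eq , f≈0 , p , f≉0 = singular-solution s Ps≈0 Fs≈0 in
      Sum.[ (λ _ → 0#) , f ] , (Solves-cong t (λ _ → refl) (sym (trans (+-identityˡ _) f≈0)) (Solves-zero t x) , eq) , refl , inj₂ p , f≉0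
    by-cases (inj₂ Ps≈0) (inj₁ Fs≉0) Pt-cases = with-P Pt-cases
      where
      Ft≈0 : F t x ≈ 0#
      Ft≈0 = *-cancel-0 Fs≉0 (trans (*-comm _ _) (trans (solve 2 (λ p f → f := p :- (p :- f)) refl (P t x * P s x) (F t x * F s x))
        (trans (+-cong (·0 Ps≈0) (-‿cong P≈0)) (-‿inverseʳ 0#))))
      with-P : P t x ≉ 0# ⊎ P t x ≈ 0# → Solution
      with-P (inj₂ Pt≈0) = on-t Ft≈0 Pt≈0
      -- The adjugate columns of the two parts, scaled by F s and P t: the value P t F s at the top
      -- of the branch is exactly what the equation at the root of the stem demands, and F t = P s =
      -- 0 settles the rest.
      with-P (inj₁ Pt≉0) = Sum.[ (λ p → F s x * φ t x p) , (λ q → P t x * φ s x q) ] ,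
        ( Solves-cong t (λ _ → refl) (trans (*-comm _ _) (trans (*-congˡ (sym (φ-top s x))) (sym (+-identityˡ _)))) (Solves-scale t (F s x) (φ-solves t x))
        , Solves-cong s (λ _ → refl) (trans (·0 Ps≈0) (sym (·0 (trans (φ-top t x) Ft≈0)))) (Solves-scale s (P t x) (φ-solves s x))) ,
        ·0 (trans (φ-top t x) Ft≈0) ,
        inj₂ (top s) , λ eq → *-≉0 Pt≉0 Fs≉0 (trans (*-congˡ (sym (φ-top s x))) eq)

  kernel : ∀ t {x} → P t x ≈ 0# → ∃[ f ] Solves t f x 0# × ∃[ p ] f p ≉ 0#
  kernel t {x} P≈0 = by-cases (≉0-or-≈0 (F t x))
    where
    by-cases : F t x ≉ 0# ⊎ F t x ≈ 0# → ∃[ f ] Solves t f x 0# × ∃[ p ] f p ≉ 0#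
    by-cases (inj₁ F≉0) = φ t x , Solves-cong t (λ _ → refl) P≈0 (φ-solves t x) , top t , λ eq → F≉0 (trans (sym (φ-top t x)) eq)
    by-cases (inj₂ F≈0) = let f , eq , _ , p , f≉0 = singular-solution t P≈0 F≈0 in f , eq , p , f≉0

  kernel⇒P≈0 : ∀ t {f x} → Solves t f x 0# → (∃[ p ] f p ≉ 0#) → P t x ≈ 0#
  kernel⇒P≈0 t {f} {x} eq (p , f≉0) = by-cases (≉0-or-≈0 (P t x))
    where
    by-cases : P t x ≉ 0# ⊎ P t x ≈ 0# → P t x ≈ 0#
    by-cases (inj₂ P≈0) = P≈0
    by-cases (inj₁ P≉0) = contradiction
      (solution-vanishes t eq (*-cancel-0 P≉0 (trans (root-value t eq) (zeroʳ _))) (λ (P≈0 , _) → P≉0 P≈0) p) f≉0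

-- Zeros of the characteristic polynomial of two joined trees.

module JoinedTrees {κ ℓ₁ ℓ₂} (ℝ : RealClosedField κ ℓ₁ ℓ₂) where
  open RealClosedField ℝ hiding (zero) renaming (commutativeRing to K)
  open OrderedField ℝ
  open Monotonicity ℝ
  open Integers K
  open CharacteristicLaws K
  open SetoidReasoning setoid

  below-index : ∀ t {x y} → Positive t x → x < y → Index t y → 0< - P t x
  below-index t {x} {y} pt x<y (_ , Py≈0) with sign (P t x)
  ... | pos 0<P  = contradiction Py≈0 (0<⇒≉0 (P-rises t pt x<y (inj₁ 0<P)))
  ... | nul P≈0  = contradiction Py≈0 (0<⇒≉0 (P-rises t pt x<y (inj₂ P≈0)))
  ... | neg 0<-P = 0<-P

  private
    zero⇒product : ∀ t s {x} → P (t ⊕ s) x ≈ 0# → P t x * P s x ≈ F t x * F s x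
    zero⇒product t s Px≈0 = x-y≈0⇒x≈y Px≈0

    -- For two increasing quotients p / f and q / g that are positive at the first point, the
    -- product increases; all denominators are cleared.
    product-rises : ∀ {p₁ f₁ q₁ g₁ p₂ f₂ q₂ g₂} → 0< p₂ * f₁ - p₁ * f₂ → 0< q₂ * g₁ - q₁ * g₂ →
      0< p₁ → 0< q₁ → 0< f₁ → 0< f₂ → 0< g₁ → 0< g₂ → 0< p₂ * q₂ * (f₁ * g₁) - p₁ * q₁ * (f₂ * g₂)
    product-rises {p₁} {f₁} {q₁} {g₁} {p₂} {f₂} {q₂} {g₂} d e 0<p 0<q 0<f₁ 0<f₂ 0<g₁ 0<g₂ = 0<-resp
      (solve 8 (λ p₁ f₁ q₁ g₁ p₂ f₂ q₂ g₂ → (p₂ :* f₁ :- p₁ :* f₂) :* (q₂ :* g₁ :- q₁ :* g₂) :+ (p₁ :* f₂ :* (q₂ :* g₁ :- q₁ :* g₂) :+ q₁ :* g₂ :* (p₂ :* f₁ :- p₁ :* f₂))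
        := p₂ :* q₂ :* (f₁ :* g₁) :- p₁ :* q₁ :* (f₂ :* g₂)) refl p₁ f₁ q₁ g₁ p₂ f₂ q₂ g₂)
      (+-pos (*-pos d e) (+-pos (*-pos (*-pos 0<p 0<f₂) e) (*-pos (*-pos 0<q 0<g₂) d)))

  both-positive-unique : ∀ t s {x y} → Positive t x → Positive s x → x < y → 0< P t x → 0< P s x →
    P (t ⊕ s) x ≈ 0# → P (t ⊕ s) y ≈ 0# → ⊥
  both-positive-unique t s {x} {y} pt ps x<y 0<Pt 0<Ps Px≈0 Py≈0 = 0<⇒≉0
    (product-rises (rises-strictly t pt x<y) (rises-strictly s ps x<y) 0<Pt 0<Ps
      (F-pos t pt) (F-pos t (proj₁ (rises t pt x<y))) (F-pos s ps) (F-pos s (proj₁ (rises s ps x<y))))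
    (trans (+-cong (*-congʳ (zero⇒product t s Py≈0)) (-‿cong (*-congʳ (zero⇒product t s Px≈0))))
      (solve 2 (λ a b → a :* b :- b :* a := con +0) refl (F t y * F s y) (F t x * F s x)))

  -- To the left of y both pivots are still more negative, so their product, which is 1 at y,
  -- exceeds 1 at x. This is `product-rises` for -P with the two points exchanged.
  both-negative-falls : ∀ t s {x y} → Positive t x → Positive s x → x < y → 0< - P t y → 0< - P s y →
    P (t ⊕ s) y ≈ 0# → 0< P (t ⊕ s) x
  both-negative-falls t s {x} {y} pt ps x<y 0<-Pt 0<-Ps Py≈0 = 0<-cancelˡ (*-pos 0<Fty 0<Fsy) (0<-resp
      (trans (+-congˡ (-‿cong (*-congʳ (trans (solve 2 (λ p q → :- p :* :- q := p :* q) refl (P t y) (P s y)) (zero⇒product t s Py≈0)))))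
        (solve 6 (λ p q f g a b → :- p :* :- q :* (a :* b) :- a :* b :* (f :* g) := a :* b :* (p :* q :- f :* g)) refl
          (P t x) (P s x) (F t x) (F s x) (F t y) (F s y)))
      (product-rises (flip t pt) (flip s ps) 0<-Pt 0<-Ps 0<Fty (F-pos t pt) 0<Fsy (F-pos s ps)))
    where
    0<Fty = F-pos t (proj₁ (rises t pt x<y))
    0<Fsy = F-pos s (proj₁ (rises s ps x<y))
    flip : ∀ t → Positive t x → 0< - P t x * F t y - - P t y * F t x
    flip t pt = 0<-resp (solve 4 (λ p f p′ f′ → p′ :* f :- p :* f′ := :- p :* f′ :- :- p′ :* f) refl (P t x) (F t x) (P t y) (F t y)) (rises-strictly t pt x<y)

  -- A branch with eigenvalue a gives the pivot at the root a pole at a, where it tends to −∞ from the right.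

  pole : ∀ t {a} → Branches-bounded t a → F t a ≈ 0# → ∀ m {b} → a < b → ∃[ x ] a < x × x < b × 0≤ - (P t x + m * F t x)
  pole •       _ F≈0 m a<b = contradiction F≈0 (0<⇒≉0 0<1)
  pole (t ⊕ s) {a} (bt , ps , 0≤Ps) FP≈0 m {b} a<b = by-cases (≉0-or-≈0 (F t a))
    where
    Goal = ∃[ x ] a < x × x < b × 0≤ - (P (t ⊕ s) x + m * F (t ⊕ s) x)
    by-cases : F t a ≉ 0# ⊎ F t a ≈ 0# → Goal
    by-cases (inj₂ Ft≈0) =
      let x , a<x , x<b , 0≤ = pole t bt Ft≈0 m a<b in
      x , a<x , x<b , 0≤-resp (solve 5 (λ pt ft ps fs m → :- (pt :+ m :* ft) :* ps :+ ft :* fs := :- (pt :* ps :- ft :* fs :+ m :* (ft :* ps)))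
          refl (P t x) (F t x) (P s x) (F s x) m)
        (+-nonneg (*-nonneg 0≤ (inj₁ (P-rises s ps a<x 0≤Ps)))
          (inj₁ (*-pos (F-pos t (Branches-bounded⇒Positive t bt a<x)) (F-pos s (proj₁ (rises s ps a<x))))))
    -- Here P s = 0 < F s at a, so F s > (b + m) P s persists at some x slightly beyond a. The term
    -- F s / P s then outweighs b + m, and the rest of the pivot is at most x < b.
    by-cases (inj₁ Ft≉0) =
      let x , a<x , x<b , 0<g = stays-positive _ g ℕ.≤-refl a<b (0<-resp (sym (trans (g-value a)
              (trans (+-congˡ (-‿cong (·0 Ps≈0))) (solve 1 (λ f → f :- con +0 := f) refl (F s a))))) (F-pos s ps))
          ptx = Branches-bounded⇒Positive t bt a<x in
      x , a<x , x<b , inj₁ (0<-resp (solve 7 (λ pt ft ps fs m x b →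
            ft :* (fs :- (b :+ m) :* ps) :+ ps :* (x :* ft :- pt :+ (b :- x) :* ft) := :- (pt :* ps :- ft :* fs :+ m :* (ft :* ps)))
          refl (P t x) (F t x) (P s x) (F s x) m x b)
        (+-pos-nonneg (*-pos (F-pos t ptx) (0<-resp (g-value x) 0<g))
          (*-nonneg (inj₁ (P-rises s ps a<x 0≤Ps)) (+-nonneg (P≤xF t ptx) (inj₁ (*-pos (<⇒0< x<b) (F-pos t ptx)))))))
      where
      Ps≈0 : P s a ≈ 0#
      Ps≈0 = *-cancel-0 Ft≉0 FP≈0
      g-poly : IsPolynomial (λ x → F s x - (b + m) * P s x)
      g-poly = poly-- (F-polynomial s) (poly-* (poly-const (b + m)) (P-polynomial s))
      g = proj₁ g-poly
      g-value = proj₂ g-poly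

  SecondZero : Tree → Tree → Carrier → Set _
  SecondZero t s a = ∃[ x ] a < x × P (t ⊕ s) x ≈ 0# × 0< - P t x × 0< - P s x

  module _ (t s : Tree) {a} (bt : Branches-bounded t a) (bs : Branches-bounded s a) where

    private
      positive-t : ∀ {x} → a < x → Positive t x
      positive-t = Branches-bounded⇒Positive t bt
      positive-s : ∀ {x} → a < x → Positive s x
      positive-s = Branches-bounded⇒Positive s bs

    zero-signs : ∀ {x} → a < x → P (t ⊕ s) x ≈ 0# → (0< P t x × 0< P s x) ⊎ (0< - P t x × 0< - P s x)
    zero-signs {x} a<x Px≈0 = by-signs (sign (P t x)) (sign (P s x))
      where
      0<PP : 0< P t x * P s x
      0<PP = 0<-resp (sym (zero⇒product t s Px≈0)) (*-pos (F-pos t (positive-t a<x)) (F-pos s (positive-s a<x)))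
      by-signs : Sign (P t x) → Sign (P s x) → (0< P t x × 0< P s x) ⊎ (0< - P t x × 0< - P s x)
      by-signs (pos p) (pos q) = inj₁ (p , q)
      by-signs (neg p) (neg q) = inj₂ (p , q)
      by-signs (pos p) (neg q) = contradiction (pos*neg p q) (0<⇒¬0<- 0<PP)
      by-signs (neg p) (pos q) = contradiction (neg*pos p q) (0<⇒¬0<- 0<PP)
      by-signs (nul p) _       = contradiction (0· p) (0<⇒≉0 0<PP)
      by-signs _       (nul q) = contradiction (·0 q) (0<⇒≉0 0<PP)

    same-signs⇒equal : ∀ {x y} → a < x → a < y → P (t ⊕ s) x ≈ 0# → P (t ⊕ s) y ≈ 0# →
      (0< P t x × 0< P s x) × (0< P t y × 0< P s y) ⊎ (0< - P t x × 0< - P s x) × (0< - P t y × 0< - P s y) → x ≈ y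
    same-signs⇒equal {x} {y} a<x a<y Px≈0 Py≈0 signs with compare x y
    ... | tri≈ _ x≈y _ = x≈y
    ... | tri< x<y _ _ = ⊥-elim (Sum.[
        (λ ((p , q) , _) → both-positive-unique t s (positive-t a<x) (positive-s a<x) x<y p q Px≈0 Py≈0) ,
        (λ (_ , (p , q)) → 0<⇒≉0 (both-negative-falls t s (positive-t a<x) (positive-s a<x) x<y p q Py≈0) Px≈0) ]′ signs)
    ... | tri> _ _ y<x = ⊥-elim (Sum.[
        (λ (_ , (p , q)) → both-positive-unique t s (positive-t a<y) (positive-s a<y) y<x p q Py≈0 Px≈0) ,
        (λ ((p , q) , _) → 0<⇒≉0 (both-negative-falls t s (positive-t a<y) (positive-s a<y) y<x p q Px≈0) Py≈0) ]′ signs)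

    -- b is the smaller of the two indices.

    second-zero-before : ∀ {x b} → x < b → ¬ x < a → 0< P (t ⊕ s) x → (∀ {y} → a < y → y < b → 0< - P t y × 0< - P s y) →
      a < b → P t b * P s b ≈ 0# → SecondZero t s a
    second-zero-before {x} {b} x<b x≮a 0<Px negative a<b PP≈0 =
      let y , x<y , y<b , Py≈0 = root-between (poly-- (poly-const 0#) (P-polynomial (t ⊕ s))) x<b
            (0<-resp (solve 1 (λ p → p := :- (con +0 :- p)) refl (P (t ⊕ s) x)) 0<Px)
            (0<-resp (trans (solve 1 (λ f → f := con +0 :- (con +0 :- f)) refl _) (+-congˡ (-‿cong (+-congʳ (sym PP≈0)))))
              (*-pos (F-pos t (positive-t a<b)) (F-pos s (positive-s a<b))))
          a<y = above x<y
      in y , a<y , trans (solve 1 (λ p → p := :- (con +0 :- p)) refl (P (t ⊕ s) y)) (trans (-‿cong Py≈0) -0#≈0#) , negative a<y y<b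
      where
      above : ∀ {y} → x < y → a < y
      above x<y with compare x a
      ... | tri< x<a _ _ = contradiction x<a x≮a
      ... | tri≈ _ x≈a _ = <-respˡ-≈ x≈a x<y
      ... | tri> _ _ a<x = <-trans a<x x<y

    -- With m = -F s / P s at d, the pivot of t falls to -m or below at some x between a and d. The
    -- pivot of s at x is below its negative value -1 / m at d, so the product of the two pivots
    -- exceeds 1.
    positive-near-pole : F t a ≈ 0# → ∀ {b} → a < b → (∀ {y} → a < y → y < b → 0< - P t y × 0< - P s y) →
      ∃[ x ] a < x × x < b × 0< P (t ⊕ s) x
    positive-near-pole Ft≈0 {b} a<b negative =
      let d , a<d , d<b = between a<b
          0<-Psd = proj₂ (negative a<d d<b)
          r , -Psd*r≈1 = inverse (0<⇒≉0 0<-Psd)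
          m = F s d * r
          x , a<x , x<d , 0≤ = pole t bt Ft≈0 m a<d
          x<b = <-trans x<d d<b
      in x , a<x , x<b , positive {x} {d} {r} 0≤ -Psd*r≈1 (0<inverse 0<-Psd -Psd*r≈1) a<x a<d x<d (proj₂ (negative a<x x<b))
      where
      positive : ∀ {x d r} → 0≤ - (P t x + F s d * r * F t x) → - P s d * r ≈ 1# → 0< r → a < x → a < d → x < d → 0< - P s x → 0< P (t ⊕ s) x
      positive {x} {d} {r} 0≤ -Psd*r≈1 0<r a<x a<d x<d 0<-Psx = 0<-cancelˡ 0<Fsd (0<-resp
          (begin
            fsd * (- (pt + fsd * r * ft) * - ps) + fsd * r * ft * (psd * fs - ps * fsd)
              ≈⟨ solve 7 (λ pt ft ps fs psd fsd r → fsd :* (:- (pt :+ fsd :* r :* ft) :* :- ps) :+ fsd :* r :* ft :* (psd :* fs :- ps :* fsd)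
                   := fsd :* (pt :* ps) :- fsd :* ft :* fs :* (:- psd :* r)) refl pt ft ps fs psd fsd r ⟩
            fsd * (pt * ps) - fsd * ft * fs * (- psd * r)
              ≈⟨ +-congˡ (-‿cong (*-congˡ -Psd*r≈1)) ⟩
            fsd * (pt * ps) - fsd * ft * fs * 1#
              ≈⟨ solve 4 (λ f p ft fs → f :* p :- f :* ft :* fs :* con (+ 1) := f :* (p :- ft :* fs)) refl fsd (pt * ps) ft fs ⟩
            fsd * (pt * ps - ft * fs) ∎)
          (+-nonneg-pos (*-nonneg (inj₁ 0<Fsd) (*-nonneg 0≤ (inj₁ 0<-Psx)))
            (*-pos (*-pos (*-pos 0<Fsd 0<r) (F-pos t (positive-t a<x))) (rises-strictly s (positive-s a<x) x<d))))
        where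
        pt = P t x
        ft = F t x
        ps = P s x
        fs = F s x
        psd = P s d
        fsd = F s d
        0<Fsd = F-pos s (positive-s a<d)

    -- Before the smaller index b both pivots are negative, and at b itself `P` of the join is -F F
    -- < 0. It remains to find a point before b where it is positive: a itself, or a point next to
    -- the pole at a.
    second-zero : Exceeds t a → Exceeds s a → F t a ≈ 0# ⊎ 0< P (t ⊕ s) a → SecondZero t s a
    second-zero (y , a<y , iy) (z , a<z , iz) = by-order (<-or-≥ y z)
      where
      below : ∀ {b} → a < b → P t b * P s b ≈ 0# → (∀ {x} → x < b → x < y × x < z) → F t a ≈ 0# ⊎ 0< P (t ⊕ s) a → SecondZero t s a
      below {b} a<b PP≈0 b≤ = Sum.[
          (λ F≈0 → let x , a<x , x<b , 0<P = positive-near-pole F≈0 a<b negative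
                   in second-zero-before x<b (<-asym a<x) 0<P negative a<b PP≈0) ,
          (λ 0<P → second-zero-before a<b (<-irrefl refl) 0<P negative a<b PP≈0) ]′
        where
        negative : ∀ {x} → a < x → x < b → 0< - P t x × 0< - P s x
        negative a<x x<b = below-index t (positive-t a<x) (proj₁ (b≤ x<b)) iy , below-index s (positive-s a<x) (proj₂ (b≤ x<b)) iz
      by-order : y < z ⊎ (z < y ⊎ z ≈ y) → F t a ≈ 0# ⊎ 0< P (t ⊕ s) a → SecondZero t s a
      by-order (inj₁ y<z) = below a<y (0· (proj₂ iy)) λ x<y → x<y , <-trans x<y y<z
      by-order (inj₂ (inj₁ z<y)) = below a<z (·0 (proj₂ iz)) λ x<z → <-trans x<z z<y , x<z
      by-order (inj₂ (inj₂ z≈y)) = below a<z (·0 (proj₂ iz)) λ x<z → <-respʳ-≈ z≈y x<z , x<z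

  P-⊕-comm : ∀ t s x → P (t ⊕ s) x ≈ P (s ⊕ t) x
  P-⊕-comm t s x = +-cong (*-comm _ _) (-‿cong (*-comm _ _))

  excess⇒second-zero : ∀ t s {a} → Branches-bounded t a → Branches-bounded s a → Exceeds t a → Exceeds s a →
    F t a ≈ 0# ⊎ F s a ≈ 0# ⊎ 0< P (t ⊕ s) a → SecondZero t s a
  excess⇒second-zero t s bt bs et es (inj₁ Ft≈0)        = second-zero t s bt bs et es (inj₁ Ft≈0)
  excess⇒second-zero t s bt bs et es (inj₂ (inj₂ 0<P))  = second-zero t s bt bs et es (inj₂ 0<P)
  excess⇒second-zero t s bt bs et es (inj₂ (inj₁ Fs≈0)) =
    let x , a<x , Px≈0 , ps , pt = second-zero s t bs bt es et (inj₁ Fs≈0) in x , a<x , trans (P-⊕-comm t s x) Px≈0 , pt , ps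

  -- At the index w of the join both pivots are positive. If w were not beyond a, `P t` would stay
  -- positive from w on and could not vanish at y.
  index-of-join : ∀ t s {a} → Exceeds t a → ∃[ y ] a < y × Index (t ⊕ s) y
  index-of-join t s {a} (y , a<y , py , Py≈0) =
    let w , (pt , ps , 0<Ps) , Pw≈0 = index (t ⊕ s)
    in w , by-order w pt ps 0<Ps Pw≈0 (<-or-≥ a w) , (pt , ps , 0<Ps) , Pw≈0
    where
    by-order : ∀ w → Positive t w → Positive s w → 0< P s w → P (t ⊕ s) w ≈ 0# → a < w ⊎ (w < a ⊎ w ≈ a) → a < w
    by-order w pt ps 0<Ps Pw≈0 (inj₁ a<w) = a<w
    by-order w pt ps 0<Ps Pw≈0 (inj₂ w≤a) = contradiction Py≈0 (0<⇒≉0 (P-rises t pt (w<y w≤a) (inj₁ 0<Pt)))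
      where
      w<y : w < a ⊎ w ≈ a → w < y
      w<y (inj₁ w<a) = <-trans w<a a<y
      w<y (inj₂ w≈a) = <-respˡ-≈ (sym w≈a) a<y
      0<Pt : 0< P t w
      0<Pt = 0<-cancelˡ 0<Ps (0<-resp (trans (sym (zero⇒product t s Pw≈0)) (*-comm _ _)) (*-pos (F-pos t pt) (F-pos s ps)))

-- Spectra of the represented graphs.

colour : ∀ t → Pos t → Bool
colour •       _        = true
colour (t ⊕ s) (inj₁ p) = colour t p
colour (t ⊕ s) (inj₂ q) = not (colour s q)

colour-top : ∀ t → colour t (top t) ≡ true
colour-top •       = ≡.refl
colour-top (t ⊕ s) = colour-top t

∧-true : ∀ b c → b ∧ c ≡ true → b ≡ true × c ≡ true
∧-true true true _ = ≡.refl , ≡.refl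

colour-edge : ∀ t p q → edge t p q ≡ true → colour t p ≢ colour t q
colour-edge (t ⊕ s) (inj₁ p) (inj₁ q) e eq = colour-edge t p q e eq
colour-edge (t ⊕ s) (inj₂ p) (inj₂ q) e eq = colour-edge s p q e (Bool.not-injective eq)
colour-edge (t ⊕ s) (inj₁ p) (inj₂ q) e eq with ∧-true (isTop t p) _ e
... | p-top , q-top rewrite isTop⇒top t p p-top | isTop⇒top s q q-top | colour-top t | colour-top s = contradiction eq λ ()
colour-edge (t ⊕ s) (inj₂ p) (inj₁ q) e eq with ∧-true (isTop t q) _ e
... | q-top , p-top rewrite isTop⇒top t q q-top | isTop⇒top s p p-top | colour-top t | colour-top s = contradiction eq λ ()

bipartite : ∀ {T t} → Represents T t → Bipartite (RootedGraph.graph T)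
bipartite {T} {t} ρ = colour t ∘ locate , λ u v uv → colour-edge t (locate u) (locate v)
  (≡.trans (≡.sym (edges (locate u) (locate v))) (≡.trans (≡.cong₂ adj (place-locate u) (place-locate v)) uv))
  where
  open Represents ρ
  open Graph (RootedGraph.graph T) using (adj)

module TreeSpectra {κ ℓ₁ ℓ₂} (ℝ : RealClosedField κ ℓ₁ ℓ₂) where
  open RealClosedField ℝ hiding (zero) renaming (commutativeRing to K)
  open OrderedField ℝ
  open Monotonicity ℝ
  open DualLaws ℝ using (two-zeros-of-F)
  open JoinedTrees ℝ
  open TreeEigenvectors ℝ
  open Integers K
  open CharacteristicLaws K
  open TreeSums K
  open Spectra ℝ
  open StrictToNonStrict _≈_ _<_ using (_≤_)

  private
    δ-0 : ∀ b → δ b 0# ≈ 0#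
    δ-0 true  = refl
    δ-0 false = refl

  OneZero : Tree → Set _
  OneZero t = ∃[ x ] 2ᴿ < x × P t x ≈ 0# × (∀ y → 2ᴿ < y → P t y ≈ 0# → y ≈ x)

  module _ {T t} (ρ : Represents T t) where
    open Represents ρ
    private G = RootedGraph.graph T

    InEigenspace⇒Solves : ∀ {x v} → InEigenspace G x v → Solves t (v ∘ place) x 0#
    InEigenspace⇒Solves {x} {v} eq = graph⇒tree ρ {v} λ i → trans (+-congˡ (δ-0 (does (i Fin.≟ RootedGraph.root T)))) (trans (+-identityʳ _) (eq i))

    Solves⇒InEigenspace : ∀ {x f} → Solves t f x 0# → InEigenspace G x (f ∘ locate)
    Solves⇒InEigenspace {x} {f} eq i = trans (sym (trans (+-congˡ (δ-0 (does (i Fin.≟ RootedGraph.root T)))) (+-identityʳ _))) (tree⇒graph ρ eq i)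

    eigenvector : ∀ {x f} → Solves t f x 0# → (∃[ p ] f p ≉ 0#) → IsEigenvector G x (f ∘ locate)
    eigenvector {f = f} eq (p , f≉0) = (place p , λ f≈0 → f≉0 (trans (reflexive (≡.cong f (≡.sym (locate-place p)))) f≈0)) , Solves⇒InEigenspace eq

    zero⇒eigenvalue : ∀ {x} → P t x ≈ 0# → IsEigenvalue G x
    zero⇒eigenvalue P≈0 = let f , eq , nz = kernel t P≈0 in f ∘ locate , eigenvector eq nz

    eigenvalue⇒zero : ∀ {x} → IsEigenvalue G x → P t x ≈ 0#
    eigenvalue⇒zero (v , (i , v≉0) , eq) = kernel⇒P≈0 t (InEigenspace⇒Solves eq)
      (locate i , λ v≈0 → v≉0 (trans (reflexive (≡.cong v (≡.sym (place-locate i)))) v≈0))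

    eigenvalue-neg : ∀ {x} → IsEigenvalue G x → IsEigenvalue G (- x)
    eigenvalue-neg (v , (i , v≉0) , eq) = flip t (v ∘ place) ∘ locate , eigenvector
      (Solves-cong t (λ _ → refl) -0#≈0# (flip-solves t (InEigenspace⇒Solves eq)))
      (locate i , λ f≈0 → v≉0 (trans (reflexive (≡.cong v (≡.sym (place-locate i))))
        (flip-zero t (v ∘ place) (locate i) f≈0)))
      where
      flip-zero : ∀ t f p → flip t f p ≈ 0# → f p ≈ 0#
      flip-zero •       f p        eq = eq
      flip-zero (t ⊕ s) f (inj₁ p) eq = flip-zero t (f ∘ inj₁) p eq
      flip-zero (t ⊕ s) f (inj₂ q) eq = flip-zero s (f ∘ inj₂) q (trans (sym (-‿involutive _)) (trans (-‿cong eq) -0#≈0#))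

    private
      -- Where F ≠ 0 a solution is determined by its value at the root, by `solution-vanishes`. The
      -- factor matches the root value of φ, which is F.
      multiple : ∀ {x w} → P t x ≈ 0# → F t x ≉ 0# → Solves t w x 0# → ∃[ a ] (∀ p → w p ≈ a * φ t x p)
      multiple {x} {w} P≈0 F≉0 eq = a , λ p → x-y≈0⇒x≈y (solution-vanishes t difference top≈0 (λ (_ , F≈0) → F≉0 F≈0) p)
        where
        r = inverse F≉0
        a = w (top t) * proj₁ r
        difference : Solves t (λ p → w p - a * φ t x p) x 0#
        difference = Solves-cong t (λ _ → refl) (trans (+-congˡ (-‿cong (·0 P≈0))) (-‿inverseʳ 0#))
          (Solves-- t eq (Solves-scale t a (φ-solves t x)))
        top≈0 : w (top t) - a * φ t x (top t) ≈ 0#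
        top≈0 = trans (+-congˡ (-‿cong (trans (*-congˡ (φ-top t x)) (trans (*-assoc _ _ _) (*-congˡ (trans (*-comm _ _) (proj₂ r)))))))
          (solve 1 (λ w → w :- w :* con (+ 1) := con +0) refl (w (top t)))

    simple : ∀ {x} → P t x ≈ 0# → F t x ≉ 0# → IsSimpleEigenvalue G x
    simple {x} P≈0 F≉0 = φ t x ∘ locate ,
      eigenvector (Solves-cong t (λ _ → refl) P≈0 (φ-solves t x)) (top t , λ eq → F≉0 (trans (sym (φ-top t x)) eq)) ,
      λ w eq → let a , w≈aφ = multiple P≈0 F≉0 (InEigenspace⇒Solves eq) in
        a , λ i → trans (reflexive (≡.cong w (≡.sym (place-locate i)))) (w≈aφ (locate i))

    simple-neg : ∀ {x} → P t x ≈ 0# → F t x ≉ 0# → IsSimpleEigenvalue G (- x)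
    simple-neg {x} P≈0 F≉0 = flip t (φ t x) ∘ locate ,
      eigenvector (Solves-cong t (λ _ → refl) (trans (-‿cong P≈0) -0≈0) (flip-solves t (φ-solves t x)))
        (top t , λ eq → F≉0 (trans (sym (φ-top t x)) (trans (reflexive (≡.sym (flip-top t (φ t x)))) eq))) ,
      λ w eq → let a , w≈aφ = multiple P≈0 F≉0 (unflip (InEigenspace⇒Solves eq)) in
        a , λ i → trans (reflexive (≡.cong w (≡.sym (place-locate i))))
          (trans (sym (flip-flip t (w ∘ place) (locate i))) (trans (flip-cong t w≈aφ (locate i)) (flip-scale t a (φ t x) (locate i))))
      where
      -0≈0 = -0#≈0#
      unflip : ∀ {f} → Solves t f (- x) 0# → Solves t (flip t f) x 0#
      unflip eq = Solves-x {t} (-‿involutive x) (Solves-cong t (λ _ → refl) -0≈0 (flip-solves t eq))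
        where
        Solves-x : ∀ {t f x y c} → x ≈ y → Solves t f x c → Solves t f y c
        Solves-x {•}     x≈y eq         = trans eq (*-congʳ x≈y)
        Solves-x {t ⊕ s} x≈y (eq , eq′) = Solves-x {t} x≈y eq , Solves-x {s} x≈y eq′

    cyclotomic : Bounded t 2ᴿ → Cyclotomic G
    cyclotomic b x ev = lower , upper ev
      where
      upper : ∀ {x} → IsEigenvalue G x → x ≤ 2ᴿ
      upper {x} ev with compare x 2ᴿ
      ... | tri< x<2 _ _ = inj₁ x<2
      ... | tri≈ _ x≈2 _ = inj₂ x≈2
      ... | tri> _ _ 2<x = contradiction (eigenvalue⇒zero ev) (0<⇒≉0 (P-rises t (proj₁ b) 2<x (proj₂ b)))
      lower : - 2ᴿ ≤ x
      lower = negate (upper (eigenvalue-neg ev))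
        where
        negate : - x ≤ 2ᴿ → - 2ᴿ ≤ x
        negate (inj₁ -x<2) = inj₁ (0<⇒< (0<-resp (solve 2 (λ x c → c :- :- x := x :- :- c) refl x 2ᴿ) (<⇒0< -x<2)))
        negate (inj₂ -x≈2) = inj₂ (trans (-‿cong (sym -x≈2)) (-‿involutive x))

    cyclotomic⇒bounded : Cyclotomic G → Bounded t 2ᴿ
    cyclotomic⇒bounded c = Sum.[ id , (λ (y , 2<y , _ , Py≈0) → ⊥-elim (absurd 2<y (proj₂ (c y (zero⇒eigenvalue Py≈0))))) ]′ (bounded-or-exceeds t 2ᴿ)
      where
      absurd : ∀ {y} → 2ᴿ < y → y ≤ 2ᴿ → ⊥
      absurd 2<y (inj₁ y<2) = <-asym 2<y y<2
      absurd 2<y (inj₂ y≈2) = <-irrefl (sym y≈2) 2<y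

    salem : ∀ {x} → 2ᴿ < x → P t x ≈ 0# → F t x ≉ 0# → (∀ y → 2ᴿ < y → P t y ≈ 0# → y ≈ x) → SalemGraph G
    salem {x} 2<x P≈0 F≉0 unique = bipartite ρ , x ,
      (2<x , simple P≈0 F≉0 , λ y ev 2<y → unique y 2<y (eigenvalue⇒zero ev)) ,
      (0<⇒< (0<-resp (solve 2 (λ x c → x :- c := :- c :- :- x) refl x 2ᴿ) (<⇒0< 2<x)) , simple-neg P≈0 F≉0 ,
       λ y ev y<-2 → trans (sym (-‿involutive y)) (-‿cong (unique (- y)
         (0<⇒< (0<-resp (solve 2 (λ y c → :- c :- y := :- y :- c) refl y 2ᴿ) (<⇒0< y<-2))) (eigenvalue⇒zero (eigenvalue-neg ev)))))

    salem⇒one-zero : SalemGraph G → OneZero t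
    salem⇒one-zero (_ , x , (2<x , (v , ev , _) , unique) , _) = x , 2<x , eigenvalue⇒zero (v , ev) , λ y 2<y P≈0 → unique y (zero⇒eigenvalue P≈0) 2<y

  two-branches : ∀ u w s → OneZero ((u ⊕ w) ⊕ s) → Exceeds w 2ᴿ → Exceeds s 2ᴿ → ⊥
  two-branches u w s (λ₁ , 2<λ , Pλ≈0 , unique) (y , 2<y , py , Py≈0) (z , 2<z , pz , Pz≈0) =
    let ξ , ((pu , pw , 0<Pw) , ps , 0<Ps) , Pξ≈0 = index t
        y<ξ = above w pw 0<Pw py Py≈0
        z<ξ = above s ps 0<Ps pz Pz≈0
        nonzero = λ x 2<x x<ξ Px≈0 → <-irrefl (trans (unique x 2<x Px≈0) (sym (unique ξ (<-trans 2<y y<ξ) Pξ≈0))) x<ξ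
    in by-order y<ξ z<ξ nonzero (compare y z)
    where
    t = (u ⊕ w) ⊕ s
    above : ∀ w {x y} → Positive w x → 0< P w x → Positive w y → P w y ≈ 0# → y < x
    above w {x} {y} px 0<Px py Py≈0 with compare x y
    ... | tri< x<y _ _ = contradiction Py≈0 (0<⇒≉0 (P-rises w px x<y (inj₁ 0<Px)))
    ... | tri≈ _ x≈y _ = contradiction (trans (P-cong w x≈y) Py≈0) (0<⇒≉0 0<Px)
    ... | tri> _ _ y<x = y<x
    F≈0-w : ∀ {x} → P w x ≈ 0# → F t x ≈ 0#
    F≈0-w Pw≈0 = 0· (·0 Pw≈0)
    F≈0-s : ∀ {x} → P s x ≈ 0# → F t x ≈ 0#
    F≈0-s Ps≈0 = ·0 Ps≈0
    within : ∀ {a b x ξ} → 2ᴿ < a → b < ξ → ¬ x < a → ¬ b < x → 2ᴿ < x × x < ξ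
    within {a} {b} {x} {ξ} 2<a b<ξ x≮a b≮x with compare 2ᴿ x | compare x ξ
    ... | tri< 2<x _ _ | tri< x<ξ _ _ = 2<x , x<ξ
    ... | tri≈ _ 2≈x _ | _ = contradiction (<-respˡ-≈ 2≈x 2<a) x≮a
    ... | tri> _ _ x<2 | _ = contradiction (<-trans x<2 2<a) x≮a
    ... | _ | tri≈ _ x≈ξ _ = contradiction (<-respʳ-≈ (sym x≈ξ) b<ξ) b≮x
    ... | _ | tri> _ _ ξ<x = contradiction (<-trans b<ξ ξ<x) b≮x
    by-order : ∀ {ξ} → y < ξ → z < ξ → (∀ x → 2ᴿ < x → x < ξ → P t x ≈ 0# → ⊥) → _ → ⊥
    -- At a common index of w and s both products in `P t` contain a vanishing factor, so this index
    -- is itself a zero of `P t` in (2 , ξ).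
    by-order y<ξ z<ξ nonzero (tri≈ _ y≈z _) = nonzero z 2<z z<ξ (trans (+-cong (·0 Pz≈0)
      (-‿cong (trans (*-congʳ (·0 (trans (P-cong w (sym y≈z)) Py≈0))) (zeroˡ _)))) (-‿inverseʳ 0#))
    by-order y<ξ z<ξ nonzero (tri< y<z _ _) = two-zeros-of-F t y<z (F≈0-w Py≈0) (F≈0-s Pz≈0)
      λ x x≮y z≮x → let 2<x , x<ξ = within 2<y z<ξ x≮y z≮x in nonzero x 2<x x<ξ
    by-order y<ξ z<ξ nonzero (tri> _ _ z<y) = two-zeros-of-F t z<y (F≈0-s Pz≈0) (F≈0-w Py≈0)
      λ x x≮z y≮x → let 2<x , x<ξ = within 2<z y<ξ x≮z y≮x in nonzero x 2<x x<ξ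

-- Branches of a graph-theoretic tree, assembled into a term.

any-true : ∀ {a} {A : Set a} (p : A → Bool) xs → any p xs ≡ true → ∃[ x ] p x ≡ true
any-true p (x ∷ xs) eq with p x in px
... | true  = x , px
... | false = any-true p xs eq

true-any : ∀ {a} {A : Set a} (p : A → Bool) {x xs} → x ∈ xs → p x ≡ true → any p xs ≡ true
true-any p (here ≡.refl) px rewrite px = ≡.refl
true-any p {xs = y ∷ _} (there x∈xs) px rewrite true-any p x∈xs px = Bool.∨-zeroʳ (p y)

lookup-injective : ∀ {a} {A : Set a} {xs : List A} → Unique xs → ∀ i j → lookup xs i ≡ lookup xs j → i ≡ j
lookup-injective (x∉ ∷ u) zero    zero    eq = ≡.refl
lookup-injective (x∉ ∷ u) zero    (suc j) eq = contradiction eq (All.lookup x∉ (∈.∈-lookup j))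
lookup-injective (x∉ ∷ u) (suc i) zero    eq = contradiction (≡.sym eq) (All.lookup x∉ (∈.∈-lookup i))
lookup-injective (x∉ ∷ u) (suc i) (suc j) eq = ≡.cong suc (lookup-injective u i j eq)

module Routes (T : RootedGraph) where
  open RootedGraph T
  open Graph graph using (adj; Adj; Vertex; symmetric; loopless) renaming (order to n)
  open Branches T

  -- A path from s to the head of the list that avoids the root, except that s may be the root.

  data Route (s : Vertex) : List Vertex → Set where
    start : Route s (s ∷ [])
    step  : ∀ {u v us} → Route s (u ∷ us) → Adj u v → v ≢ root → v ∉ u ∷ us → Route s (v ∷ u ∷ us)

  Joined : Vertex → Vertex → Set
  Joined s v = ∃[ vs ] Route s (v ∷ vs)

  Adj-sym : ∀ {u v} → Adj u v → Adj v u
  Adj-sym {u} {v} uv = ≡.trans (symmetric v u) uv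

  private
    truncate : ∀ {s u us v} → Route s (u ∷ us) → v ∈ u ∷ us → Joined s v
    truncate route             (here ≡.refl) = _ , route
    truncate (step route _ _ _) (there v∈)   = truncate route v∈
    truncate start              (there ())

  -- Loop erasure keeps the list free of duplicates. This bounds its length, so that n steps of
  -- `reach` suffice, and makes it usable as part of a cycle.
  extend : ∀ {s u v} → Joined s u → Adj u v → v ≢ root → Joined s v
  extend {v = v} (us , route) uv v≢r with Any.any? (v Fin.≟_) (_ ∷ us)
  ... | yes v∈ = truncate route v∈
  ... | no  v∉ = _ , step route uv v≢r v∉

  route-unique : ∀ {s vs} → Route s vs → Unique vs
  route-unique start                = [] ∷ []
  route-unique (step route _ _ v∉) = All.tabulate (λ u∈ v≡u → v∉ (≡.subst (_∈ _) (≡.sym v≡u) u∈)) ∷ route-unique route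

  route-avoids-root : ∀ {s vs} → s ≢ root → Route s vs → All (_≢ root) vs
  route-avoids-root s≢r start                 = s≢r ∷ []
  route-avoids-root s≢r (step route _ v≢r _) = v≢r ∷ route-avoids-root s≢r route

  joined-avoids-root : ∀ {s v} → s ≢ root → Joined s v → v ≢ root
  joined-avoids-root s≢r (_ , route) = All.head (route-avoids-root s≢r route)

  joined-back : ∀ {s s′ v vs} → s′ ≢ root → Route s′ (v ∷ vs) → Joined s v → Joined s s′
  joined-back s′≢r start                j = j
  joined-back s′≢r (step route uv _ _) j =
    joined-back s′≢r route (extend j (Adj-sym uv) (All.head (route-avoids-root s′≢r route)))

  private
    reach-suc : ∀ k s v → reach k s v ≡ true → reach (suc k) s v ≡ true
    reach-suc k s v eq rewrite eq = ≡.refl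

    reach-+ : ∀ j k s v → reach k s v ≡ true → reach (j ℕ.+ k) s v ≡ true
    reach-+ zero    k s v eq = eq
    reach-+ (suc j) k s v eq = reach-suc (j ℕ.+ k) s v (reach-+ j k s v eq)

    reach⇒joined′ : ∀ k s v → reach k s v ≡ true → Joined s v
    reach⇒joined′ zero s v eq with s Fin.≟ v
    ... | yes ≡.refl = [] , start
    reach⇒joined′ (suc k) s v eq with reach k s v in r
    ... | true = reach⇒joined′ k s v r
    ... | false with ∧-true (any (λ u → reach k s u ∧ adj u v) (allFin n)) _ eq
    ...   | some , v≢r with any-true _ (allFin n) some
    ...     | u , both with ∧-true (reach k s u) _ both
    ...       | su , uv = extend (reach⇒joined′ k s u su) uv λ v≡r → not-¬-true (≡.trans (≡.sym (≡.cong not (dec-true (v Fin.≟ root) v≡r))) v≢r)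
      where
      not-¬-true : false ≡ true → ⊥
      not-¬-true ()

    route⇒reach : ∀ {s v vs} → Route s (v ∷ vs) → reach (length vs) s v ≡ true
    route⇒reach {s} start = dec-true (s Fin.≟ s) ≡.refl
    route⇒reach {s} {v} (step {u} {us = us} route uv v≢r _)
      rewrite true-any (λ u → reach (length us) s u ∧ adj u v) (∈.∈-allFin u) (≡.cong₂ _∧_ (route⇒reach route) uv)
            | dec-false (v Fin.≟ root) v≢r = Bool.∨-zeroʳ (reach (length us) s v)

    route-length : ∀ {s v vs} → Route s (v ∷ vs) → length vs ℕ.≤ n
    route-length route = ℕ.≤-trans (ℕ.n≤1+n _) (Fin.injective⇒≤ (λ {i} {j} → lookup-injective (route-unique route) i j))

  reach⇒joined : ∀ {s v} → reach n s v ≡ true → Joined s v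
  reach⇒joined {s} {v} = reach⇒joined′ n s v

  joined⇒reach : ∀ {s v} → Joined s v → reach n s v ≡ true
  joined⇒reach {s} {v} (vs , route) = ≡.subst (λ k → reach k s v ≡ true) (ℕ.m∸n+n≡m (route-length route))
    (reach-+ (n ∸ length vs) (length vs) s v (route⇒reach route))

  private
    last-of-route : ∀ {s v vs} → Route s (v ∷ vs) → lookup (v ∷ vs) (fromℕ (length vs)) ≡ s
    last-of-route start              = ≡.refl
    last-of-route (step route _ _ _) = last-of-route route

    route-step : ∀ {s v vs} → Route s (v ∷ vs) → ∀ (i : Fin (length vs)) → Adj (lookup (v ∷ vs) (inject₁ i)) (lookup vs i)
    route-step (step route uv _ _) zero    = Adj-sym uv
    route-step (step route _ _ _)  (suc i) = route-step route i

  neighbour≢root : ∀ {s} → Adj root s → s ≢ root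
  neighbour≢root rs ≡.refl with ≡.trans (≡.sym (loopless root)) rs
  ... | ()

  routeCycle : ∀ {s v vs} → Adj root s → Adj root v → s ≢ v → Route s (v ∷ vs) → Cycle graph
  routeCycle rs rv s≢v start = contradiction ≡.refl s≢v
  routeCycle {s} {v} rs rv s≢v route@(step {u} {us = us} _ _ _ _) = record
    { vertex   = lookup (root ∷ v ∷ u ∷ us)
    ; distinct = λ {i} {j} → lookup-injective (All.map (_∘ ≡.sym) (route-avoids-root (neighbour≢root rs) route) ∷ route-unique route) i j
    ; step     = λ { zero → rv ; (suc i) → route-step route i }
    ; close    = ≡.subst (λ w → Adj w root) (≡.sym (last-of-route route)) (Adj-sym rs)
    }

  module _ (tree : IsTree graph) where
    open IsTree tree

    -- Two different neighbours of the root in one component would close a cycle through the root.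
    branches-disjoint : ∀ {s s′ v} → Adj root s → Adj root s′ → Joined s v → Joined s′ v → s ≡ s′
    branches-disjoint {s} {s′} rs rs′ sv (_ , route) with s Fin.≟ s′
    ... | yes s≡s′ = s≡s′
    ... | no  s≢s′ = contradiction (routeCycle rs rs′ s≢s′ (proj₂ (joined-back (neighbour≢root rs′) route sv))) acyclic

    -- On a walk from v to the root, the vertex just before the first visit to the root is the
    -- required neighbour.
    branches-cover : ∀ {v} → v ≢ root → ∃[ s ] Adj root s × Joined s v
    branches-cover {v} v≢r = walk-branch (connected v root) v≢r ≡.refl
      where
      walk-branch : ∀ {v w} → Walk graph v w → v ≢ root → w ≡ root → ∃[ s ] Adj root s × Joined s v
      walk-branch [] v≢r w≡r = contradiction w≡r v≢r
      walk-branch {v} (_∷_ {v = u} vu walk) v≢r w≡r with u Fin.≟ root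
      ... | yes u≡r = v , Adj-sym (≡.subst (Adj v) u≡r vu) , [] , start
      ... | no  u≢r = let s , rs , su = walk-branch walk u≢r w≡r in s , rs , extend su (Adj-sym vu) v≢r

    module _ {s} (rs : Adj root s) where
      private
        vs = component s
        H  = RootedGraph.graph (branch s)

      component-unique : Unique vs
      component-unique = Unique.filter⁺ (λ v → reach n s v Bool.≟ true) (Unique.allFin⁺ n)

      joined⇒∈ : ∀ {v} → Joined s v → v ∈ vs
      joined⇒∈ {v} j = ∈.∈-filter⁺ (λ v → reach n s v Bool.≟ true) (∈.∈-allFin v) (joined⇒reach j)

      lookup-joined : ∀ i → Joined s (lookup vs i)
      lookup-joined i = reach⇒joined (proj₂ (∈.∈-filter⁻ (λ v → reach n s v Bool.≟ true) {xs = allFin n} (∈.∈-lookup i)))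

      branch-root : lookup vs (RootedGraph.root (branch s)) ≡ s
      branch-root = ≡.sym (lookup-index (∈-component s))

      branch-smaller : length vs ℕ.< n
      branch-smaller = ≡.subst (length vs ℕ.<_) (List.length-tabulate id)
        (List.filter-notAll (λ v → reach n s v Bool.≟ true) (allFin n)
          (Any.map (λ r≡v eq → joined-avoids-root (neighbour≢root rs) (reach⇒joined eq) (≡.sym r≡v)) (∈.∈-allFin root)))

      private
        append : ∀ {i j k} → Walk H i j → Graph.Adj H j k → Walk H i k
        append []         jk = jk ∷ []
        append (e ∷ walk) jk = e ∷ append walk jk

        reverse : ∀ {i j} → Walk H i j → Walk H j i
        reverse []                          = []
        reverse {i} (_∷_ {v = k} e walk) = append (reverse walk) (≡.trans (Graph.symmetric H k i) e)

        join : ∀ {i j k} → Walk H i j → Walk H j k → Walk H i k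
        join []         walk = walk
        join (e ∷ walk) walk′ = e ∷ join walk walk′

        from-s : ∀ {v us} → Route s (v ∷ us) → ∀ i j → lookup vs i ≡ s → lookup vs j ≡ v → Walk H i j
        from-s start i j eq eq′ with ≡.refl ← lookup-injective component-unique i j (≡.trans eq (≡.sym eq′)) = []
        from-s (step {u} {us = us} route uv _ _) i j eq eq′ = append (from-s route i (Any.index u∈) eq u≡)
          (≡.subst₂ Adj (≡.sym u≡) (≡.sym eq′) uv)
          where
          u∈ : u ∈ vs
          u∈ = joined⇒∈ (us , route)
          u≡ : lookup vs (Any.index u∈) ≡ u
          u≡ = ≡.sym (lookup-index u∈)

      branch-tree : IsTree H
      branch-tree = record
        { nonempty  = RootedGraph.root (branch s)
        ; connected = λ i j → join (reverse (to i)) (to j)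
        ; acyclic   = λ c → acyclic record
          { vertex   = lookup vs ∘ Cycle.vertex c
          ; distinct = Cycle.distinct c ∘ lookup-injective component-unique _ _
          ; step     = Cycle.step c
          ; close    = Cycle.close c
          }
        }
        where
        to : ∀ i → Walk H (RootedGraph.root (branch s)) i
        to i = from-s (proj₂ (lookup-joined i)) (RootedGraph.root (branch s)) i branch-root ≡.refl

attach : List Tree → Tree
attach = foldr (λ s t → t ⊕ s) •

-- Beyond `Represents`, the summands of t are the branches in the order of `T ′`, hereditarily. The
-- ν-values are defined through `T ′` and are computed along this structure.
data Decomposed : RootedGraph → Tree → Set where
  decomposed : ∀ {T} ss → Represents T (attach ss) → Pointwise Decomposed (T ′) ss → Decomposed T (attach ss)

represents : ∀ {T t} → Decomposed T t → Represents T t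
represents (decomposed _ ρ _) = ρ

module Assembly (T : RootedGraph) (tree : IsTree (RootedGraph.graph T))
  (rep : ∀ {s} → Graph.Adj (RootedGraph.graph T) (RootedGraph.root T) s → ∃[ t ] Decomposed (Branches.branch T s) t) where
  open RootedGraph T
  open Graph graph using (adj; Adj; Vertex; symmetric; loopless; neighbours)
  open Branches T
  open Routes T

  -- The construction is carried out for an arbitrary list of neighbours of the root, so that
  -- induction on the list attaches one branch at a time.
  AllNeighbours : List Vertex → Set
  AllNeighbours = All (Adj root)

  trees : ∀ {L} → AllNeighbours L → List Tree
  trees []       = []
  trees (rs ∷ a) = proj₁ (rep rs) ∷ trees a

  pointwise : ∀ {L} (a : AllNeighbours L) → Pointwise Decomposed (map branch L) (trees a)
  pointwise []       = []
  pointwise (rs ∷ a) = proj₂ (rep rs) ∷ pointwise a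

  InBranches : List Vertex → Vertex → Set
  InBranches L v = v ≡ root ⊎ ∃[ s ] s ∈ L × Joined s v

  place : ∀ {L} (a : AllNeighbours L) → Pos (attach (trees a)) → Vertex
  place []             tt       = root
  place (_∷_ {s} rs a) (inj₁ p) = place a p
  place (_∷_ {s} rs a) (inj₂ q) = lookup (component s) (Represents.place (represents (proj₂ (rep rs))) q)

  place-in : ∀ {L} (a : AllNeighbours L) p → InBranches L (place a p)
  place-in []             tt       = inj₁ ≡.refl
  place-in (_∷_ {s} rs a) (inj₁ p) = Sum.map₂ (λ (s , s∈ , j) → s , there s∈ , j) (place-in a p)
  place-in (_∷_ {s} rs a) (inj₂ q) = inj₂ (s , here ≡.refl , lookup-joined tree rs _)

  place-top : ∀ {L} (a : AllNeighbours L) → place a (top (attach (trees a))) ≡ root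
  place-top []       = ≡.refl
  place-top (rs ∷ a) = place-top a

  private
    separate : ∀ {s L} → All (s ≢_) L → AllNeighbours L → Adj root s → ∀ {v w} → InBranches L v → Joined s w → v ≢ w
    separate s∉ a rs (inj₁ v≡r)           sw v≡w = joined-avoids-root (neighbour≢root rs) sw (≡.trans (≡.sym v≡w) v≡r)
    separate s∉ a rs (inj₂ (s′ , s′∈ , s′v)) sw v≡w = All.lookup s∉ s′∈
      (branches-disjoint tree rs (All.lookup a s′∈) sw (≡.subst (Joined s′) v≡w s′v))

  place-injective : ∀ {L} (a : AllNeighbours L) → Unique L → ∀ p q → place a p ≡ place a q → p ≡ q
  place-injective []       u        tt       tt       eq = ≡.refl
  place-injective (rs ∷ a) (s∉ ∷ u) (inj₁ p) (inj₁ q) eq = ≡.cong inj₁ (place-injective a u p q eq)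
  place-injective (rs ∷ a) (s∉ ∷ u) (inj₁ p) (inj₂ q) eq = contradiction eq (separate s∉ a rs (place-in a p) (lookup-joined tree rs _))
  place-injective (rs ∷ a) (s∉ ∷ u) (inj₂ p) (inj₁ q) eq = contradiction (≡.sym eq) (separate s∉ a rs (place-in a q) (lookup-joined tree rs _))
  place-injective (rs ∷ a) (s∉ ∷ u) (inj₂ p) (inj₂ q) eq = ≡.cong inj₂
    (≡.trans (≡.sym (locate-place p)) (≡.trans (≡.cong locate (lookup-injective (component-unique tree rs) _ _ eq)) (locate-place q)))
    where open Represents (represents (proj₂ (rep rs)))

  find : ∀ {L} (a : AllNeighbours L) {v} → InBranches L v → ∃[ p ] place a p ≡ v
  find a        (inj₁ v≡r) = top _ , ≡.trans (place-top a) (≡.sym v≡r)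
  find (rs ∷ a) (inj₂ (s , there s∈ , j)) = let p , eq = find a (inj₂ (s , s∈ , j)) in inj₁ p , eq
  find (_∷_ {s} rs a) (inj₂ (s , here ≡.refl , j)) = inj₂ (locate (Any.index (joined⇒∈ tree rs j))) ,
    ≡.trans (≡.cong (lookup (component s)) (place-locate _)) (≡.sym (lookup-index (joined⇒∈ tree rs j)))
    where open Represents (represents (proj₂ (rep rs)))

  private
    equal-true : ∀ {a b} → (a ≡ true → b ≡ true) → (b ≡ true → a ≡ true) → a ≡ b
    equal-true {false} {false} f g = ≡.refl
    equal-true {false} {true}  f g = g ≡.refl
    equal-true {true}  {false} f g = ≡.sym (f ≡.refl)
    equal-true {true}  {true}  f g = ≡.refl

    cross : ∀ {s L} (s∉ : All (s ≢_) L) (a : AllNeighbours L) → Unique L → (rs : Adj root s) → ∀ p q →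
      adj (place a p) (lookup (component s) (Represents.place (represents (proj₂ (rep rs))) q)) ≡ isTop (attach (trees a)) p ∧ isTop (proj₁ (rep rs)) q
    cross {s} s∉ a u rs p q = equal-true forth back
      where
      open Represents (represents (proj₂ (rep rs))) using (roots; locate-place) renaming (place to place-s; locate to locate-s)
      w = lookup (component s) (place-s q)
      sw : Joined s w
      sw = lookup-joined tree rs (place-s q)
      forth : adj (place a p) w ≡ true → isTop (attach (trees a)) p ∧ isTop (proj₁ (rep rs)) q ≡ true
      forth e with place-in a p
      ... | inj₂ (s′ , s′∈ , s′v) = contradiction
              (branches-disjoint tree rs (All.lookup a s′∈) sw (extend s′v e (joined-avoids-root (neighbour≢root rs) sw)))
              (All.lookup s∉ s′∈)
      ... | inj₁ v≡r = ≡.cong₂ _∧_ p-top q-top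
        where
        p-top : isTop (attach (trees a)) p ≡ true
        p-top = ≡.trans (≡.cong (isTop _) (place-injective a u p (top _) (≡.trans v≡r (≡.sym (place-top a))))) (isTop-top (attach (trees a)))
        s≡w : s ≡ w
        s≡w = branches-disjoint tree rs (≡.subst (λ v → Adj v w) v≡r e) sw ([] , start)
        q≡top : q ≡ top (proj₁ (rep rs))
        q≡top = ≡.trans (≡.sym (locate-place q)) (≡.trans (≡.cong locate-s
          (lookup-injective (component-unique tree rs) _ _ (≡.trans (≡.sym s≡w) (≡.trans (≡.sym (branch-root tree rs)) (≡.cong (lookup (component s)) (≡.sym roots))))))
          (locate-place _))
        q-top : isTop (proj₁ (rep rs)) q ≡ true
        q-top = ≡.trans (≡.cong (isTop _) q≡top) (isTop-top (proj₁ (rep rs)))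
      back : isTop (attach (trees a)) p ∧ isTop (proj₁ (rep rs)) q ≡ true → adj (place a p) w ≡ true
      back e with ∧-true (isTop (attach (trees a)) p) _ e
      ... | p-top , q-top = ≡.subst₂ (λ x y → adj x y ≡ true)
              (≡.sym (≡.trans (≡.cong (place a) (isTop⇒top _ p p-top)) (place-top a)))
              (≡.sym (≡.trans (≡.cong (lookup (component s) ∘ place-s) (isTop⇒top _ q q-top)) (≡.trans (≡.cong (lookup (component s)) roots) (branch-root tree rs))))
              rs

  place-edges : ∀ {L} (a : AllNeighbours L) → Unique L → ∀ p q → adj (place a p) (place a q) ≡ edge (attach (trees a)) p q
  place-edges []       u        tt       tt       = loopless root
  place-edges (rs ∷ a) (s∉ ∷ u) (inj₁ p) (inj₁ q) = place-edges a u p q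
  place-edges (rs ∷ a) (s∉ ∷ u) (inj₁ p) (inj₂ q) = cross s∉ a u rs p q
  place-edges (rs ∷ a) (s∉ ∷ u) (inj₂ p) (inj₁ q) = ≡.trans (symmetric _ _) (cross s∉ a u rs q p)
  place-edges (rs ∷ a) (s∉ ∷ u) (inj₂ p) (inj₂ q) = Represents.edges (represents (proj₂ (rep rs))) p q

  private
    all : AllNeighbours (neighbours root)
    all = All.tabulate λ v∈ → proj₂ (∈.∈-filter⁻ (λ u → adj root u Bool.≟ true) {xs = allFin _} v∈)

    unique : Unique (neighbours root)
    unique = Unique.filter⁺ (λ u → adj root u Bool.≟ true) (Unique.allFin⁺ _)

    cover : ∀ v → InBranches (neighbours root) v
    cover v with v Fin.≟ root
    ... | yes v≡r = inj₁ v≡r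
    ... | no  v≢r = let s , rs , sv = branches-cover tree v≢r in
      inj₂ (s , ∈.∈-filter⁺ (λ u → adj root u Bool.≟ true) (∈.∈-allFin s) rs , sv)

  assembled : ∃[ t ] Decomposed T t
  assembled = _ , decomposed (trees all) (record
    { place        = place all
    ; locate       = λ v → proj₁ (find all (cover v))
    ; place-locate = λ v → proj₂ (find all (cover v))
    ; locate-place = λ p → place-injective all unique _ p (proj₂ (find all (cover (place all p))))
    ; edges        = place-edges all unique
    ; roots        = place-top all
    }) (pointwise all)

private
  decompose-at : ∀ n T → order T ℕ.≤ n → IsTree (RootedGraph.graph T) → ∃[ t ] Decomposed T t
  decompose-at zero    T T≤n tree with order T | T≤n | RootedGraph.root T
  ... | zero | _ | ()
  decompose-at (suc n) T T≤n tree = Assembly.assembled T tree λ {s} rs →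
    decompose-at n (Branches.branch T s) (ℕ.≤-pred (ℕ.≤-trans (Routes.branch-smaller T tree rs) T≤n)) (Routes.branch-tree T tree rs)

decompose : ∀ T → IsTree (RootedGraph.graph T) → ∃[ t ] Decomposed T t
decompose T = decompose-at (order T) T ℕ.≤-refl

branch-trees : ∀ T → IsTree (RootedGraph.graph T) → All (IsTree ∘ RootedGraph.graph) (T ′)
branch-trees T tree = All-map (All.tabulate λ {s} s∈ →
  Routes.branch-tree T tree (proj₂ (∈.∈-filter⁻ (λ u → adj root u Bool.≟ true) {xs = allFin _} s∈)))
  where
  open RootedGraph T
  open Graph graph using (adj)
  All-map : ∀ {xs} → All (λ s → IsTree (RootedGraph.graph (Branches.branch T s))) xs → All (IsTree ∘ RootedGraph.graph) (map (Branches.branch T) xs)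
  All-map []       = []
  All-map (p ∷ ps) = p ∷ All-map ps

-- Graphs represented by terms are trees.

edge-sym : ∀ t p q → edge t p q ≡ edge t q p
edge-sym •       p        q        = ≡.refl
edge-sym (t ⊕ s) (inj₁ p) (inj₁ q) = edge-sym t p q
edge-sym (t ⊕ s) (inj₁ p) (inj₂ q) = ≡.refl
edge-sym (t ⊕ s) (inj₂ p) (inj₁ q) = ≡.refl
edge-sym (t ⊕ s) (inj₂ p) (inj₂ q) = edge-sym s p q

depth : ∀ t → Pos t → ℕ
depth •       _        = 0
depth (t ⊕ s) (inj₁ p) = depth t p
depth (t ⊕ s) (inj₂ q) = suc (depth s q)

private
  depth-top : ∀ t → depth t (top t) ≡ 0
  depth-top •       = ≡.refl
  depth-top (t ⊕ s) = depth-top t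

  depth-0 : ∀ t p → depth t p ≡ 0 → p ≡ top t
  depth-0 •       tt       eq = ≡.refl
  depth-0 (t ⊕ s) (inj₁ p) eq = ≡.cong inj₁ (depth-0 t p eq)

private
  top-has-no-parent : ∀ s p q → isTop s p ≡ true → edge s p q ≡ true → depth s q ℕ.≤ depth s p → ⊥
  top-has-no-parent s p q p-top e d rewrite isTop⇒top s p p-top | depth-top s | depth-0 s q (ℕ.n≤0⇒n≡0 d) = colour-edge s (top s) (top s) e ≡.refl

-- An edge changes the depth by one, so a neighbour that is no deeper than p lies one level up,
-- where p has only its parent.
parent-unique : ∀ t p {q q′} → edge t p q ≡ true → edge t p q′ ≡ true → depth t q ℕ.≤ depth t p → depth t q′ ℕ.≤ depth t p → q ≡ q′
parent-unique (t ⊕ s) (inj₁ p) {inj₁ q} {inj₁ q′} e e′ d d′ = ≡.cong inj₁ (parent-unique t p e e′ d d′)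
parent-unique (t ⊕ s) (inj₁ p) {q} {inj₂ q′} e e′ d d′ with ∧-true (isTop t p) _ e′
... | p-top , _ rewrite isTop⇒top t p p-top | depth-top t = contradiction d′ λ ()
parent-unique (t ⊕ s) (inj₁ p) {inj₂ q} {inj₁ q′} e e′ d d′ with ∧-true (isTop t p) _ e
... | p-top , _ rewrite isTop⇒top t p p-top | depth-top t = contradiction d λ ()
parent-unique (t ⊕ s) (inj₂ p) {inj₂ q} {inj₂ q′} e e′ (ℕ.s≤s d) (ℕ.s≤s d′) = ≡.cong inj₂ (parent-unique s p e e′ d d′)
parent-unique (t ⊕ s) (inj₂ p) {inj₁ q} {inj₁ q′} e e′ d d′ =
  ≡.cong inj₁ (≡.trans (isTop⇒top t q (proj₁ (∧-true _ _ e))) (≡.sym (isTop⇒top t q′ (proj₁ (∧-true _ _ e′)))))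
parent-unique (t ⊕ s) (inj₂ p) {inj₁ q} {inj₂ q′} e e′ d (ℕ.s≤s d′) = ⊥-elim (top-has-no-parent s p q′ (proj₂ (∧-true (isTop t q) _ e)) e′ d′)
parent-unique (t ⊕ s) (inj₂ p) {inj₂ q} {inj₁ q′} e e′ (ℕ.s≤s d) d′ = ⊥-elim (top-has-no-parent s p q (proj₂ (∧-true (isTop t q′) _ e′)) e d)

private
  argmax : ∀ {n} (f : Fin (suc n) → ℕ) → ∃[ i ] (∀ j → f j ℕ.≤ f i)
  argmax {zero}  f = zero , λ { zero → ℕ.≤-refl }
  argmax {suc n} f with argmax (f ∘ suc)
  ... | i , max with ℕ.≤-total (f zero) (f (suc i))
  ...   | inj₁ f₀≤ = suc i , λ { zero → f₀≤ ; (suc j) → max j }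
  ...   | inj₂ ≤f₀ = zero , λ { zero → ℕ.≤-refl ; (suc j) → ℕ.≤-trans (max j) ≤f₀ }

-- A deepest vertex of a cycle would have two parents.

represents⇒tree : ∀ {T t} → Represents T t → IsTree (RootedGraph.graph T)
represents⇒tree {T} {t} ρ = record
  { nonempty  = place (top t)
  ; connected = λ u v → ≡.subst₂ (Walk graph) (place-locate u) (place-locate v) (walk (to-top t (locate u) ◅◅ from-top t (locate v)))
  ; acyclic   = no-cycle
  }
  where
  open RootedGraph T using (graph)
  open Graph graph using (adj; Adj; symmetric)
  open Represents ρ
  Edge : ∀ t → Pos t → Pos t → Set
  Edge t p q = edge t p q ≡ true
  to-top : ∀ t p → Star (Edge t) p (top t)
  to-top •       tt       = ε
  to-top (t ⊕ s) (inj₁ p) = Star.gmap inj₁ id (to-top t p)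
  to-top (t ⊕ s) (inj₂ q) = Star.gmap inj₂ id (to-top s q) ◅◅ (≡.cong₂ _∧_ (isTop-top t) (isTop-top s) ◅ ε)
  from-top : ∀ t p → Star (Edge t) (top t) p
  from-top t p = Star.reverse (λ {p} {q} e → ≡.trans (edge-sym t q p) e) (to-top t p)
  walk : ∀ {p q} → Star (Edge t) p q → Walk graph (place p) (place q)
  walk ε                         = []
  walk {p} (_◅_ {j = q} e steps) = ≡.trans (edges p q) e ∷ walk steps
  no-cycle : ¬ Cycle graph
  no-cycle c = two-parents (argmax h)
    where
    open Cycle c
    h : Fin (3 ℕ.+ k) → ℕ
    h i = depth t (locate (vertex i))
    Adj⇒Edge : ∀ {u v} → Adj u v → Edge t (locate u) (locate v)
    Adj⇒Edge {u} {v} uv = ≡.trans (≡.sym (edges (locate u) (locate v))) (≡.trans (≡.cong₂ adj (place-locate u) (place-locate v)) uv)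
    Adj-sym : ∀ {u v} → Adj u v → Adj v u
    Adj-sym {u} {v} uv = ≡.trans (symmetric v u) uv
    same : ∀ i j j′ → (∀ j → h j ℕ.≤ h i) → Adj (vertex i) (vertex j) → Adj (vertex i) (vertex j′) → j ≡ j′
    same i j j′ max e e′ = distinct (≡.trans (≡.sym (place-locate _)) (≡.trans
      (≡.cong place (parent-unique t (locate (vertex i)) (Adj⇒Edge e) (Adj⇒Edge e′) (max j) (max j′))) (place-locate _)))
    two-parents : ∃[ i ] (∀ j → h j ℕ.≤ h i) → ⊥
    two-parents (zero , max) with same zero (suc zero) (fromℕ (2 ℕ.+ k)) max (step zero) (Adj-sym close)
    ... | ()
    two-parents (suc i , max) = at-view (view (suc i)) ≡.refl
      where
      predecessor : Adj (vertex (suc i)) (vertex (inject₁ i))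
      predecessor = Adj-sym (step i)
      at-view : ∀ {j} → View j → j ≡ suc i → ⊥
      at-view ‵fromℕ eq = contradiction
        (≡.trans (≡.sym (Fin.toℕ-fromℕ (2 ℕ.+ k))) (≡.trans (≡.cong toℕ eq) (≡.cong suc (≡.trans (≡.sym (Fin.toℕ-inject₁ i))
          (≡.cong toℕ (same (suc i) (inject₁ i) zero max predecessor (≡.subst (λ j → Adj (vertex j) (vertex zero)) eq close)))))))
        λ ()
      at-view (‵inject₁ j) eq = ℕ.m≢1+n+m (toℕ i) {1} (≡.trans (≡.sym (Fin.toℕ-inject₁ i))
        (≡.trans (≡.cong toℕ (same (suc i) (inject₁ i) (suc j) max predecessor (≡.subst (λ l → Adj (vertex l) (vertex (suc j))) eq (step j))))
          (≡.cong suc (≡.trans (≡.sym (Fin.toℕ-inject₁ j)) (≡.cong toℕ eq)))))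

-- Reordering branches and moving the root.

record _≃_ (t t′ : Tree) : Set where
  field
    to      : Pos t → Pos t′
    from    : Pos t′ → Pos t
    to-from : ∀ p → to (from p) ≡ p
    from-to : ∀ p → from (to p) ≡ p
    edges   : ∀ p q → edge t′ (to p) (to q) ≡ edge t p q
    tops    : ∀ p → isTop t′ (to p) ≡ isTop t p

≃-refl : ∀ {t} → t ≃ t
≃-refl = record { to = id ; from = id ; to-from = λ _ → ≡.refl ; from-to = λ _ → ≡.refl ; edges = λ _ _ → ≡.refl ; tops = λ _ → ≡.refl }

≃-trans : ∀ {t u v} → t ≃ u → u ≃ v → t ≃ v
≃-trans a b = record
  { to      = b.to ∘ a.to
  ; from    = a.from ∘ b.from
  ; to-from = λ p → ≡.trans (≡.cong b.to (a.to-from _)) (b.to-from p)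
  ; from-to = λ p → ≡.trans (≡.cong a.from (b.from-to _)) (a.from-to p)
  ; edges   = λ p q → ≡.trans (b.edges _ _) (a.edges p q)
  ; tops    = λ p → ≡.trans (b.tops _) (a.tops p)
  }
  where
  module a = _≃_ a
  module b = _≃_ b

⊕-cong : ∀ {t t′ s s′} → t ≃ t′ → s ≃ s′ → (t ⊕ s) ≃ (t′ ⊕ s′)
⊕-cong a b = record
  { to      = Sum.map a.to b.to
  ; from    = Sum.map a.from b.from
  ; to-from = λ { (inj₁ p) → ≡.cong inj₁ (a.to-from p) ; (inj₂ q) → ≡.cong inj₂ (b.to-from q) }
  ; from-to = λ { (inj₁ p) → ≡.cong inj₁ (a.from-to p) ; (inj₂ q) → ≡.cong inj₂ (b.from-to q) }
  ; edges   = λ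
    { (inj₁ p) (inj₁ q) → a.edges p q
    ; (inj₁ p) (inj₂ q) → ≡.cong₂ _∧_ (a.tops p) (b.tops q)
    ; (inj₂ p) (inj₁ q) → ≡.cong₂ _∧_ (a.tops q) (b.tops p)
    ; (inj₂ p) (inj₂ q) → b.edges p q }
  ; tops    = λ { (inj₁ p) → a.tops p ; (inj₂ q) → ≡.refl }
  }
  where
  module a = _≃_ a
  module b = _≃_ b

⊕-swap : ∀ t a b → ((t ⊕ a) ⊕ b) ≃ ((t ⊕ b) ⊕ a)
⊕-swap t a b = record
  { to      = swap
  ; from    = swap
  ; to-from = swap-swap
  ; from-to = swap-swap
  ; edges   = λ
    { (inj₁ (inj₁ p)) (inj₁ (inj₁ q)) → ≡.refl ; (inj₁ (inj₁ p)) (inj₁ (inj₂ q)) → ≡.refl ; (inj₁ (inj₁ p)) (inj₂ q) → ≡.refl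
    ; (inj₁ (inj₂ p)) (inj₁ (inj₁ q)) → ≡.refl ; (inj₁ (inj₂ p)) (inj₁ (inj₂ q)) → ≡.refl ; (inj₁ (inj₂ p)) (inj₂ q) → ≡.refl
    ; (inj₂ p) (inj₁ (inj₁ q)) → ≡.refl ; (inj₂ p) (inj₁ (inj₂ q)) → ≡.refl ; (inj₂ p) (inj₂ q) → ≡.refl }
  ; tops    = λ { (inj₁ (inj₁ p)) → ≡.refl ; (inj₁ (inj₂ q)) → ≡.refl ; (inj₂ q) → ≡.refl }
  }
  where
  swap : ∀ {a b c : Set} → (a ⊎ b) ⊎ c → (a ⊎ c) ⊎ b
  swap (inj₁ (inj₁ p)) = inj₁ (inj₁ p)
  swap (inj₁ (inj₂ q)) = inj₂ q
  swap (inj₂ q)        = inj₁ (inj₂ q)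
  swap-swap : ∀ {a b c : Set} (p : (a ⊎ b) ⊎ c) → swap (swap p) ≡ p
  swap-swap (inj₁ (inj₁ p)) = ≡.refl
  swap-swap (inj₁ (inj₂ q)) = ≡.refl
  swap-swap (inj₂ q)        = ≡.refl

-- The root is quantified because the graph stays fixed while the root moves.
Rootable : Graph → Tree → Set
Rootable G t = ∃[ r ] Represents (G rootedAt r) t

rootable-≃ : ∀ {G t t′} → t ≃ t′ → Rootable G t → Rootable G t′
rootable-≃ {t′ = t′} a (r , ρ) = place (from (top t′)) , record
  { place        = place ∘ from
  ; locate       = to ∘ locate
  ; place-locate = λ v → ≡.trans (≡.cong place (from-to _)) (place-locate v)
  ; locate-place = λ p → ≡.trans (≡.cong to (locate-place _)) (to-from p)
  ; edges        = λ p q → ≡.trans (ρ.edges _ _) (≡.trans (≡.sym (a.edges _ _)) (≡.cong₂ (edge t′) (to-from p) (to-from q)))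
  ; roots        = ≡.refl
  }
  where
  module a = _≃_ a
  module ρ = Represents ρ
  open _≃_ a using (to; from; to-from; from-to)
  open Represents ρ using (place; locate; place-locate; locate-place)

-- The root moves along the edge that joins the two parts; as unrooted trees t ⊕ s and s ⊕ t agree.
rootable-flip : ∀ {G t s} → Rootable G (t ⊕ s) → Rootable G (s ⊕ t)
rootable-flip {t = t} {s} (r , ρ) = place (inj₂ (top s)) , record
  { place        = place ∘ Sum.swap
  ; locate       = Sum.swap ∘ locate
  ; place-locate = λ v → ≡.trans (≡.cong place (swap-swap _)) (place-locate v)
  ; locate-place = λ p → ≡.trans (≡.cong Sum.swap (locate-place _)) (swap-swap p)
  ; edges        = λ p q → ≡.trans (edges _ _) (edge-swap p q)
  ; roots        = ≡.refl
  }
  where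
  open Represents ρ
  swap-swap : ∀ {a b : Set} (p : a ⊎ b) → Sum.swap (Sum.swap p) ≡ p
  swap-swap (inj₁ p) = ≡.refl
  swap-swap (inj₂ q) = ≡.refl
  edge-swap : ∀ p q → edge (t ⊕ s) (Sum.swap p) (Sum.swap q) ≡ edge (s ⊕ t) p q
  edge-swap (inj₁ p) (inj₁ q) = ≡.refl
  edge-swap (inj₁ p) (inj₂ q) = Bool.∧-comm (isTop t q) (isTop s p)
  edge-swap (inj₂ p) (inj₁ q) = Bool.∧-comm (isTop t p) (isTop s q)
  edge-swap (inj₂ p) (inj₂ q) = ≡.refl

treeGraph : Tree → RootedGraph
treeGraph •       = record { order = 1 ; adj = λ _ _ → false ; symmetric = λ _ _ → ≡.refl ; loopless = λ _ → ≡.refl } rootedAt zero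
treeGraph (t ⊕ s) = treeGraph t +ᵀ treeGraph s

represents-+ᵀ : ∀ {T S t s} → Represents T t → Represents S s → Represents (T +ᵀ S) (t ⊕ s)
represents-+ᵀ {T} {S} {t} {s} ρ σ = record
  { place        = place
  ; locate       = locate
  ; place-locate = λ v → place-locate v (splitAt n v) ≡.refl
  ; locate-place = λ
    { (inj₁ p) → ≡.trans (≡.cong (Sum.map ρ.locate σ.locate) (Fin.splitAt-↑ˡ n (ρ.place p) m)) (≡.cong inj₁ (ρ.locate-place p))
    ; (inj₂ q) → ≡.trans (≡.cong (Sum.map ρ.locate σ.locate) (Fin.splitAt-↑ʳ n m (σ.place q))) (≡.cong inj₂ (σ.locate-place q)) }
  ; edges        = edges
  ; roots        = ≡.cong (_↑ˡ m) ρ.roots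
  }
  where
  module ρ = Represents ρ
  module σ = Represents σ
  n = order T
  m = order S
  place : Pos (t ⊕ s) → Fin (n ℕ.+ m)
  place (inj₁ p) = ρ.place p ↑ˡ m
  place (inj₂ q) = n ↑ʳ σ.place q
  locate : Fin (n ℕ.+ m) → Pos (t ⊕ s)
  locate v = Sum.map ρ.locate σ.locate (splitAt n v)
  place-locate : ∀ v x → splitAt n v ≡ x → place (Sum.map ρ.locate σ.locate x) ≡ v
  place-locate v (inj₁ u) eq = ≡.trans (≡.cong (_↑ˡ m) (ρ.place-locate u)) (Fin.splitAt⁻¹-↑ˡ eq)
  place-locate v (inj₂ w) eq = ≡.trans (≡.cong (n ↑ʳ_) (σ.place-locate w)) (Fin.splitAt⁻¹-↑ʳ eq)
  tops : ∀ p q → does (ρ.place p Fin.≟ RootedGraph.root T) ∧ does (σ.place q Fin.≟ RootedGraph.root S) ≡ isTop t p ∧ isTop s q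
  tops p q = ≡.cong₂ _∧_ (≡.trans (ρ.isTop-locate _) (≡.cong (isTop t) (ρ.locate-place p))) (≡.trans (σ.isTop-locate _) (≡.cong (isTop s) (σ.locate-place q)))
  edges : ∀ p q → Graph.adj (RootedGraph.graph (T +ᵀ S)) (place p) (place q) ≡ edge (t ⊕ s) p q
  edges (inj₁ p) (inj₁ q) rewrite Fin.splitAt-↑ˡ n (ρ.place p) m | Fin.splitAt-↑ˡ n (ρ.place q) m = ρ.edges p q
  edges (inj₁ p) (inj₂ q) rewrite Fin.splitAt-↑ˡ n (ρ.place p) m | Fin.splitAt-↑ʳ n m (σ.place q) = tops p q
  edges (inj₂ p) (inj₁ q) rewrite Fin.splitAt-↑ʳ n m (σ.place p) | Fin.splitAt-↑ˡ n (ρ.place q) m = tops q p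
  edges (inj₂ p) (inj₂ q) rewrite Fin.splitAt-↑ʳ n m (σ.place p) | Fin.splitAt-↑ʳ n m (σ.place q) = σ.edges p q

treeGraph-represents : ∀ t → Represents (treeGraph t) t
treeGraph-represents •       = record
  { place = λ _ → zero ; locate = λ _ → tt ; place-locate = λ { zero → ≡.refl } ; locate-place = λ _ → ≡.refl
  ; edges = λ _ _ → ≡.refl ; roots = ≡.refl }
treeGraph-represents (t ⊕ s) = represents-+ᵀ (treeGraph-represents t) (treeGraph-represents s)

same-tree⇒≅ : ∀ {T S t} → Represents T t → Represents S t → RootedGraph.graph T ≅ RootedGraph.graph S
same-tree⇒≅ {T} {S} {t} ρ σ = record
  { vertices = mk↔ₛ′ (σ.place ∘ ρ.locate) (ρ.place ∘ σ.locate)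
      (λ v → ≡.trans (≡.cong σ.place (ρ.locate-place _)) (σ.place-locate v))
      (λ v → ≡.trans (≡.cong ρ.place (σ.locate-place _)) (ρ.place-locate v))
  ; preserve = λ u v → ≡.sym (≡.trans (σ.edges _ _) (≡.trans (≡.sym (ρ.edges _ _)) (≡.cong₂ (Graph.adj (RootedGraph.graph T)) (ρ.place-locate u) (ρ.place-locate v))))
  }
  where
  module ρ = Represents ρ
  module σ = Represents σ

-- Triangular factorisation of x - A from the leaves.

same : ∀ t → Pos t → Pos t → Bool
same •       _        _        = true
same (t ⊕ s) (inj₁ p) (inj₁ q) = same t p q
same (t ⊕ s) (inj₁ p) (inj₂ q) = false
same (t ⊕ s) (inj₂ p) (inj₁ q) = false
same (t ⊕ s) (inj₂ p) (inj₂ q) = same s p q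

same-refl : ∀ t p → same t p p ≡ true
same-refl •       _        = ≡.refl
same-refl (t ⊕ s) (inj₁ p) = same-refl t p
same-refl (t ⊕ s) (inj₂ q) = same-refl s q

same⇒≡ : ∀ t p q → same t p q ≡ true → p ≡ q
same⇒≡ •       _        _        eq = ≡.refl
same⇒≡ (t ⊕ s) (inj₁ p) (inj₁ q) eq = ≡.cong inj₁ (same⇒≡ t p q eq)
same⇒≡ (t ⊕ s) (inj₂ p) (inj₂ q) eq = ≡.cong inj₂ (same⇒≡ s p q eq)

isTop-same : ∀ t p q → isTop t p ∧ same t p q ≡ isTop t p ∧ isTop t q
isTop-same •       p        q        = ≡.refl
isTop-same (t ⊕ s) (inj₁ p) (inj₁ q) = isTop-same t p q
isTop-same (t ⊕ s) (inj₁ p) (inj₂ q) = ≡.refl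
isTop-same (t ⊕ s) (inj₂ p) q        = ≡.refl

-- A stem precedes the branches attached to it, so a position precedes everything below it. `upper`
-- and `lower` are triangular for this order.
preorder : ∀ t → Pos t → ℕ
preorder •       _        = 0
preorder (t ⊕ s) (inj₁ p) = preorder t p
preorder (t ⊕ s) (inj₂ q) = size t ℕ.+ preorder s q

preorder<size : ∀ t p → preorder t p ℕ.< size t
preorder<size •       _        = ℕ.s≤s ℕ.z≤n
preorder<size (t ⊕ s) (inj₁ p) = ℕ.≤-trans (preorder<size t p) (ℕ.m≤m+n _ _)
preorder<size (t ⊕ s) (inj₂ q) = ℕ.+-monoʳ-< (size t) (preorder<size s q)

preorder-injective : ∀ t p q → preorder t p ≡ preorder t q → p ≡ q
preorder-injective •       _        _        eq = ≡.refl
preorder-injective (t ⊕ s) (inj₁ p) (inj₁ q) eq = ≡.cong inj₁ (preorder-injective t p q eq)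
preorder-injective (t ⊕ s) (inj₁ p) (inj₂ q) eq = contradiction eq (ℕ.<⇒≢ (ℕ.≤-trans (preorder<size t p) (ℕ.m≤m+n _ _)))
preorder-injective (t ⊕ s) (inj₂ p) (inj₁ q) eq = contradiction (≡.sym eq) (ℕ.<⇒≢ (ℕ.≤-trans (preorder<size t q) (ℕ.m≤m+n _ _)))
preorder-injective (t ⊕ s) (inj₂ p) (inj₂ q) eq = ≡.cong inj₂ (preorder-injective s p q (ℕ.+-cancelˡ-≡ (size t) _ _ eq))

module Elimination {κ ℓ} (K : CommutativeRing κ ℓ) (x : CommutativeRing.Carrier K) where
  open CommutativeRing K hiding (zero)
  open Integers K
  open CharacteristicLaws K
  open TreeSums K
  open PositionFold *-commutativeMonoid using () renaming (fold to ΠPos; fold-cong to ΠPos-cong; sum-by-position to product-by-position)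
  open SetoidReasoning setoid

  Invertible : Tree → Set (κ ⊔ ℓ)
  Invertible •       = ⊤
  Invertible (t ⊕ s) = Invertible t × Invertible s × ∃[ r ] P s x * r ≈ 1#

  private
    ⟦_⟧ : Bool → Carrier
    ⟦ b ⟧ = if b then 1# else 0#

  -- x - A with d taken off the root entry: d accumulates the terms F s / P s, the reciprocal pivots
  -- of the branches already eliminated.
  shifted : ∀ t → Carrier → Pos t → Pos t → Carrier
  shifted t d p q = ⟦ same t p q ⟧ * x - ⟦ isTop t p ∧ same t p q ⟧ * d - ⟦ edge t p q ⟧

  -- shifted t d = upper · lower: elimination from the leaves, where d is subtracted from the root entry.

  lower : ∀ t → Invertible t → Carrier → Pos t → Pos t → Carrier
  lower •       i                 d _        _        = x - d
  lower (t ⊕ s) (i , j , (r , _)) d (inj₁ p) (inj₁ q) = lower t i (d + F s x * r) p q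
  lower (t ⊕ s) (i , j , (r , _)) d (inj₁ p) (inj₂ q) = 0#
  lower (t ⊕ s) (i , j , (r , _)) d (inj₂ p) (inj₁ q) = - ⟦ isTop s p ∧ isTop t q ⟧
  lower (t ⊕ s) (i , j , (r , _)) d (inj₂ p) (inj₂ q) = lower s j 0# p q

  upper : ∀ t → Invertible t → Pos t → Pos t → Carrier
  upper •       i                 _        _        = 1#
  upper (t ⊕ s) (i , j , (r , _)) (inj₁ p) (inj₁ q) = upper t i p q
  upper (t ⊕ s) (i , j , (r , _)) (inj₁ p) (inj₂ q) = - (⟦ isTop t p ∧ isTop s q ⟧ * (F s x * r))
  upper (t ⊕ s) (i , j , (r , _)) (inj₂ p) (inj₁ q) = 0#
  upper (t ⊕ s) (i , j , (r , _)) (inj₂ p) (inj₂ q) = upper s j p q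

  -- P - d F is the determinant of x - A with d taken off the root entry, because the minor of the
  -- root is F.
  diagonal : ∀ t i d → ΠPos t (λ p → lower t i d p p) ≈ P t x - d * F t x
  diagonal •       i d = solve 2 (λ x d → x :- d := x :- d :* con (+ 1)) refl x d
  diagonal (t ⊕ s) (i , j , (r , Pr≈1)) d = begin
    ΠPos t (λ p → lower t i (d + F s x * r) p p) * ΠPos s (λ q → lower s j 0# q q)
      ≈⟨ *-cong (diagonal t i (d + F s x * r)) (diagonal s j 0#) ⟩
    (P t x - (d + F s x * r) * F t x) * (P s x - 0# * F s x)
      ≈⟨ solve 6 (λ pt ft ps fs d r → (pt :- (d :+ fs :* r) :* ft) :* (ps :- con +0 :* fs) := pt :* ps :- d :* (ft :* ps) :- ft :* fs :* (ps :* r)) refl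
           (P t x) (F t x) (P s x) (F s x) d r ⟩
    P t x * P s x - d * (F t x * P s x) - F t x * F s x * (P s x * r)
      ≈⟨ +-congˡ (-‿cong (trans (*-congˡ Pr≈1) (*-identityʳ _))) ⟩
    P t x * P s x - d * (F t x * P s x) - F t x * F s x
      ≈⟨ solve 3 (λ p d f → p :- d :- f := p :- f :- d) refl _ _ _ ⟩
    P t x * P s x - F t x * F s x - d * (F t x * P s x) ∎

  pivot : ∀ t → Invertible t → Carrier → Carrier
  pivot t i d = lower t i d (top t) (top t)

  pivot-value : ∀ t i d → pivot t i d * F t x ≈ P t x - d * F t x
  pivot-value •       i d = solve 2 (λ x d → (x :- d) :* con (+ 1) := x :- d :* con (+ 1)) refl x d
  pivot-value (t ⊕ s) (i , j , (r , Pr≈1)) d = begin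
    pivot t i (d + F s x * r) * (F t x * P s x)
      ≈⟨ *-assoc _ _ _ ⟨
    pivot t i (d + F s x * r) * F t x * P s x
      ≈⟨ *-congʳ (pivot-value t i (d + F s x * r)) ⟩
    (P t x - (d + F s x * r) * F t x) * P s x
      ≈⟨ solve 6 (λ pt ft ps fs d r → (pt :- (d :+ fs :* r) :* ft) :* ps := pt :* ps :- d :* (ft :* ps) :- ft :* fs :* (ps :* r)) refl
           (P t x) (F t x) (P s x) (F s x) d r ⟩
    P t x * P s x - d * (F t x * P s x) - F t x * F s x * (P s x * r)
      ≈⟨ +-congˡ (-‿cong (trans (*-congˡ Pr≈1) (*-identityʳ _))) ⟩
    P t x * P s x - d * (F t x * P s x) - F t x * F s x
      ≈⟨ solve 3 (λ p d f → p :- d :- f := p :- f :- d) refl _ _ _ ⟩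
    P t x * P s x - F t x * F s x - d * (F t x * P s x) ∎

  lower-top : ∀ t i d q → lower t i d (top t) q ≈ ⟦ isTop t q ⟧ * pivot t i d
  lower-top •       i d q        = sym (*-identityˡ _)
  lower-top (t ⊕ s) (i , j , (r , _)) d (inj₁ q) = lower-top t i (d + F s x * r) q
  lower-top (t ⊕ s) (i , j , (r , _)) d (inj₂ q) = sym (zeroˡ _)

  upper-top : ∀ t i p → upper t i p (top t) ≈ ⟦ isTop t p ⟧
  upper-top •       i p        = refl
  upper-top (t ⊕ s) (i , j , _) (inj₁ p) = upper-top t i p
  upper-top (t ⊕ s) (i , j , _) (inj₂ p) = refl

  private
    ⟦∧⟧ : ∀ b c → ⟦ b ∧ c ⟧ ≈ ⟦ b ⟧ * ⟦ c ⟧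
    ⟦∧⟧ true  c = sym (*-identityˡ _)
    ⟦∧⟧ false c = sym (zeroˡ _)

    ΣPos-top : ∀ t (f : Pos t → Carrier) → ΣPos t (λ p → ⟦ isTop t p ⟧ * f p) ≈ f (top t)
    ΣPos-top •       f = *-identityˡ _
    ΣPos-top (t ⊕ s) f = trans (+-cong (ΣPos-top t (f ∘ inj₁)) (trans (ΣPos-cong s λ q → zeroˡ (f (inj₂ q))) (ΣPos-zero s))) (+-identityʳ _)

    ΣPos-vanishes : ∀ t {f : Pos t → Carrier} → (∀ p → f p ≈ 0#) → ΣPos t f ≈ 0#
    ΣPos-vanishes t f≈0 = trans (ΣPos-cong t f≈0) (ΣPos-zero t)

  -- Sums across the joining edge collapse because `isTop` selects one position. Within t, the
  -- correction b that `lower` subtracts at the root is given back by the entry that joins the root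
  -- to the branch.
  factorisation : ∀ t i d p q → ΣPos t (λ w → upper t i p w * lower t i d w q) ≈ shifted t d p q
  factorisation • i d p q = solve 2 (λ x d → con (+ 1) :* (x :- d) := con (+ 1) :* x :- con (+ 1) :* d :- con +0) refl x d
  factorisation (t ⊕ s) (i , j , (r , Pr≈1)) d (inj₁ p) (inj₁ q) = begin
    ΣPos t (λ w → upper t i p w * lower t i (d + b) w q) + ΣPos s (λ w → - (⟦ isTop t p ∧ isTop s w ⟧ * b) * - ⟦ isTop s w ∧ isTop t q ⟧)
      ≈⟨ +-cong (factorisation t i (d + b) p q) (trans (ΣPos-cong s λ w → trans
           (*-cong (-‿cong (*-congʳ (⟦∧⟧ (isTop t p) (isTop s w)))) (-‿cong (⟦∧⟧ (isTop s w) (isTop t q))))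
           (solve 4 (λ p w q b → :- (p :* w :* b) :* :- (w :* q) := w :* (w :* (p :* q :* b))) refl ⟦ isTop t p ⟧ ⟦ isTop s w ⟧ ⟦ isTop t q ⟧ b))
           (ΣPos-top s (λ w → ⟦ isTop s w ⟧ * (⟦ isTop t p ⟧ * ⟦ isTop t q ⟧ * b)))) ⟩
    ⟦ same t p q ⟧ * x - ⟦ isTop t p ∧ same t p q ⟧ * (d + b) - e + ⟦ isTop s (top s) ⟧ * (⟦ isTop t p ⟧ * ⟦ isTop t q ⟧ * b)
      ≈⟨ +-congˡ (trans (*-congʳ (reflexive (≡.cong ⟦_⟧ (isTop-top s)))) (trans (*-identityˡ _) (*-congʳ
           (trans (sym (⟦∧⟧ (isTop t p) (isTop t q))) (reflexive (≡.cong ⟦_⟧ (≡.sym (isTop-same t p q)))))))) ⟩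
    ⟦ same t p q ⟧ * x - ⟦ isTop t p ∧ same t p q ⟧ * (d + b) - e + ⟦ isTop t p ∧ same t p q ⟧ * b
      ≈⟨ solve 6 (λ m x k d b e → m :* x :- k :* (d :+ b) :- e :+ k :* b := m :* x :- k :* d :- e) refl ⟦ same t p q ⟧ x ⟦ isTop t p ∧ same t p q ⟧ d b e ⟩
    ⟦ same t p q ⟧ * x - ⟦ isTop t p ∧ same t p q ⟧ * d - e ∎
    where
    b = F s x * r
    e = ⟦ edge t p q ⟧
  factorisation (t ⊕ s) (i , j , (r , Pr≈1)) d (inj₁ p) (inj₂ q) = begin
    ΣPos t (λ w → upper t i p w * 0#) + ΣPos s (λ w → - (⟦ isTop t p ∧ isTop s w ⟧ * b) * lower s j 0# w q)
      ≈⟨ +-cong (ΣPos-vanishes t (λ w → zeroʳ _)) (trans (ΣPos-cong s λ w → trans (*-congʳ (-‿cong (*-congʳ (⟦∧⟧ (isTop t p) (isTop s w)))))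
           (solve 4 (λ p w b l → :- (p :* w :* b) :* l := w :* (:- (p :* b) :* l)) refl ⟦ isTop t p ⟧ ⟦ isTop s w ⟧ b (lower s j 0# w q)))
           (ΣPos-top s (λ w → - (⟦ isTop t p ⟧ * b) * lower s j 0# w q))) ⟩
    0# + - (⟦ isTop t p ⟧ * b) * lower s j 0# (top s) q
      ≈⟨ +-congˡ (*-congˡ (lower-top s j 0# q)) ⟩
    0# + - (⟦ isTop t p ⟧ * b) * (⟦ isTop s q ⟧ * pivot s j 0#)
      ≈⟨ solve 5 (λ p f r q v → con +0 :+ :- (p :* (f :* r)) :* (q :* v) := :- (p :* q :* (v :* f :* r))) refl ⟦ isTop t p ⟧ (F s x) r ⟦ isTop s q ⟧ (pivot s j 0#) ⟩
    - (⟦ isTop t p ⟧ * ⟦ isTop s q ⟧ * (pivot s j 0# * F s x * r))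
      ≈⟨ -‿cong (*-cong (sym (⟦∧⟧ (isTop t p) (isTop s q))) (trans (*-congʳ (trans (pivot-value s j 0#) (solve 2 (λ p f → p :- con +0 :* f := p) refl (P s x) (F s x)))) Pr≈1)) ⟩
    - (⟦ isTop t p ∧ isTop s q ⟧ * 1#)
      ≈⟨ solve 4 (λ k e x d → :- (k :* con (+ 1)) := con +0 :* x :- e :* d :- k :+ e :* d) refl ⟦ isTop t p ∧ isTop s q ⟧ ⟦ isTop t p ∧ false ⟧ x d ⟩
    0# * x - ⟦ isTop t p ∧ false ⟧ * d - ⟦ isTop t p ∧ isTop s q ⟧ + ⟦ isTop t p ∧ false ⟧ * d
      ≈⟨ trans (+-congˡ (trans (*-congʳ (reflexive (≡.cong ⟦_⟧ (Bool.∧-zeroʳ (isTop t p))))) (zeroˡ d))) (+-identityʳ _) ⟩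
    0# * x - ⟦ isTop t p ∧ false ⟧ * d - ⟦ isTop t p ∧ isTop s q ⟧ ∎
    where
    b = F s x * r
  factorisation (t ⊕ s) (i , j , (r , Pr≈1)) d (inj₂ p) (inj₁ q) = begin
    ΣPos t (λ w → 0# * lower t i (d + F s x * r) w q) + ΣPos s (λ w → upper s j p w * - ⟦ isTop s w ∧ isTop t q ⟧)
      ≈⟨ +-cong (ΣPos-vanishes t (λ w → zeroˡ _)) (trans (ΣPos-cong s λ w → trans (*-congˡ (-‿cong (⟦∧⟧ (isTop s w) (isTop t q))))
           (solve 3 (λ u w q → u :* :- (w :* q) := w :* (u :* :- q)) refl (upper s j p w) ⟦ isTop s w ⟧ ⟦ isTop t q ⟧))
           (ΣPos-top s (λ w → upper s j p w * - ⟦ isTop t q ⟧))) ⟩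
    0# + upper s j p (top s) * - ⟦ isTop t q ⟧
      ≈⟨ +-congˡ (*-congʳ (upper-top s j p)) ⟩
    0# + ⟦ isTop s p ⟧ * - ⟦ isTop t q ⟧
      ≈⟨ solve 4 (λ p q x d → con +0 :+ p :* :- q := con +0 :* x :- con +0 :* d :- q :* p) refl ⟦ isTop s p ⟧ ⟦ isTop t q ⟧ x d ⟩
    0# * x - 0# * d - ⟦ isTop t q ⟧ * ⟦ isTop s p ⟧
      ≈⟨ +-congˡ (-‿cong (sym (⟦∧⟧ (isTop t q) (isTop s p)))) ⟩
    0# * x - 0# * d - ⟦ isTop t q ∧ isTop s p ⟧ ∎
  factorisation (t ⊕ s) (i , j , (r , Pr≈1)) d (inj₂ p) (inj₂ q) = begin
    ΣPos t (λ w → 0# * 0#) + ΣPos s (λ w → upper s j p w * lower s j 0# w q)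
      ≈⟨ +-cong (ΣPos-vanishes t (λ w → zeroˡ 0#)) (factorisation s j 0# p q) ⟩
    0# + (⟦ same s p q ⟧ * x - ⟦ isTop s p ∧ same s p q ⟧ * 0# - ⟦ edge s p q ⟧)
      ≈⟨ solve 5 (λ m x k e d → con +0 :+ (m :* x :- k :* con +0 :- e) := m :* x :- con +0 :* d :- e) refl ⟦ same s p q ⟧ x ⟦ isTop s p ∧ same s p q ⟧ ⟦ edge s p q ⟧ d ⟩
    ⟦ same s p q ⟧ * x - 0# * d - ⟦ edge s p q ⟧ ∎

  upper-diagonal : ∀ t i p → upper t i p p ≈ 1#
  upper-diagonal •       i           p        = refl
  upper-diagonal (t ⊕ s) (i , j , _) (inj₁ p) = upper-diagonal t i p
  upper-diagonal (t ⊕ s) (i , j , _) (inj₂ q) = upper-diagonal s j q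

  upper-triangular : ∀ t i p q → p ≢ q → ¬ preorder t p ℕ.< preorder t q → upper t i p q ≈ 0#
  upper-triangular •       i           p        q        p≢q p≮q = contradiction ≡.refl p≢q
  upper-triangular (t ⊕ s) (i , j , _) (inj₁ p) (inj₁ q) p≢q p≮q = upper-triangular t i p q (p≢q ∘ ≡.cong inj₁) p≮q
  upper-triangular (t ⊕ s) (i , j , _) (inj₁ p) (inj₂ q) p≢q p≮q = contradiction (ℕ.≤-trans (preorder<size t p) (ℕ.m≤m+n _ _)) p≮q
  upper-triangular (t ⊕ s) (i , j , _) (inj₂ p) (inj₁ q) p≢q p≮q = refl
  upper-triangular (t ⊕ s) (i , j , _) (inj₂ p) (inj₂ q) p≢q p≮q = upper-triangular s j p q (p≢q ∘ ≡.cong inj₂) (p≮q ∘ ℕ.+-monoʳ-< (size t))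

  lower-triangular : ∀ t i d p q → p ≢ q → ¬ preorder t q ℕ.< preorder t p → lower t i d p q ≈ 0#
  lower-triangular •       i           d p        q        p≢q q≮p = contradiction ≡.refl p≢q
  lower-triangular (t ⊕ s) (i , j , (r , _)) d (inj₁ p) (inj₁ q) p≢q q≮p = lower-triangular t i (d + F s x * r) p q (p≢q ∘ ≡.cong inj₁) q≮p
  lower-triangular (t ⊕ s) (i , j , _) d (inj₁ p) (inj₂ q) p≢q q≮p = refl
  lower-triangular (t ⊕ s) (i , j , _) d (inj₂ p) (inj₁ q) p≢q q≮p = contradiction (ℕ.≤-trans (preorder<size t q) (ℕ.m≤m+n _ _)) q≮p
  lower-triangular (t ⊕ s) (i , j , _) d (inj₂ p) (inj₂ q) p≢q q≮p = lower-triangular s j 0# p q (p≢q ∘ ≡.cong inj₂) (q≮p ∘ ℕ.+-monoʳ-< (size t))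

  open Matrices rawRing using (det; scalar; Matrix)
  open Determinants K using (det-unitriangular; det-triangular)

  det-adjacency : ∀ {T t} → Represents T t → Invertible t → det (λ u v → scalar x u v - adjacency rawRing (RootedGraph.graph T) u v) ≈ P t x
  det-adjacency {T} {t} ρ i = begin
    det M                        ≈⟨ det-unitriangular h (λ eq → locate-injective (preorder-injective t _ _ eq)) (size t) (λ u → preorder<size t (locate u))
                                     M N C (λ u → upper-diagonal t i (locate u)) (λ u w u≢w → upper-triangular t i (locate u) (locate w) (u≢w ∘ locate-injective)) M≈CN ⟩
    det N                        ≈⟨ det-triangular N h (λ u w u≢w → lower-triangular t i 0# (locate u) (locate w) (u≢w ∘ locate-injective)) ⟩
    product (λ u → N u u)        ≈⟨ product-by-position ρ (λ u → N u u) ⟩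
    ΠPos t (λ p → lower t i 0# (locate (place p)) (locate (place p)))
      ≈⟨ ΠPos-cong t (λ p → reflexive (≡.cong₂ (lower t i 0#) (locate-place p) (locate-place p))) ⟩
    ΠPos t (λ p → lower t i 0# p p)  ≈⟨ diagonal t i 0# ⟩
    P t x - 0# * F t x           ≈⟨ solve 2 (λ p f → p :- con +0 :* f := p) refl (P t x) (F t x) ⟩
    P t x                        ∎
    where
    open Represents ρ
    open Graph (RootedGraph.graph T) using (adj)
    open RawMonoidDefs (CommutativeMonoid.rawMonoid *-commutativeMonoid) using () renaming (sum to product)
    locate-injective : ∀ {u v} → locate u ≡ locate v → u ≡ v
    locate-injective eq = ≡.trans (≡.sym (place-locate _)) (≡.trans (≡.cong place eq) (place-locate _))
    h : Fin (order T) → ℕ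
    h u = preorder t (locate u)
    M N C : Matrix (order T)
    M u v = scalar x u v - adjacency rawRing (RootedGraph.graph T) u v
    N u v = lower t i 0# (locate u) (locate v)
    C u v = upper t i (locate u) (locate v)
    same-locate : ∀ u v → does (u Fin.≟ v) ≡ same t (locate u) (locate v)
    same-locate u v with u Fin.≟ v
    ... | yes ≡.refl = ≡.sym (same-refl t (locate u))
    ... | no u≢v with same t (locate u) (locate v) in eq
    ...   | true  = contradiction (locate-injective (same⇒≡ t _ _ eq)) u≢v
    ...   | false = ≡.refl
    if-* : ∀ b → (if b then x else 0#) ≈ ⟦ b ⟧ * x
    if-* true  = sym (*-identityˡ x)
    if-* false = sym (zeroˡ x)
    M≈CN : ∀ u v → M u v ≈ RawMonoidDefs.sum +-rawMonoid (λ w → C u w * N w v)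
    M≈CN u v = begin
      M u v
        ≈⟨ +-cong (trans (reflexive (≡.cong (λ b → if b then x else 0#) (same-locate u v))) (if-* (same t (locate u) (locate v))))
             (-‿cong (reflexive (≡.cong ⟦_⟧ (≡.trans (≡.sym (≡.cong₂ adj (place-locate u) (place-locate v))) (edges (locate u) (locate v)))))) ⟩
      ⟦ same t (locate u) (locate v) ⟧ * x - ⟦ edge t (locate u) (locate v) ⟧
        ≈⟨ solve 3 (λ m k e → m :- e := m :- k :* con +0 :- e) refl _ ⟦ isTop t (locate u) ∧ same t (locate u) (locate v) ⟧ _ ⟩
      shifted t 0# (locate u) (locate v)
        ≈⟨ factorisation t i 0# (locate u) (locate v) ⟨
      ΣPos t (λ w → upper t i (locate u) w * lower t i 0# w (locate v))
        ≈⟨ ΣPos-cong t (λ p → reflexive (≡.cong (λ w → upper t i (locate u) w * lower t i 0# w (locate v)) (≡.sym (locate-place p)))) ⟩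
      ΣPos t (λ p → C u (place p) * N (place p) v)
        ≈⟨ sum-by-position ρ (λ w → C u w * N w v) ⟨
      RawMonoidDefs.sum +-rawMonoid (λ w → C u w * N w v) ∎

-- The characteristic polynomial and the reciprocal polynomial.

module ℕ-Solver = NatSolver.+-*-Solver

module _ where
  open Coefficients ℤ.+-*-rawRing

  coeff-add : ∀ p q k → coeff (add p q) k ≡ coeff p k ℤ.+ coeff q k
  coeff-add []      q       k       = ≡.sym (ℤ.+-identityˡ _)
  coeff-add (a ∷ p) []      k       = ≡.sym (ℤ.+-identityʳ _)
  coeff-add (a ∷ p) (b ∷ q) zero    = ≡.refl
  coeff-add (a ∷ p) (b ∷ q) (suc k) = coeff-add p q k

  coeff-neg : ∀ p k → coeff (map ℤ.-_ p) k ≡ ℤ.- coeff p k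
  coeff-neg []      k       = ≡.refl
  coeff-neg (a ∷ p) zero    = ≡.refl
  coeff-neg (a ∷ p) (suc k) = coeff-neg p k

  coeff-scale : ∀ a p k → coeff (scale a p) k ≡ a ℤ.* coeff p k
  coeff-scale a []      k       = ≡.sym (ℤ.*-zeroʳ a)
  coeff-scale a (b ∷ p) zero    = ≡.refl
  coeff-scale a (b ∷ p) (suc k) = coeff-scale a p k

  -- z ʲ p(z) is a combination of z ᵉ , z ᵉ⁻² , z ᵉ⁻⁴ , …

  Graded : ℕ → ℕ → List ℤ → Set
  Graded j e p = ∀ k → coeff p k ≡ +0 ⊎ ∃[ m ] j ℕ.+ k ℕ.+ 2 ℕ.* m ≡ e

  graded-add : ∀ {j e} p q → Graded j e p → Graded j e q → Graded j e (add p q)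
  graded-add p q gp gq k with gp k | gq k
  ... | inj₂ m | _      = inj₂ m
  ... | _      | inj₂ m = inj₂ m
  ... | inj₁ a | inj₁ b = inj₁ (≡.trans (coeff-add p q k) (≡.cong₂ ℤ._+_ a b))

  graded-neg : ∀ {j e} p → Graded j e p → Graded j e (map ℤ.-_ p)
  graded-neg p gp k = Sum.map₁ (λ a → ≡.trans (coeff-neg p k) (≡.cong ℤ.-_ a)) (gp k)

  graded-weaken : ∀ {j e} p → Graded j e p → Graded j (2 ℕ.+ e) p
  graded-weaken {j} p gp k = Sum.map₂ (λ (m , eq) → suc m ,
    ≡.trans (ℕ-Solver.solve 2 (λ a m → a ℕ-Solver.:+ ℕ-Solver.con 2 ℕ-Solver.:* (ℕ-Solver.con 1 ℕ-Solver.:+ m) ℕ-Solver.:= ℕ-Solver.con 2 ℕ-Solver.:+ (a ℕ-Solver.:+ ℕ-Solver.con 2 ℕ-Solver.:* m)) ≡.refl (j ℕ.+ k) m)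
      (≡.cong (2 ℕ.+_) eq)) (gp k)

  graded-mul : ∀ {j e e′} p q → Graded j e p → Graded 0 e′ q → Graded j (e ℕ.+ e′) (mul p q)
  graded-mul []      q gp gq k = inj₁ ≡.refl
  graded-mul {j} {e} {e′} (a ∷ p) q gp gq = graded-add {j} {e ℕ.+ e′} (scale a q) (+0 ∷ mul p q) first rest
    where
    first : Graded j (e ℕ.+ e′) (scale a q)
    first k with gp zero | gq k
    ... | inj₁ a≡0 | _ = inj₁ (≡.trans (coeff-scale a q k) (≡.cong (ℤ._* coeff q k) a≡0))
    ... | inj₂ _ | inj₁ b≡0 = inj₁ (≡.trans (coeff-scale a q k) (≡.trans (≡.cong (a ℤ.*_) b≡0) (ℤ.*-zeroʳ a)))
    ... | inj₂ (m , ≡.refl) | inj₂ (m′ , ≡.refl) = inj₂ (m ℕ.+ m′ ,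
      ℕ-Solver.solve 4 (λ j k m m′ → j ℕ-Solver.:+ k ℕ-Solver.:+ ℕ-Solver.con 2 ℕ-Solver.:* (m ℕ-Solver.:+ m′)
        ℕ-Solver.:= j ℕ-Solver.:+ ℕ-Solver.con 0 ℕ-Solver.:+ ℕ-Solver.con 2 ℕ-Solver.:* m ℕ-Solver.:+ (k ℕ-Solver.:+ ℕ-Solver.con 2 ℕ-Solver.:* m′)) ≡.refl j k m m′)
    rest : Graded j (e ℕ.+ e′) (+0 ∷ mul p q)
    rest zero    = inj₁ ≡.refl
    rest (suc k) = Sum.map₂ (λ (m , eq) → m , ≡.trans (≡.cong (ℕ._+ 2 ℕ.* m) (ℕ.+-suc j k)) eq)
      (graded-mul {suc j} {e} {e′} p q (λ k → Sum.map₂ (λ (m , eq) → m , ≡.trans (≡.cong (ℕ._+ 2 ℕ.* m) (≡.sym (ℕ.+-suc j k))) eq) (gp (suc k))) gq k)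

  module ℤ[X] = Characteristic ℤ[X]

  -- Bipartiteness in algebraic form: the exponents in `P` have the parity of the size, those in `F`
  -- the opposite one. Hence halving the exponents in `R` is exact.
  F-graded : ∀ t → ∃[ e ] suc e ≡ size t × Graded 0 e (ℤ[X].F t X)
  P-graded : ∀ t → Graded 0 (size t) (ℤ[X].P t X)
  P-graded •       0             = inj₁ ≡.refl
  P-graded •       1             = inj₂ (0 , ≡.refl)
  P-graded •       (suc (suc k)) = inj₁ ≡.refl
  P-graded (t ⊕ s) with F-graded t | F-graded s
  ... | e , e≡ , ft | e′ , e′≡ , fs = graded-add {0} {size t ℕ.+ size s} PP (map ℤ.-_ FF)
    (graded-mul {0} {size t} {size s} (ℤ[X].P t X) (ℤ[X].P s X) (P-graded t) (P-graded s))
    (graded-neg {0} {size t ℕ.+ size s} FF (≡.subst (λ n → Graded 0 n FF)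
      (≡.trans (≡.cong suc (≡.sym (ℕ.+-suc e e′))) (≡.cong₂ ℕ._+_ e≡ e′≡))
      (graded-weaken {0} {e ℕ.+ e′} FF (graded-mul {0} {e} {e′} (ℤ[X].F t X) (ℤ[X].F s X) ft fs))))
    where
    PP = mul (ℤ[X].P t X) (ℤ[X].P s X)
    FF = mul (ℤ[X].F t X) (ℤ[X].F s X)
  F-graded •       = 0 , ≡.refl , λ { zero → inj₂ (0 , ≡.refl) ; (suc k) → inj₁ ≡.refl }
  F-graded (t ⊕ s) with F-graded t
  ... | e , e≡ , ft = e ℕ.+ size s , ≡.cong (ℕ._+ size s) e≡ , graded-mul {0} {e} {size s} (ℤ[X].F t X) (ℤ[X].P s X) ft (P-graded s)

represents-size : ∀ {T t} → Represents T t → order T ≡ size t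
represents-size {T} {t} ρ = ↔⇒≡ (Composition.inverse (Symmetry.inverse (mk↔ₛ′ place locate place-locate locate-place)) (enumerate t))
  where open Represents ρ

module CharacteristicPolynomial {κ ℓ₁ ℓ₂} (ℝ : RealClosedField κ ℓ₁ ℓ₂) where
  open RealClosedField ℝ hiding (zero) renaming (commutativeRing to K)
  open OrderedField ℝ
  open Monotonicity ℝ
  open Integers K
  open CharacteristicLaws K
  private
    module ℤ-poly = Coefficients ℤ.+-*-rawRing
    module E = Evaluation (fromIntegers K)

  Positive⇒Invertible : ∀ t {x} → Positive t x → Elimination.Invertible K x t
  Positive⇒Invertible •       _               = tt
  Positive⇒Invertible (t ⊕ s) (pt , ps , 0<P) = Positive⇒Invertible t pt , Positive⇒Invertible s ps , inverse (0<⇒≉0 0<P)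

  χ-value : ∀ {T t} → Represents T t → ∀ {x} → Positive t x → E.ev (χ (RootedGraph.graph T)) x ≈ P t x
  χ-value {T} {t} ρ {x} pt = trans (ev-χ K (RootedGraph.graph T) x) (Elimination.det-adjacency K x ρ (Positive⇒Invertible t pt))

  -- The elimination yields χ = P only at x beyond the index, where the pivots are invertible. The
  -- difference vanishes on this half-line, so its coefficients are zero in the field, and an
  -- integer that is zero there is zero.
  coeff-χ : ∀ {T t} → Represents T t → ∀ k → ℤ-poly.coeff (χ (RootedGraph.graph T)) k ≡ ℤ-poly.coeff (ℤ[X].P t ℤ-poly.X) k
  coeff-χ {T} {t} ρ k = ℤ.i-j≡0⇒i≡j _ _ (≡.trans (≡.cong (λ j → ℤ-poly.coeff c k ℤ.+ j) (≡.sym (coeff-neg p k)))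
    (≡.trans (≡.sym (coeff-add c (map ℤ.-_ p) k)) (ι-injective₀ (ℤ-poly.coeff d k) (trans (coeff-map d k) (vanishes⇒0 _ (map ι d) ℕ.≤-refl y ev-d k)))))
    where
    c = χ (RootedGraph.graph T)
    p = ℤ[X].P t ℤ-poly.X
    d = ℤ-poly.add c (map ℤ.-_ p)
    y = proj₁ (index t)
    coeff-map : ∀ p k → ι (ℤ-poly.coeff p k) ≈ coeff (map ι p) k
    coeff-map []      k       = refl
    coeff-map (a ∷ p) zero    = refl
    coeff-map (a ∷ p) (suc k) = coeff-map p k
    ev-map : ∀ p x → ev (map ι p) x ≡ E.ev p x
    ev-map []      x = ≡.refl
    ev-map (a ∷ p) x = ≡.cong (λ v → ι a + x * v) (ev-map p x)
    ev-d : ∀ x → y < x → ev (map ι d) x ≈ 0#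
    ev-d x y<x = trans (reflexive (ev-map d x)) (trans (E.ev-add c (map ℤ.-_ p) x) (trans
      (+-cong (χ-value ρ (proj₁ (rises t (proj₁ (proj₂ (index t))) y<x)))
        (trans (E.ev-neg p x) (-‿cong (trans (P-homo (E.at x) t ℤ-poly.X) (P-cong t (E.ev-X x))))))
      (-‿inverseʳ (P t x))))

  module _ {κ′ ℓ′} (L : CommutativeRing κ′ ℓ′) where
    private
      module L where
        open CommutativeRing L public
        open CharacteristicLaws L public
        open Integers L public
        open RawSemiringDefs (RawRing.rawSemiring (CommutativeRing.rawRing L)) public using (_^_)
        open RawMonoidDefs (CommutativeRing.+-rawMonoid L) public using (sum)
        open SemiringExp (CommutativeRing.semiring L) public using (^-homo-*; ^-assocʳ; ^-congˡ)
        open CommutativeExp (CommutativeRing.commutativeSemiring L) public using (^-distrib-*)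
      module EL = Evaluation (fromIntegers L)
      open SetoidReasoning L.setoid
      open RawSemiringDefs (RawRing.rawSemiring ℤ[X]) using () renaming (_^_ to _^ₓ_)
      module SL = SemiringSum L.semiring

    ev-as-sum : ∀ n p y → (∀ k → n ℕ.≤ k → ℤ-poly.coeff p k ≡ +0) →
      EL.ev p y L.≈ L.sum {n} (λ k → L.ι (ℤ-poly.coeff p (toℕ k)) L.* y L.^ toℕ k)
    ev-as-sum zero    p       y p≡0 = EL.ev-zero p y (λ k → p≡0 k ℕ.z≤n)
    ev-as-sum (suc n) []      y p≡0 = L.sym (trans′ n)
      where
      trans′ : ∀ n → L.sum {suc n} (λ k → L.0# L.* y L.^ toℕ k) L.≈ L.0#
      trans′ n = L.trans (SL.sum-cong-≋ {suc n} (λ k → L.zeroˡ (y L.^ toℕ k))) (SL.sum-replicate-zero (suc n))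
    ev-as-sum (suc n) (a ∷ p) y p≡0 = L.+-cong (L.sym (L.*-identityʳ _))
      (L.trans (L.*-congˡ (ev-as-sum n p y (λ k n≤k → p≡0 (suc k) (ℕ.s≤s n≤k))))
        (L.trans (SL.*-distribˡ-sum {n} y (λ k → L.ι (ℤ-poly.coeff p (toℕ k)) L.* y L.^ toℕ k))
          (SL.sum-cong-≋ {n} {λ k → y L.* (L.ι (ℤ-poly.coeff p (toℕ k)) L.* y L.^ toℕ k)} {λ k → L.ι (ℤ-poly.coeff p (toℕ k)) L.* (y L.* y L.^ toℕ k)} λ k → L.solve 3 (λ y c z → y L.:* (c L.:* z) L.:= c L.:* (y L.:* z)) L.refl y (L.ι (ℤ-poly.coeff p (toℕ k))) (y L.^ toℕ k))))

    -- The integer coefficients agree, so no pivot has to be invertible and L is arbitrary: it will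
    -- be the field, its dual numbers and its complex numbers.
    χ-everywhere : ∀ {T t} → Represents T t → ∀ x → EL.ev (χ (RootedGraph.graph T)) x L.≈ L.P t x
    χ-everywhere {T} {t} ρ x = L.trans (EL.ev-cong (χ (RootedGraph.graph T)) (ℤ[X].P t ℤ-poly.X) x (coeff-χ ρ))
      (L.trans (P-homo (EL.at x) t ℤ-poly.X) (L.P-cong t (EL.ev-X x)))

    -- With z = s² and y = s + s⁻¹ one has 1 + z = s y. Only the k with n - k even contribute, and
    -- for them the monomial z^((n - k) / 2) (1 + z)^k equals s^n y^k.
    R-value : ∀ {T t} → Represents T t → ∀ {s s⁻¹} → s L.* s⁻¹ L.≈ L.1# →
      EL.ev (R (RootedGraph.graph T)) (s L.* s) L.≈ s L.^ order T L.* L.P t (s L.+ s⁻¹)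
    R-value {T} {t} ρ {s} {s⁻¹} ss⁻¹≈1 = begin
      EL.ev (R G) z
        ≈⟨ sum-homo (EL.at z) (λ k → ℤ-poly.scale (c (toℕ k)) (monomial k)) ⟩
      L.sum {suc n} (λ k → EL.ev (ℤ-poly.scale (c (toℕ k)) (monomial k)) z)
        ≈⟨ SL.sum-cong-≋ {suc n} (λ k → L.trans (EL.ev-scale (c (toℕ k)) (monomial k) z) (term k (graded (toℕ k)))) ⟩
      L.sum {suc n} (λ k → s L.^ n L.* (L.ι (c (toℕ k)) L.* y L.^ toℕ k))
        ≈⟨ SL.*-distribˡ-sum {suc n} (s L.^ n) (λ k → L.ι (c (toℕ k)) L.* y L.^ toℕ k) ⟨
      s L.^ n L.* L.sum {suc n} (λ k → L.ι (c (toℕ k)) L.* y L.^ toℕ k)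
        ≈⟨ L.*-congˡ (ev-as-sum (suc n) (χ G) y high) ⟨
      s L.^ n L.* EL.ev (χ G) y
        ≈⟨ L.*-congˡ (χ-everywhere ρ y) ⟩
      s L.^ n L.* L.P t y ∎
      where
      G = RootedGraph.graph T
      n = order T
      z = s L.* s
      y = s L.+ s⁻¹
      c = ℤ-poly.coeff (χ G)
      1+X = ℤ-poly.add (+ 1 ∷ []) ℤ-poly.X
      monomial : Fin (suc n) → List ℤ
      monomial k = ℤ-poly.mul (ℤ-poly.X ^ₓ ⌊ (n ∸ toℕ k) /2⌋) (1+X ^ₓ toℕ k)
      graded : ∀ k → c k ≡ +0 ⊎ ∃[ m ] k ℕ.+ 2 ℕ.* m ≡ n
      graded k = Sum.map (≡.trans (coeff-χ ρ k)) (λ (m , eq) → m , ≡.trans eq (≡.sym (represents-size ρ))) (P-graded t k)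
      high : ∀ k → suc n ℕ.≤ k → c k ≡ +0
      high k n<k = Sum.[ id , (λ (m , eq) → contradiction (ℕ.≤-trans (ℕ.m≤m+n k (2 ℕ.* m)) (ℕ.≤-reflexive eq)) (ℕ.<⇒≱ n<k)) ]′ (graded k)
      1+z : L.1# L.+ z L.≈ s L.* y
      1+z = L.trans (L.+-comm L.1# z) (L.sym (L.trans (L.distribˡ s s s⁻¹) (L.+-congˡ ss⁻¹≈1)))
      ev-1+X : EL.ev 1+X z L.≈ s L.* y
      ev-1+X = L.trans (EL.ev-add (+ 1 ∷ []) ℤ-poly.X z) (L.trans (L.+-cong (Hom.1-homo (EL.at z)) (EL.ev-X z)) 1+z)
      halve : ∀ k m → k ℕ.+ 2 ℕ.* m ≡ n → ⌊ (n ∸ k) /2⌋ ≡ m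
      halve k m ≡.refl = ≡.trans (≡.cong ⌊_/2⌋ (≡.trans (ℕ.m+n∸m≡n k (2 ℕ.* m)) (≡.cong (m ℕ.+_) (ℕ.+-identityʳ m)))) (≡.sym (ℕ.n≡⌊n+n/2⌋ m))
      term : ∀ k → c (toℕ k) ≡ +0 ⊎ ∃[ m ] toℕ k ℕ.+ 2 ℕ.* m ≡ n →
        L.ι (c (toℕ k)) L.* EL.ev (monomial k) z L.≈ s L.^ n L.* (L.ι (c (toℕ k)) L.* y L.^ toℕ k)
      term k (inj₁ c≡0) = L.trans (L.*-congʳ ι≈0) (L.trans (L.zeroˡ _) (L.sym (L.trans (L.*-congˡ (L.trans (L.*-congʳ ι≈0) (L.zeroˡ _))) (L.zeroʳ _))))
        where
        ι≈0 = L.reflexive (≡.cong L.ι c≡0)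
      term k (inj₂ (m , eq)) = begin
        L.ι (c j) L.* EL.ev (monomial k) z
          ≈⟨ L.*-congˡ (EL.ev-mul (ℤ-poly.X ^ₓ ⌊ (n ∸ j) /2⌋) (1+X ^ₓ j) z) ⟩
        L.ι (c j) L.* (EL.ev (ℤ-poly.X ^ₓ ⌊ (n ∸ j) /2⌋) z L.* EL.ev (1+X ^ₓ j) z)
          ≈⟨ L.*-congˡ (L.*-cong (L.trans (^-homo (EL.at z) ℤ-poly.X ⌊ (n ∸ j) /2⌋) (L.trans (L.^-congˡ ⌊ (n ∸ j) /2⌋ (EL.ev-X z)) (L.reflexive (≡.cong (z L.^_) (halve j m eq)))))
               (L.trans (^-homo (EL.at z) 1+X j) (L.trans (L.^-congˡ j ev-1+X) (L.^-distrib-* s y j)))) ⟩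
        L.ι (c j) L.* (z L.^ m L.* (s L.^ j L.* y L.^ j))
          ≈⟨ L.solve 4 (λ c z s y → c L.:* (z L.:* (s L.:* y)) L.:= (s L.:* z) L.:* (c L.:* y)) L.refl (L.ι (c j)) (z L.^ m) (s L.^ j) (y L.^ j) ⟩
        (s L.^ j L.* z L.^ m) L.* (L.ι (c j) L.* y L.^ j)
          ≈⟨ L.*-congʳ (L.trans (L.*-congˡ power) (L.trans (L.sym (L.^-homo-* s j (2 ℕ.* m))) (L.reflexive (≡.cong (s L.^_) eq)))) ⟩
        s L.^ n L.* (L.ι (c j) L.* y L.^ j) ∎
        where
        j = toℕ k
        power : z L.^ m L.≈ s L.^ (2 ℕ.* m)
        power = L.trans (L.^-congˡ m (L.sym (L.*-congˡ (L.*-identityʳ s)))) (L.^-assocʳ s 2 m)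

-- Rational numbers in the field and the values of ν.

module RationalValues {κ ℓ₁ ℓ₂} (ℝ : RealClosedField κ ℓ₁ ℓ₂) where
  open RealClosedField ℝ hiding (zero) renaming (commutativeRing to K)
  open OrderedField ℝ
  open Integers K
  open SetoidReasoning setoid

  infix 4 _▷_

  -- x is the image of q in the field. The relation is cross-multiplied because arithmetic on ℚ
  -- reduces its fractions.
  _▷_ : ℚ → Carrier → Set ℓ₁
  q ▷ x = ι (↥ q) ≈ x * ι (↧ q)

  0<ι↧ : ∀ q → 0< ι (↧ q)
  0<ι↧ (ℚ.mkℚ _ d _) = 0<ι d

  private
    cancelʳ : ∀ {a b c} → c ≉ 0# → a * c ≈ b * c → a ≈ b
    cancelʳ {a} {b} {c} c≉0 ac≈bc = x-y≈0⇒x≈y (*-cancel-0 c≉0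
      (trans (solve 3 (λ a b c → c :* (a :- b) := a :* c :- b :* c) refl a b c) (trans (+-congʳ ac≈bc) (-‿inverseʳ _))))

  /-▷ : ∀ i n .{{_ : ℕ.NonZero n}} {x} → ι i ≈ x * ι (+ n) → (i ℚ./ n) ▷ x
  /-▷ i n {x} eq = cancelʳ g≉0 (begin
    ι (↥ q) * ι g                ≈⟨ ι-* (↥ q) g ⟨
    ι (↥ q ℤ.* g)                ≡⟨ ≡.cong ι (ℚ.↥-/ i n) ⟩
    ι i                          ≈⟨ eq ⟩
    x * ι (+ n)                  ≡⟨ ≡.cong (λ j → x * ι j) (ℚ.↧-/ i n) ⟨
    x * ι (↧ q ℤ.* g)            ≈⟨ *-congˡ (ι-* (↧ q) g) ⟩
    x * (ι (↧ q) * ι g)          ≈⟨ *-assoc _ _ _ ⟨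
    x * ι (↧ q) * ι g            ∎)
    where
    q = i ℚ./ n
    g = ℤ.gcd i (+ n)
    g≉0 : ι g ≉ 0#
    g≉0 g≈0 = no-zero n (≡.trans (≡.sym (ℚ.↧-/ i n)) (≡.trans (≡.cong (↧ q ℤ.*_) (ι-injective₀ g g≈0)) (ℤ.*-zeroʳ (↧ q))))
      where
      no-zero : ∀ n .{{_ : ℕ.NonZero n}} → + n ≡ +0 → ⊥
      no-zero (suc n) ()

  private
    ι-↧* : ∀ p q → ι (+ (↧ₙ p ℕ.* ↧ₙ q)) ≈ ι (↧ p) * ι (↧ q)
    ι-↧* p q = trans (reflexive (≡.cong ι (ℤ.pos-* (↧ₙ p) (↧ₙ q)))) (ι-* (↧ p) (↧ q))

  +-▷ : ∀ {p q x y} → p ▷ x → q ▷ y → (p ℚ.+ q) ▷ x + y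
  +-▷ {p@record{}} {q@record{}} {x} {y} p▷x q▷y = /-▷ (↥ p ℤ.* ↧ q ℤ.+ ↥ q ℤ.* ↧ p) (↧ₙ p ℕ.* ↧ₙ q) (begin
    ι (↥ p ℤ.* ↧ q ℤ.+ ↥ q ℤ.* ↧ p)                ≈⟨ trans (ι-+ (↥ p ℤ.* ↧ q) (↥ q ℤ.* ↧ p)) (+-cong (ι-* (↥ p) (↧ q)) (ι-* (↥ q) (↧ p))) ⟩
    ι (↥ p) * ι (↧ q) + ι (↥ q) * ι (↧ p)          ≈⟨ +-cong (*-congʳ p▷x) (*-congʳ q▷y) ⟩
    x * ι (↧ p) * ι (↧ q) + y * ι (↧ q) * ι (↧ p)  ≈⟨ solve 4 (λ x y a b → x :* a :* b :+ y :* b :* a := (x :+ y) :* (a :* b)) refl x y (ι (↧ p)) (ι (↧ q)) ⟩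
    (x + y) * (ι (↧ p) * ι (↧ q))                  ≈⟨ *-congˡ (ι-↧* p q) ⟨
    (x + y) * ι (+ (↧ₙ p ℕ.* ↧ₙ q))                ∎)

  *-▷ : ∀ {p q x y} → p ▷ x → q ▷ y → (p ℚ.* q) ▷ x * y
  *-▷ {p@record{}} {q@record{}} {x} {y} p▷x q▷y = /-▷ (↥ p ℤ.* ↥ q) (↧ₙ p ℕ.* ↧ₙ q) (begin
    ι (↥ p ℤ.* ↥ q)                        ≈⟨ ι-* (↥ p) (↥ q) ⟩
    ι (↥ p) * ι (↥ q)                      ≈⟨ *-cong p▷x q▷y ⟩
    x * ι (↧ p) * (y * ι (↧ q))            ≈⟨ solve 4 (λ x y a b → x :* a :* (y :* b) := x :* y :* (a :* b)) refl x y (ι (↧ p)) (ι (↧ q)) ⟩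
    x * y * (ι (↧ p) * ι (↧ q))            ≈⟨ *-congˡ (ι-↧* p q) ⟨
    x * y * ι (+ (↧ₙ p ℕ.* ↧ₙ q))          ∎)

  neg-▷ : ∀ {q y} → q ▷ y → (ℚ.- q) ▷ - y
  neg-▷ {q} {y} q▷y = begin
    ι (↥ (ℚ.- q))             ≡⟨ ≡.cong ι (ℚ.↥-neg q) ⟩
    ι (ℤ.- ↥ q)               ≈⟨ trans (ι-neg (↥ q)) (-‿cong q▷y) ⟩
    - (y * ι (↧ q))           ≈⟨ solve 2 (λ y d → :- (y :* d) := :- y :* d) refl y (ι (↧ q)) ⟩
    - y * ι (↧ q)             ≡⟨ ≡.cong (λ d → - y * ι d) (ℚ.↧-neg q) ⟨
    - y * ι (↧ (ℚ.- q))       ∎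

  0▷ : 0ℚ ▷ 0#
  0▷ = sym (zeroˡ _)

  1▷ : 1ℚ ▷ 1#
  1▷ = sym (*-identityˡ _)

  2▷ : 2ℚ ▷ 1# + 1#
  2▷ = trans (solve 0 (con (+ 1) :+ (con (+ 1) :+ con +0) := (con (+ 1) :+ con (+ 1)) :* (con (+ 1) :+ con +0)) refl) refl

  private
    ι-mono-≤ : ∀ {i j} → i ℤ.≤ j → 0≤ ι j - ι i
    ι-mono-≤ {i} {j} i≤j = 0≤-resp (trans (ι-+ j (ℤ.- i)) (+-congˡ (ι-neg i))) (nonneg (j ℤ.- i) (ℤ.i≤j⇒0≤j-i i≤j))
      where
      nonneg : ∀ k → +0 ℤ.≤ k → 0≤ ι k
      nonneg +0       _ = inj₂ refl
      nonneg +[1+ n ] _ = inj₁ (0<ι n)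

    difference : ∀ {p q x y} → p ▷ x → q ▷ y → ι (↥ q ℤ.* ↧ p) - ι (↥ p ℤ.* ↧ q) ≈ ι (↧ p) * ι (↧ q) * (y - x)
    difference {p} {q} {x} {y} p▷x q▷y = begin
      ι (↥ q ℤ.* ↧ p) - ι (↥ p ℤ.* ↧ q)                  ≈⟨ +-cong (ι-* (↥ q) (↧ p)) (-‿cong (ι-* (↥ p) (↧ q))) ⟩
      ι (↥ q) * ι (↧ p) - ι (↥ p) * ι (↧ q)              ≈⟨ +-cong (*-congʳ q▷y) (-‿cong (*-congʳ p▷x)) ⟩
      y * ι (↧ q) * ι (↧ p) - x * ι (↧ p) * ι (↧ q)      ≈⟨ solve 4 (λ x y a b → y :* b :* a :- x :* a :* b := a :* b :* (y :- x)) refl x y (ι (↧ p)) (ι (↧ q)) ⟩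
      ι (↧ p) * ι (↧ q) * (y - x)                        ∎

  ≤-▷ : ∀ {p q x y} → p ▷ x → q ▷ y → p ℚ.≤ q → 0≤ y - x
  ≤-▷ {p} {q} p▷x q▷y (ℚ.*≤* p≤q) = 0≤-cancelˡ (*-pos (0<ι↧ p) (0<ι↧ q)) (0≤-resp (difference {p} {q} p▷x q▷y) (ι-mono-≤ p≤q))

  <-▷ : ∀ {p q x y} → p ▷ x → q ▷ y → p ℚ.< q → x < y
  <-▷ {p} {q} p▷x q▷y p<q@(ℚ.*<* ↥p<↥q) = 0<⇒< (strict (≤-▷ {p} {q} p▷x q▷y (ℚ.<⇒≤ p<q)))
    where
    strict : 0≤ _ → 0< _
    strict (inj₁ 0<y-x) = 0<y-x
    strict (inj₂ y-x≈0) = contradiction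
      (ι-injective₀ (↥ q ℤ.* ↧ p ℤ.- ↥ p ℤ.* ↧ q) (trans (ι-+ (↥ q ℤ.* ↧ p) (ℤ.- (↥ p ℤ.* ↧ q)))
        (trans (+-congˡ (ι-neg (↥ p ℤ.* ↧ q))) (trans (difference {p} {q} p▷x q▷y) (·0 y-x≈0)))))
      λ eq → ℤ.<⇒≢ ↥p<↥q (≡.sym (ℤ.i-j≡0⇒i≡j _ _ eq))

valueAtOne-regular : ∀ k p q {b} → Coefficients.eval ℤ.+-*-rawRing q (+ 1) ≡ +[1+ b ] →
  valueAtOne k p q ≡ [ Coefficients.eval ℤ.+-*-rawRing p (+ 1) ℚ./ suc b ]
valueAtOne-regular k p q eq with Coefficients.eval ℤ.+-*-rawRing p (+ 1) | Coefficients.eval ℤ.+-*-rawRing q (+ 1)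
valueAtOne-regular k p q ≡.refl | a | +[1+ b ] = ≡.refl

valueAtOne-pole : ∀ k p q → Coefficients.eval ℤ.+-*-rawRing q (+ 1) ≡ +0 → Coefficients.eval ℤ.+-*-rawRing p (+ 1) ≢ +0 →
  valueAtOne k p q ≡ ⊤⁺
valueAtOne-pole k p q eq ne with Coefficients.eval ℤ.+-*-rawRing p (+ 1) | Coefficients.eval ℤ.+-*-rawRing q (+ 1)
valueAtOne-pole zero    p q ≡.refl ne | +0       | +0 = contradiction ≡.refl ne
valueAtOne-pole zero    p q ≡.refl ne | +[1+ _ ] | +0 = ≡.refl
valueAtOne-pole zero    p q ≡.refl ne | -[1+ _ ] | +0 = ≡.refl
valueAtOne-pole (suc k) p q ≡.refl ne | +0       | +0 = contradiction ≡.refl ne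
valueAtOne-pole (suc k) p q ≡.refl ne | +[1+ _ ] | +0 = ≡.refl
valueAtOne-pole (suc k) p q ≡.refl ne | -[1+ _ ] | +0 = ≡.refl

≤⁺-or-<⁺ : ∀ (v : ℚ ⁺) q → v ≤⁺ [ q ] ⊎ [ q ] <⁺ v
≤⁺-or-<⁺ ⊤⁺    q = inj₂ [ q ]<⊤⁺
≤⁺-or-<⁺ [ p ] q with p ℚ.≤? q
... | yes p≤q = inj₁ [ p≤q ]
... | no  p≰q = inj₂ [ ℚ.≰⇒> p≰q ]

module NuValues {κ ℓ₁ ℓ₂} (ℝ : RealClosedField κ ℓ₁ ℓ₂) where
  open RealClosedField ℝ hiding (zero) renaming (commutativeRing to K)
  open OrderedField ℝ
  open Monotonicity ℝ
  open RationalValues ℝ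
  open CharacteristicPolynomial ℝ
  open Integers K
  open CharacteristicLaws K
  private
    module E = Evaluation (fromIntegers K)
    module ℤ-poly = Coefficients ℤ.+-*-rawRing
    module ℤX = RawRing ℤ[X]

  two : Carrier
  two = 1# + 1#

  private
    -- The point 1 is written as 1 · 1 because `R-value` evaluates at a square s · s; here s = 1 and
    -- s + s⁻¹ = 2.
    ι-eval : ∀ p → ι (ℤ-poly.eval p (+ 1)) ≈ E.ev p (1# * 1#)
    ι-eval p = trans (E.ev-eval p (+ 1)) (E.ev-cong₂ p (trans ι-1 (sym (*-identityˡ 1#))))

    R-at-one : ∀ {T t} → Represents T t → ι (ℤ-poly.eval (R (RootedGraph.graph T)) (+ 1)) ≈ P t two
    R-at-one {T} {t} ρ = trans (ι-eval (R (RootedGraph.graph T))) (trans (R-value K ρ (*-identityˡ 1#))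
      (trans (*-congʳ (one (order T))) (*-identityˡ _)))
      where
      one : ∀ n → RawSemiringDefs._^_ (RawRing.rawSemiring rawRing) 1# n ≈ 1#
      one zero    = refl
      one (suc n) = trans (*-identityˡ _) (one n)

    numerator-at-one : ∀ {Ts ss} → Pointwise Decomposed Ts ss →
      E.ev (foldr ℤX._*_ ℤX.1# (map (R ∘ RootedGraph.graph) Ts)) (1# * 1#) ≈ F (attach ss) two
    numerator-at-one []       = Hom.1-homo (E.at (1# * 1#))
    numerator-at-one (_∷_ {x = T} {xs = Ts} d ds) = trans (E.ev-mul (R (RootedGraph.graph T)) (foldr ℤX._*_ ℤX.1# (map (R ∘ RootedGraph.graph) Ts)) (1# * 1#))
      (trans (*-cong (trans (sym (ι-eval (R (RootedGraph.graph T)))) (R-at-one (represents d))) (numerator-at-one ds)) (*-comm _ _))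

  Ratio : ℚ ⁺ → Carrier → Carrier → Set _
  Ratio v f p = (0< p × ∃[ q ] v ≡ [ q ] × ∃[ y ] q ▷ y × f ≈ y * p) ⊎ (p ≈ 0# × v ≡ ⊤⁺)

  -- At z = 1 the numerator of the quotient is F(2) and its denominator P(2), so ν is the reciprocal
  -- of the root pivot at 2. Boundedness gives F(2) > 0, so no common factor z - 1 has to be
  -- cancelled.
  ν-value : ∀ {T t} → Decomposed T t → Bounded t two → Ratio (ν T) (F t two) (P t two)
  ν-value {T} {t} (decomposed ss ρ ds) (pt , 0≤P) = by-value (ℤ-poly.eval q (+ 1)) ≡.refl
    where
    p = foldr ℤX._*_ ℤX.1# (map (R ∘ RootedGraph.graph) (T ′))
    q = R (RootedGraph.graph T)
    p-value : ι (ℤ-poly.eval p (+ 1)) ≈ F (attach ss) two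
    p-value = trans (ι-eval p) (numerator-at-one ds)
    by-value : ∀ i → ℤ-poly.eval q (+ 1) ≡ i → Ratio (ν T) (F (attach ss) two) (P (attach ss) two)
    by-value +0 eq = inj₂ (trans (sym (R-at-one ρ)) (reflexive (≡.cong ι eq)) , valueAtOne-pole (order T) p q eq λ p≡0 →
      0<⇒≉0 (F-pos (attach ss) pt) (trans (sym p-value) (reflexive (≡.cong ι p≡0))))
    by-value -[1+ n ] eq = contradiction (0<-resp (trans (solve 1 (λ a → a := :- :- a) refl _) (-‿cong (trans (reflexive (≡.cong ι (≡.sym eq))) (R-at-one ρ)))) (0<ι n)) (0≤⇒¬0<- 0≤P)
    by-value +[1+ n ] eq = inj₁ (0<-resp P-eq (0<ι n) , ℤ-poly.eval p (+ 1) ℚ./ suc n , valueAtOne-regular (order T) p q eq ,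
        y , /-▷ (ℤ-poly.eval p (+ 1)) (suc n) (trans p-value (trans f≈yp (*-congˡ (sym P-eq)))) , f≈yp)
      where
      P-eq : ι +[1+ n ] ≈ P (attach ss) two
      P-eq = trans (reflexive (≡.cong ι (≡.sym eq))) (R-at-one ρ)
      r = inverse (0<⇒≉0 (0<-resp P-eq (0<ι n)))
      y = F (attach ss) two * proj₁ r
      f≈yp : F (attach ss) two ≈ y * P (attach ss) two
      f≈yp = sym (trans (*-assoc _ _ _) (trans (*-congˡ (trans (*-comm _ _) (proj₂ r))) (*-identityʳ _)))

  -- Attaching s subtracts F s / P s = ν(s) from the root pivot, which is 2 for a single vertex. The
  -- pivot becomes 2 - ν unless a branch has P = 0, which is the case F = 0, ν = ∞.
  ν-sum : ∀ {Ts ss} → Pointwise Decomposed Ts ss → Branches-bounded (attach ss) two →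
    (0< F (attach ss) two × ∃[ q ] νᶠ Ts ≡ [ q ] × ∃[ y ] q ▷ y × P (attach ss) two ≈ (two - y) * F (attach ss) two)
    ⊎ (F (attach ss) two ≈ 0# × νᶠ Ts ≡ ⊤⁺)
  ν-sum [] _ = inj₁ (0<1 , 0ℚ , ≡.refl , 0# , 0▷ , solve 0 (con (+ 2) := (con (+ 2) :- con +0) :* con (+ 1)) refl)
  ν-sum (_∷_ {y = s} {ys = ss} d ds) (bt , bs) with ν-value d bs | ν-sum ds bt
  ... | inj₂ (Ps≈0 , ν≡⊤) | _ = inj₂ (·0 Ps≈0 , ≡.cong (_+⁺ _) ν≡⊤)
  ... | inj₁ (_ , q , ν≡q , _) | inj₂ (Ft≈0 , νᶠ≡⊤) = inj₂ (0· Ft≈0 , ≡.cong₂ _+⁺_ ν≡q νᶠ≡⊤)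
  ... | inj₁ (0<Ps , q , ν≡q , y , q▷y , Fs≈) | inj₁ (0<Ft , q′ , νᶠ≡q′ , y′ , q′▷y′ , Pt≈) =
    inj₁ (*-pos 0<Ft 0<Ps , q ℚ.+ q′ , ≡.cong₂ _+⁺_ ν≡q νᶠ≡q′ , y + y′ , +-▷ {q} {q′} q▷y q′▷y′ ,
      trans (+-cong (*-congʳ Pt≈) (-‿cong (*-congˡ Fs≈)))
        (solve 5 (λ c y y′ ft ps → (c :- y′) :* ft :* ps :- ft :* (y :* ps) := (c :- (y :+ y′)) :* (ft :* ps)) refl
          two y y′ (F (attach ss) two) (P s two)))

  ν-cases : ∀ {T t} → Decomposed T t → Branches-bounded t two →
    (0< F t two × ∃[ q ] νᶠ (T ′) ≡ [ q ] × ∃[ y ] q ▷ y × P t two ≈ (two - y) * F t two) ⊎ (F t two ≈ 0# × νᶠ (T ′) ≡ ⊤⁺)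
  ν-cases (decomposed ss ρ ds) bt = ν-sum ds bt

  module _ {T t} (d : Decomposed T t) (bt : Branches-bounded t two) where

    private
      positive : 0< F t two → Positive t two
      positive 0<F = Branches-bounded∧F≉0⇒Positive t bt (0<⇒≉0 0<F)

    2<ν⇒exceeds : [ 2ℚ ] <⁺ νᶠ (T ′) → Exceeds t two
    2<ν⇒exceeds 2<ν = Sum.[ (λ b → ⊥-elim (absurd b (ν-cases d bt))) , id ]′ (bounded-or-exceeds t two)
      where
      absurd : Bounded t two → _ → ⊥
      absurd (pt , _)   (inj₂ (F≈0 , _)) = 0<⇒≉0 (F-pos t pt) F≈0
      absurd (pt , 0≤P) (inj₁ (0<F , q , ν≡q , y , q▷y , P≈)) = 0≤⇒¬0<- (0≤-cancelˡ 0<F (0≤-resp (trans P≈ (*-comm _ _)) 0≤P))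
        (0<-resp (solve 2 (λ c y → y :- c := :- (c :- y)) refl two y) (<⇒0< (<-▷ {2ℚ} {q} 2▷ q▷y ([<]-injective (≡.subst ([ 2ℚ ] <⁺_) ν≡q 2<ν)))))

    ν≤2⇒bounded : νᶠ (T ′) ≤⁺ [ 2ℚ ] → Bounded t two
    ν≤2⇒bounded ν≤2 = by-cases (ν-cases d bt)
      where
      by-cases : _ → Bounded t two
      by-cases (inj₂ (_ , ν≡⊤)) = contradiction (≡.subst (_≤⁺ [ 2ℚ ]) ν≡⊤ ν≤2) λ ()
      by-cases (inj₁ (0<F , q , ν≡q , y , q▷y , P≈)) = positive 0<F , 0≤-resp (sym P≈)
        (*-nonneg (≤-▷ {q} {2ℚ} q▷y 2▷ ([≤]-injective (≡.subst (_≤⁺ [ 2ℚ ]) ν≡q ν≤2))) (inj₁ 0<F))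

    exceeds⇒2<ν : Exceeds t two → [ 2ℚ ] <⁺ νᶠ (T ′)
    exceeds⇒2<ν (y , 2<y , _ , Py≈0) = Sum.[ (λ ν≤2 → let pt , 0≤P = ν≤2⇒bounded ν≤2 in
      contradiction Py≈0 (0<⇒≉0 (P-rises t pt 2<y 0≤P))) , id ]′ (≤⁺-or-<⁺ (νᶠ (T ′)) 2ℚ)

  module _ {T₁ t T₂ s} (d : Decomposed T₁ t) (bt : Branches-bounded t two) (d′ : Decomposed T₂ s) (bs : Branches-bounded s two) where

    private
      product : ∀ {y y′} → P t two ≈ (two - y) * F t two → P s two ≈ (two - y′) * F s two →
        P (t ⊕ s) two ≈ ((y - two) * (y′ - two) - 1#) * (F t two * F s two)
      product {y} {y′} Pt≈ Ps≈ = trans (+-congʳ (*-cong Pt≈ Ps≈))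
        (solve 5 (λ c y y′ f g → (c :- y) :* f :* ((c :- y′) :* g) :- f :* g := ((y :- c) :* (y′ :- c) :- con (+ 1)) :* (f :* g)) refl two y y′ (F t two) (F s two))

      excess-▷ : ∀ {q q′ y y′} → q ▷ y → q′ ▷ y′ → ((q ℚ.- 2ℚ) ℚ.* (q′ ℚ.- 2ℚ)) ▷ (y - two) * (y′ - two)
      excess-▷ {q} {q′} q▷y q′▷y′ = *-▷ {q ℚ.- 2ℚ} {q′ ℚ.- 2ℚ} (+-▷ {q} {ℚ.- 2ℚ} q▷y (neg-▷ {2ℚ} 2▷)) (+-▷ {q′} {ℚ.- 2ℚ} q′▷y′ (neg-▷ {2ℚ} 2▷))

      excess≡ : ∀ {v w} → νᶠ (T₁ ′) ≡ v → νᶠ (T₂ ′) ≡ w → excess T₁ T₂ ≡ (v -⁺ 2ℚ) *⁺ (w -⁺ 2ℚ)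
      excess≡ ≡.refl ≡.refl = ≡.refl

    -- A product bounded by 1 is finite, so neither `F` vanishes at 2 and the pivots are defined at
    -- 2 itself, where `both-negative-falls` will start. `P` of the join is there ((ν₁ - 2)(ν₂ - 2)
    -- - 1) F F.
    excess≤1 : excess T₁ T₂ ≤⁺ [ 1ℚ ] → Positive t two × Positive s two × 0≤ - P (t ⊕ s) two
    excess≤1 e≤1 = by-cases (ν-cases d bt) (ν-cases d′ bs)
      where
      by-cases : _ → _ → Positive t two × Positive s two × 0≤ - P (t ⊕ s) two
      by-cases (inj₁ (0<F , q , ν≡q , y , q▷y , P≈)) (inj₁ (0<F′ , q′ , ν≡q′ , y′ , q′▷y′ , P≈′)) =
        Branches-bounded∧F≉0⇒Positive t bt (0<⇒≉0 0<F) , Branches-bounded∧F≉0⇒Positive s bs (0<⇒≉0 0<F′) ,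
        0≤-resp (trans (solve 2 (λ e f → (con (+ 1) :- e) :* f := :- ((e :- con (+ 1)) :* f)) refl ((y - two) * (y′ - two)) (F t two * F s two)) (-‿cong (sym (product P≈ P≈′))))
          (*-nonneg (≤-▷ {(q ℚ.- 2ℚ) ℚ.* (q′ ℚ.- 2ℚ)} {1ℚ} (excess-▷ {q} {q′} q▷y q′▷y′) 1▷
            ([≤]-injective (≡.subst (_≤⁺ [ 1ℚ ]) (excess≡ ν≡q ν≡q′) e≤1))) (inj₁ (*-pos 0<F 0<F′)))
      by-cases (inj₂ (_ , ν≡⊤)) _ = contradiction (≡.subst (_≤⁺ [ 1ℚ ]) (excess≡ ν≡⊤ ≡.refl) e≤1) λ ()
      by-cases (inj₁ (_ , _ , ν≡q , _)) (inj₂ (_ , ν≡⊤)) = contradiction (≡.subst (_≤⁺ [ 1ℚ ]) (excess≡ ν≡q ν≡⊤) e≤1) λ ()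

    1<excess : [ 1ℚ ] <⁺ excess T₁ T₂ → F t two ≈ 0# ⊎ F s two ≈ 0# ⊎ 0< P (t ⊕ s) two
    1<excess 1<e = by-cases (ν-cases d bt) (ν-cases d′ bs)
      where
      by-cases : _ → _ → F t two ≈ 0# ⊎ F s two ≈ 0# ⊎ 0< P (t ⊕ s) two
      by-cases (inj₂ (F≈0 , _)) _ = inj₁ F≈0
      by-cases (inj₁ _) (inj₂ (F≈0 , _)) = inj₂ (inj₁ F≈0)
      by-cases (inj₁ (0<F , q , ν≡q , y , q▷y , P≈)) (inj₁ (0<F′ , q′ , ν≡q′ , y′ , q′▷y′ , P≈′)) = inj₂ (inj₂ (0<-resp (sym (product P≈ P≈′))
        (*-pos (<⇒0< (<-▷ {1ℚ} {(q ℚ.- 2ℚ) ℚ.* (q′ ℚ.- 2ℚ)} 1▷ (excess-▷ {q} {q′} q▷y q′▷y′) ([<]-injective (≡.subst ([ 1ℚ ] <⁺_) (excess≡ ν≡q ν≡q′) 1<e)))) (*-pos 0<F 0<F′))))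

-- Complex numbers and the upper half plane.

module ComplexNumbers {κ ℓ₁ ℓ₂} (ℝ : RealClosedField κ ℓ₁ ℓ₂) where
  open RealClosedField ℝ hiding (zero) renaming (commutativeRing to K)
  open OrderedField ℝ
  open Integers K
  open Spectra ℝ using (ℂ; fromℤ)
  open CharacteristicLaws K
  open SetoidReasoning setoid

  ℂ-ring : CommutativeRing κ ℓ₁
  ℂ-ring = record
    { RawRing ℂ
    ; isCommutativeRing = record
      { isRing = record
        { +-isAbelianGroup = AbelianGroup.isAbelianGroup (DirectProduct.abelianGroup +-abelianGroup +-abelianGroup)
        ; *-cong = λ (a , b) (a′ , b′) → +-cong (*-cong a a′) (-‿cong (*-cong b b′)) , +-cong (*-cong a b′) (*-cong b a′)
        ; *-assoc = λ (a , b) (a′ , b′) (a″ , b″) →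
            solve 6 (λ a b a′ b′ a″ b″ → (a :* a′ :- b :* b′) :* a″ :- (a :* b′ :+ b :* a′) :* b″ := a :* (a′ :* a″ :- b′ :* b″) :- b :* (a′ :* b″ :+ b′ :* a″)) refl a b a′ b′ a″ b″ ,
            solve 6 (λ a b a′ b′ a″ b″ → (a :* a′ :- b :* b′) :* b″ :+ (a :* b′ :+ b :* a′) :* a″ := a :* (a′ :* b″ :+ b′ :* a″) :+ b :* (a′ :* a″ :- b′ :* b″)) refl a b a′ b′ a″ b″
        ; *-identity =
            (λ (a , b) → solve 2 (λ a b → con (+ 1) :* a :- con +0 :* b := a) refl a b , solve 2 (λ a b → con (+ 1) :* b :+ con +0 :* a := b) refl a b) ,
            (λ (a , b) → solve 2 (λ a b → a :* con (+ 1) :- b :* con +0 := a) refl a b , solve 2 (λ a b → a :* con +0 :+ b :* con (+ 1) := b) refl a b)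
        ; distrib =
            (λ (a , b) (a′ , b′) (a″ , b″) →
              solve 6 (λ a b a′ b′ a″ b″ → a :* (a′ :+ a″) :- b :* (b′ :+ b″) := a :* a′ :- b :* b′ :+ (a :* a″ :- b :* b″)) refl a b a′ b′ a″ b″ ,
              solve 6 (λ a b a′ b′ a″ b″ → a :* (b′ :+ b″) :+ b :* (a′ :+ a″) := a :* b′ :+ b :* a′ :+ (a :* b″ :+ b :* a″)) refl a b a′ b′ a″ b″) ,
            (λ (a , b) (a′ , b′) (a″ , b″) →
              solve 6 (λ a b a′ b′ a″ b″ → (a′ :+ a″) :* a :- (b′ :+ b″) :* b := a′ :* a :- b′ :* b :+ (a″ :* a :- b″ :* b)) refl a b a′ b′ a″ b″ ,
              solve 6 (λ a b a′ b′ a″ b″ → (a′ :+ a″) :* b :+ (b′ :+ b″) :* a := a′ :* b :+ b′ :* a :+ (a″ :* b :+ b″ :* a)) refl a b a′ b′ a″ b″)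
        }
      ; *-comm = λ (a , b) (a′ , b′) →
          solve 4 (λ a b a′ b′ → a :* a′ :- b :* b′ := a′ :* a :- b′ :* b) refl a b a′ b′ ,
          solve 4 (λ a b a′ b′ → a :* b′ :+ b :* a′ := a′ :* b :+ b′ :* a) refl a b a′ b′
      }
    }

  module ℂ = CommutativeRing ℂ-ring
  module ℂP = CharacteristicLaws ℂ-ring

  real : Hom rawRing ℂ-ring
  real = record
    { ⟦_⟧    = λ a → a , 0#
    ; cong   = λ a≈b → a≈b , refl
    ; +-homo = λ a b → refl , sym (+-identityˡ 0#)
    ; *-homo = λ a b → solve 2 (λ a b → a :* b := a :* b :- con +0 :* con +0) refl a b , solve 2 (λ a b → con +0 := a :* con +0 :+ con +0 :* b) refl a b
    ; -‿homo = λ a → refl , solve 0 (con +0 := :- con +0) refl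
    ; 0-homo = refl , refl
    ; 1-homo = refl , refl
    }

  norm : ℂ.Carrier → Carrier
  norm (a , b) = a * a + b * b

  norm-pos : ∀ {z} → ¬ z ℂ.≈ ℂ.0# → 0< norm z
  norm-pos {a , b} z≉0 with ≉0-or-≈0 a | ≉0-or-≈0 b
  ... | inj₁ a≉0 | _        = +-pos-nonneg (square-pos a≉0) (square-nonneg b)
  ... | inj₂ _   | inj₁ b≉0 = +-nonneg-pos (square-nonneg a) (square-pos b≉0)
  ... | inj₂ a≈0 | inj₂ b≈0 = contradiction (a≈0 , b≈0) z≉0

  norm-* : ∀ z w → norm (z ℂ.* w) ≈ norm z * norm w
  norm-* (a , b) (a′ , b′) = solve 4 (λ a b a′ b′ → (a :* a′ :- b :* b′) :* (a :* a′ :- b :* b′) :+ (a :* b′ :+ b :* a′) :* (a :* b′ :+ b :* a′)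
    := (a :* a :+ b :* b) :* (a′ :* a′ :+ b′ :* b′)) refl a b a′ b′

  norm-zero : ∀ {z} → z ℂ.≈ ℂ.0# → norm z ≈ 0#
  norm-zero (a≈0 , b≈0) = trans (+-cong (0· a≈0) (0· b≈0)) (+-identityˡ 0#)

  ℂ-*-≉0 : ∀ {z w} → ¬ z ℂ.≈ ℂ.0# → ¬ w ℂ.≈ ℂ.0# → ¬ z ℂ.* w ℂ.≈ ℂ.0#
  ℂ-*-≉0 {z} {w} z≉0 w≉0 zw≈0 = 0<⇒≉0 (*-pos (norm-pos z≉0) (norm-pos w≉0)) (trans (sym (norm-* z w)) (norm-zero zw≈0))

  -- Im (P · conj F), which has the sign of Im (P / F): the pivots x − Σ 1 / a map the upper half plane to itself.

  herglotz : Tree → ℂ.Carrier → Carrier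
  herglotz t x = let p₁ , p₂ = ℂP.P t x ; f₁ , f₂ = ℂP.F t x in p₂ * f₁ - p₁ * f₂

  herglotz⇒P≉0 : ∀ t {x} → 0< herglotz t x → ¬ ℂP.P t x ℂ.≈ ℂ.0#
  herglotz⇒P≉0 t 0<h (p₁≈0 , p₂≈0) = 0<⇒≉0 0<h (trans (+-cong (0· p₂≈0) (-‿cong (0· p₁≈0))) (-‿inverseʳ 0#))

  herglotz⇒F≉0 : ∀ t {x} → 0< herglotz t x → ¬ ℂP.F t x ℂ.≈ ℂ.0#
  herglotz⇒F≉0 t 0<h (f₁≈0 , f₂≈0) = 0<⇒≉0 0<h (trans (+-cong (·0 f₁≈0) (-‿cong (·0 f₂≈0))) (-‿inverseʳ 0#))

  -- The complex counterpart of the recursion for `W`: the value at t ⊕ s is |P s|² times that at t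
  -- plus |F t|² times that at s. Positivity at the parts also shows that the two factors are
  -- nonzero.
  herglotz-pos : ∀ t {x₁ x₂} → 0< x₂ → 0< herglotz t (x₁ , x₂)
  herglotz-pos •       {x₁} {x₂} 0<x₂ = 0<-resp (solve 2 (λ x₁ x₂ → x₂ := x₂ :* con (+ 1) :- x₁ :* con +0) refl x₁ x₂) 0<x₂
  herglotz-pos (t ⊕ s) {x₁} {x₂} 0<x₂ = 0<-resp
    (solve 8 (λ p₁ p₂ f₁ f₂ q₁ q₂ g₁ g₂ →
        (q₁ :* q₁ :+ q₂ :* q₂) :* (p₂ :* f₁ :- p₁ :* f₂) :+ (f₁ :* f₁ :+ f₂ :* f₂) :* (q₂ :* g₁ :- q₁ :* g₂)
        := (p₁ :* q₂ :+ p₂ :* q₁ :+ :- (f₁ :* g₂ :+ f₂ :* g₁)) :* (f₁ :* q₁ :- f₂ :* q₂) :- (p₁ :* q₁ :- p₂ :* q₂ :+ :- (f₁ :* g₁ :- f₂ :* g₂)) :* (f₁ :* q₂ :+ f₂ :* q₁)) refl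
      (proj₁ (ℂP.P t x)) (proj₂ (ℂP.P t x)) (proj₁ (ℂP.F t x)) (proj₂ (ℂP.F t x))
      (proj₁ (ℂP.P s x)) (proj₂ (ℂP.P s x)) (proj₁ (ℂP.F s x)) (proj₂ (ℂP.F s x)))
    (+-pos (*-pos (norm-pos (herglotz⇒P≉0 s (herglotz-pos s 0<x₂))) (herglotz-pos t 0<x₂))
           (*-pos (norm-pos (herglotz⇒F≉0 t (herglotz-pos t 0<x₂))) (herglotz-pos s 0<x₂)))
    where
    x = x₁ , x₂

  sqrt : ∀ {c} → 0< c → ∃[ r ] 0< r × r * r ≈ c
  sqrt {c} 0<c =
    -- The right end is c + 1 since c² need not exceed c.
    let r , 0<r , _ , eq = root-between (poly-- (poly-* poly-id poly-id) (poly-const c)) (+-pos 0<c 0<1)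
          (0<-resp (solve 1 (λ c → c := :- (con +0 :* con +0 :- c)) refl c) 0<c)
          (0<-resp (solve 1 (λ c → c :* c :+ c :+ con (+ 1) := (c :+ con (+ 1)) :* (c :+ con (+ 1)) :- c) refl c) (+-pos (+-pos (*-pos 0<c 0<c) 0<c) 0<1))
    in r , 0<r , x-y≈0⇒x≈y eq

  square-<⇒< : ∀ {a b} → 0< b → a * a < b * b → a < b
  square-<⇒< {a} {b} 0<b aa<bb with compare a b
  ... | tri< a<b _ _ = a<b
  ... | tri≈ _ a≈b _ = contradiction aa<bb (<-irrefl (*-cong a≈b a≈b))
  ... | tri> _ _ b<a = contradiction aa<bb (<-asym (0<⇒< (0<-resp (solve 2 (λ a b → (a :- b) :* (a :- b) :+ (con (+ 1) :+ con (+ 1)) :* (b :* (a :- b)) := a :* a :- b :* b) refl a b)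
        (+-pos (*-pos (<⇒0< b<a) (<⇒0< b<a)) (*-pos 0<2 (*-pos 0<b (<⇒0< b<a)))))))

  -- The half-angle formulas d² = (|z| - u) / 2 and c = v / 2d for z = u + i v. As z is not a
  -- positive real, |z| > u and d can be taken positive. `norm` is the square of the absolute value.
  upper-sqrt : ∀ u v → 1# < norm (u , v) → ¬ (0< u × v ≈ 0#) → ∃[ c ] ∃[ d ] 0< d × ((c , d) ℂ.* (c , d)) ℂ.≈ (u , v)
  upper-sqrt u v 1<n not-positive =
    let m , 0<m , mm≈n = sqrt (<-trans 0<1 1<n)
        d , 0<d , dd≈ = sqrt {(m - u) * half} (*-pos (0<m-u 0<m mm≈n) (0<inverse 0<2 2*half))
        t , 2dt≈1 = inverse (0<⇒≉0 (*-pos 0<2 0<d))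
        c = v * t
        2cd≈v : c * d + d * c ≈ v
        2cd≈v = trans (solve 3 (λ v t d → v :* t :* d :+ d :* (v :* t) := v :* ((con (+ 1) :+ con (+ 1)) :* d :* t)) refl v t d) (trans (*-congˡ 2dt≈1) (*-identityʳ v))
        2dd≈m-u : (1# + 1#) * (d * d) ≈ m - u
        2dd≈m-u = trans (*-congˡ dd≈) (trans (solve 2 (λ k h → (con (+ 1) :+ con (+ 1)) :* (k :* h) := k :* ((con (+ 1) :+ con (+ 1)) :* h)) refl (m - u) half) (trans (*-congˡ 2*half) (*-identityʳ _)))
    in c , d , 0<d , real-part m c d 0<d mm≈n 2cd≈v 2dd≈m-u , 2cd≈v
    where
    0<m-u : ∀ {m} → 0< m → m * m ≈ norm (u , v) → 0< m - u
    0<m-u {m} 0<m mm≈n with ≉0-or-≈0 v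
    ... | inj₁ v≉0 = <⇒0< (square-<⇒< 0<m (0<⇒< (0<-resp (trans (solve 2 (λ u v → v :* v := u :* u :+ v :* v :- u :* u) refl u v) (+-congʳ (sym mm≈n))) (square-pos v≉0))))
    ... | inj₂ v≈0 with sign u
    ...   | pos 0<u  = contradiction (0<u , v≈0) not-positive
    ...   | nul u≈0  = 0<-resp (trans (solve 1 (λ m → m := m :- con +0) refl m) (+-congˡ (-‿cong (sym u≈0)))) 0<m
    ...   | neg 0<-u = +-pos 0<m 0<-u
    real-part : ∀ m c d → 0< d → m * m ≈ norm (u , v) → c * d + d * c ≈ v → (1# + 1#) * (d * d) ≈ m - u → c * c - d * d ≈ u
    real-part m c d 0<d mm≈n 2cd≈v 2dd≈ = x-y≈0⇒x≈y (*-cancel-0 (0<⇒≉0 (*-pos 0<2 (*-pos 0<2 (*-pos 0<d 0<d)))) (begin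
      two * (two * (d * d)) * (c * c - d * d - u)
        ≈⟨ solve 3 (λ c d u → let 2# = con (+ 1) :+ con (+ 1) in 2# :* (2# :* (d :* d)) :* (c :* c :- d :* d :- u)
             := (c :* d :+ d :* c) :* (c :* d :+ d :* c) :- 2# :* (d :* d) :* (2# :* (d :* d)) :- 2# :* (2# :* (d :* d)) :* u) refl c d u ⟩
      (c * d + d * c) * (c * d + d * c) - two * (d * d) * (two * (d * d)) - two * (two * (d * d)) * u
        ≈⟨ +-cong (+-cong (*-cong 2cd≈v 2cd≈v) (-‿cong (*-cong 2dd≈ 2dd≈))) (-‿cong (*-congʳ (*-congˡ 2dd≈))) ⟩
      v * v - (m - u) * (m - u) - two * (m - u) * u
        ≈⟨ solve 3 (λ u v m → v :* v :- (m :- u) :* (m :- u) :- (con (+ 1) :+ con (+ 1)) :* (m :- u) :* u := u :* u :+ v :* v :- m :* m) refl u v m ⟩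
      norm (u , v) - m * m
        ≈⟨ +-congˡ (-‿cong mm≈n) ⟩
      norm (u , v) - norm (u , v)
        ≈⟨ -‿inverseʳ _ ⟩
      0# ∎))
      where
      two = 1# + 1#

  ι-real : ∀ i → Integers.ι ℂ-ring i ℂ.≈ (ι i , 0#)
  ι-real (+ n)    = multiple n
    where
    multiple : ∀ n → Integers.ι ℂ-ring (+ n) ℂ.≈ (ι (+ n) , 0#)
    multiple zero    = refl , refl
    multiple (suc n) = +-congˡ (proj₁ (multiple n)) , trans (+-identityˡ _) (proj₂ (multiple n))
  ι-real -[1+ n ] = -‿cong (proj₁ (ι-real (+ suc n))) , trans (-‿cong (proj₂ (ι-real (+ suc n)))) -0#≈0#

  fromℤ-real : ∀ i → fromℤ i ℂ.≈ (ι i , 0#)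
  fromℤ-real (+ n)    = refl , refl
  fromℤ-real -[1+ n ] = refl , refl

-- Roots of the reciprocal polynomial outside the unit circle.

module ReciprocalRoots {κ ℓ₁ ℓ₂} (ℝ : RealClosedField κ ℓ₁ ℓ₂) where
  open RealClosedField ℝ hiding (zero) renaming (commutativeRing to K)
  open OrderedField ℝ
  open Monotonicity ℝ
  open JoinedTrees ℝ
  open DualNumbers K
  open DualLaws ℝ
  open CharacteristicPolynomial ℝ
  open ComplexNumbers ℝ
  open Integers K
  open CharacteristicLaws K
  open Spectra ℝ using (ℂ; fromℤ; X-_; OutsideUnitCircle; TwoRootsOutsideUnitCircle)
  open Coefficients rawRing using (add; mul; scale)
  open RawSemiringDefs (RawRing.rawSemiring rawRing) using (_^_)
  open SetoidReasoning setoid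
  private
    module E = Evaluation (fromIntegers K)
    module dual = CommutativeRing dual
    module dualPower = RawSemiringDefs (RawRing.rawSemiring dual.rawRing)
    module ℂPower = RawSemiringDefs (RawRing.rawSemiring ℂ.rawRing)
    module ℂE = Evaluation real

  coeff-add-neg : ∀ p q k → coeff (add p (map -_ q)) k ≈ coeff p k - coeff q k
  coeff-add-neg []      []      k       = sym (-‿inverseʳ 0#)
  coeff-add-neg []      (b ∷ q) zero    = sym (+-identityˡ _)
  coeff-add-neg []      (b ∷ q) (suc k) = coeff-add-neg [] q k
  coeff-add-neg (a ∷ p) []      k       = sym (trans (+-congˡ -0#≈0#) (+-identityʳ _))
  coeff-add-neg (a ∷ p) (b ∷ q) zero    = refl
  coeff-add-neg (a ∷ p) (b ∷ q) (suc k) = coeff-add-neg p q k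

  equal-values⇒equal-coefficients : ∀ p q → (∀ x → ev p x ≈ ev q x) → ∀ k → coeff p k ≈ coeff q k
  equal-values⇒equal-coefficients p q p≈q k = x-y≈0⇒x≈y (trans (sym (coeff-add-neg p q k))
    (vanishes⇒0 _ (add p (map -_ q)) ℕ.≤-refl 0# (λ x _ → trans (ev-add p (map -_ q) x)
      (trans (+-congˡ (ev-neg q x)) (trans (+-congʳ (p≈q x)) (-‿inverseʳ _)))) k))

  ev-integers : ∀ {κ′ ℓ′} {L : CommutativeRing κ′ ℓ′} (φ : Hom rawRing L) →
    (∀ i → CommutativeRing._≈_ L (Integers.ι L i) (Hom.⟦_⟧ φ (ι i))) →
    ∀ p x → CommutativeRing._≈_ L (Evaluation.ev (fromIntegers L) p x) (Evaluation.ev φ (map ι p) x)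
  ev-integers {L = L} φ φι []      x = CommutativeRing.refl L
  ev-integers {L = L} φ φι (a ∷ p) x = CommutativeRing.+-cong L (φι a) (CommutativeRing.*-congˡ L (ev-integers φ φι p x))

  ι-constant : ∀ i → Integers.ι dual i dual.≈ (ι i , 0#)
  ι-constant (+ n)    = multiple n
    where
    multiple : ∀ n → Integers.ι dual (+ n) dual.≈ (ι (+ n) , 0#)
    multiple zero    = refl , refl
    multiple (suc n) = +-congˡ (proj₁ (multiple n)) , trans (+-identityˡ _) (proj₂ (multiple n))
  ι-constant -[1+ n ] = -‿cong (proj₁ (ι-constant (+ suc n))) , trans (-‿cong (proj₂ (ι-constant (+ suc n)))) -0#≈0#

  power-≉0 : ∀ {x} n → x ≉ 0# → x ^ n ≉ 0#
  power-≉0 zero    x≉0 = 0<⇒≉0 0<1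
  power-≉0 (suc n) x≉0 = *-≉0 x≉0 (power-≉0 n x≉0)

  ℂ-power-≉0 : ∀ {z} n → ¬ z ℂ.≈ ℂ.0# → ¬ (z ℂPower.^ n) ℂ.≈ ℂ.0#
  ℂ-power-≉0 zero    z≉0 (1≈0 , _) = 0<⇒≉0 0<1 1≈0
  ℂ-power-≉0 (suc n) z≉0 = ℂ-*-≉0 z≉0 (ℂ-power-≉0 n z≉0)

  private
    two = 1# + 1#


  -- σ² is the root of `R` outside the unit circle that belongs to an eigenvalue x.
  record Root (x : Carrier) : Set (κ ⊔ ℓ₁ ⊔ ℓ₂) where
    field
      σ σ⁻¹  : Carrier
      1<σ    : 1# < σ
      σσ⁻¹≈1 : σ * σ⁻¹ ≈ 1#
      sum≈x  : σ + σ⁻¹ ≈ x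

    0<σ : 0< σ
    0<σ = <-trans 0<1 1<σ

    0<σ⁻¹ : 0< σ⁻¹
    0<σ⁻¹ = 0<inverse 0<σ σσ⁻¹≈1

    σ⁻¹<1 : σ⁻¹ < 1#
    σ⁻¹<1 = 0<⇒< (0<-resp (trans (solve 2 (λ s r → (s :- con (+ 1)) :* r := s :* r :- r) refl σ σ⁻¹) (+-congʳ σσ⁻¹≈1)) (*-pos (<⇒0< 1<σ) 0<σ⁻¹))

  root : ∀ x → two < x → Root x
  root x 2<x =
    -- The polynomial 1 - s (x - s) is 2 - x < 0 at s = 1 and 1 at s = x; a zero has x - s as its
    -- inverse.
    let σ , 1<σ , σ<x , eq = root-between (poly-- (poly-const 0#) (poly-- (poly-* (poly-- poly-id (poly-const 0#)) (poly-- (poly-const x) poly-id)) (poly-const 1#)))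
          (<-trans (x<x+ 1# 0<1) 2<x)
          (0<-resp (solve 1 (λ x → x :- (con (+ 1) :+ con (+ 1)) := :- (con +0 :- ((con (+ 1) :- con +0) :* (x :- con (+ 1)) :- con (+ 1)))) refl x) (<⇒0< 2<x))
          (0<-resp (solve 1 (λ x → con (+ 1) := con +0 :- ((x :- con +0) :* (x :- x) :- con (+ 1))) refl x) 0<1)
    in record
      { σ = σ ; σ⁻¹ = x - σ ; 1<σ = 1<σ
      ; σσ⁻¹≈1 = trans (solve 2 (λ s x → s :* (x :- s) := con (+ 1) :- (con +0 :- ((s :- con +0) :* (x :- s) :- con (+ 1)))) refl σ x)
          (trans (+-congˡ (-‿cong eq)) (solve 0 (con (+ 1) :- con +0 := con (+ 1)) refl))
      ; sum≈x = solve 2 (λ s x → s :+ (x :- s) := x) refl σ x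
      }

  root-unique : ∀ {x y} (r : Root x) (r′ : Root y) → x ≈ y → Root.σ r ≈ Root.σ r′
  root-unique {x} {y} r r′ x≈y = x-y≈0⇒x≈y (*-cancel-0 (0<⇒≉0 (<⇒0< 1<σσ′)) (begin
    (a * b - 1#) * (a - b)
      ≈⟨ solve 4 (λ a b a′ b′ → (a :* b :- con (+ 1)) :* (a :- b) := a :* b :* (a :+ a′ :- (b :+ b′)) :+ b :* (con (+ 1) :- a :* a′) :- a :* (con (+ 1) :- b :* b′)) refl a b a′ b′ ⟩
    a * b * (a + a′ - (b + b′)) + b * (1# - a * a′) - a * (1# - b * b′)
      ≈⟨ +-cong (+-cong (*-congˡ (trans (+-cong (trans r.sum≈x x≈y) (-‿cong r′.sum≈x)) (-‿inverseʳ y)))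
           (*-congˡ (trans (+-congˡ (-‿cong r.σσ⁻¹≈1)) (-‿inverseʳ 1#)))) (-‿cong (*-congˡ (trans (+-congˡ (-‿cong r′.σσ⁻¹≈1)) (-‿inverseʳ 1#)))) ⟩
    a * b * 0# + b * 0# - a * 0#
      ≈⟨ solve 2 (λ a b → a :* b :* con +0 :+ b :* con +0 :- a :* con +0 := con +0) refl a b ⟩
    0# ∎))
    where
    module r = Root r
    module r′ = Root r′
    a = r.σ
    a′ = r.σ⁻¹
    b = r′.σ
    b′ = r′.σ⁻¹
    1<σσ′ : 1# < a * b
    1<σσ′ = 0<⇒< (0<-resp (solve 2 (λ a b → (a :- con (+ 1)) :* b :+ (b :- con (+ 1)) := a :* b :- con (+ 1)) refl a b)
      (+-pos (*-pos (<⇒0< r.1<σ) r′.0<σ) (<⇒0< r′.1<σ)))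

  roots-distinct : ∀ {x y} (r : Root x) (r′ : Root y) → x < y → Root.σ r * Root.σ r ≉ Root.σ r′ * Root.σ r′
  roots-distinct {x} {y} r r′ x<y eq = <-irrefl (trans (sym r.sum≈x) (trans (+-cong a≈b (inverse-≈ a≈b)) r′.sum≈x)) x<y
    where
    module r = Root r
    module r′ = Root r′
    a≈b : r.σ ≈ r′.σ
    a≈b = x-y≈0⇒x≈y (*-cancel-0 (0<⇒≉0 (+-pos r.0<σ r′.0<σ)) (trans (solve 2 (λ a b → (a :+ b) :* (a :- b) := a :* a :- b :* b) refl r.σ r′.σ) (trans (+-congʳ eq) (-‿inverseʳ _))))
    inverse-≈ : r.σ ≈ r′.σ → r.σ⁻¹ ≈ r′.σ⁻¹
    inverse-≈ a≈b = x-y≈0⇒x≈y (*-cancel-0 (0<⇒≉0 r.0<σ) (trans (solve 3 (λ a i j → a :* (i :- j) := a :* i :- a :* j) refl r.σ r.σ⁻¹ r′.σ⁻¹)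
      (trans (+-cong r.σσ⁻¹≈1 (-‿cong (trans (*-congʳ a≈b) r′.σσ⁻¹≈1))) (-‿inverseʳ 1#))))

  module _ {T t} (ρ : Represents T t) where
    private
      G = RootedGraph.graph T
      Rℝ = map ι (R G)

    Rℝ-value : ∀ {s s⁻¹} → s * s⁻¹ ≈ 1# → ev Rℝ (s * s) ≈ s ^ order T * P t (s + s⁻¹)
    Rℝ-value {s} ss⁻¹≈1 = trans (sym (ev-integers (identity K) (λ _ → refl) (R G) (s * s))) (R-value K ρ ss⁻¹≈1)

    Rℝ-root : ∀ {x} → P t x ≈ 0# → (r : Root x) → ev Rℝ (Root.σ r * Root.σ r) ≈ 0#
    Rℝ-root Px≈0 r = trans (Rℝ-value (Root.σσ⁻¹≈1 r)) (·0 (trans (P-cong t (Root.sum≈x r)) Px≈0))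

    root⇒zero : ∀ {s s⁻¹} → s * s⁻¹ ≈ 1# → ev Rℝ (s * s) ≈ 0# → P t (s + s⁻¹) ≈ 0#
    root⇒zero {s} ss⁻¹≈1 Rs≈0 = *-cancel-0 (power-≉0 (order T) s≉0) (trans (sym (Rℝ-value ss⁻¹≈1)) Rs≈0)
      where
      s≉0 : s ≉ 0#
      s≉0 s≈0 = 0<⇒≉0 0<1 (trans (sym ss⁻¹≈1) (0· s≈0))

    -- `R-value` over the dual numbers at σ + ε: as P = 0, the derivative of R(s²) at σ is σ^n P′,
    -- with P′ taken at the speed 1 - 1 / σ² > 0 of s + 1 / s. It is nonzero because W > 0 where F ≠
    -- 0, whereas a product of two vanishing factors has ε-part zero.
    no-double-root : ∀ {x} → P t x ≈ 0# → F t x ≉ 0# → (r : Root x) → ∀ {u v} →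
      D.ev Rℝ ((Root.σ r , 1#) dual.* (Root.σ r , 1#)) dual.≈ u dual.* v → proj₁ u ≈ 0# → proj₁ v ≈ 0# → ⊥
    no-double-root {x} Px≈0 Fx≉0 r {u₁ , u₂} {v₁ , v₂} eq u≈0 v≈0 = *-≉0 (power-≉0 (order T) (0<⇒≉0 0<σ)) P′≉0 (begin
      σ ^ order T * P′ t y c
        ≈⟨ trans (+-congˡ (*-congˡ P-0)) (trans (+-congˡ (zeroʳ _)) (+-identityʳ _)) ⟨
      σ ^ order T * P′ t y c + proj₂ (s dualPower.^ order T) * proj₁ (ε.P t (y , c))
        ≈⟨ +-congʳ (*-congʳ (reflexive (power-real (order T)))) ⟨
      proj₁ (s dualPower.^ order T) * P′ t y c + proj₂ (s dualPower.^ order T) * proj₁ (ε.P t (y , c))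
        ≈⟨ proj₂ (R-value dual ρ {s} {s⁻¹} ss⁻¹≈1) ⟨
      proj₂ (Evaluation.ev (fromIntegers dual) (R G) (s dual.* s))
        ≈⟨ proj₂ (ev-integers constant ι-constant (R G) (s dual.* s)) ⟩
      proj₂ (D.ev Rℝ (s dual.* s))
        ≈⟨ proj₂ eq ⟩
      u₁ * v₂ + u₂ * v₁
        ≈⟨ +-cong (0· u≈0) (·0 v≈0) ⟩
      0# + 0#
        ≈⟨ +-identityˡ 0# ⟩
      0# ∎)
      where
      open Root r
      s s⁻¹ : dual.Carrier
      s = σ , 1#
      s⁻¹ = σ⁻¹ , - (σ⁻¹ * σ⁻¹)
      y = σ + σ⁻¹
      c = 1# - σ⁻¹ * σ⁻¹
      0<c : 0< c
      0<c = 0<-resp (solve 1 (λ s → (con (+ 1) :- s) :* (con (+ 1) :+ s) := con (+ 1) :- s :* s) refl σ⁻¹) (*-pos (<⇒0< σ⁻¹<1) (+-pos 0<1 0<σ⁻¹))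
      ss⁻¹≈1 : (s dual.* s⁻¹) dual.≈ dual.1#
      ss⁻¹≈1 = σσ⁻¹≈1 , trans (solve 2 (λ s r → s :* :- (r :* r) :+ con (+ 1) :* r := r :- s :* r :* r) refl σ σ⁻¹)
        (trans (+-congˡ (-‿cong (trans (*-congʳ σσ⁻¹≈1) (*-identityˡ _)))) (-‿inverseʳ _))
      power-real : ∀ n → proj₁ (s dualPower.^ n) ≡ σ ^ n
      power-real zero    = ≡.refl
      power-real (suc n) = ≡.cong (σ *_) (power-real n)
      P-0 : proj₁ (ε.P t (y , c)) ≈ 0#
      P-0 = trans (reflexive (P-real t y c)) (trans (P-cong t sum≈x) Px≈0)
      Fy≉0 : F t y ≉ 0#
      Fy≉0 Fy≈0 = Fx≉0 (trans (F-cong t (sym sum≈x)) Fy≈0)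
      P′≉0 : P′ t y c ≉ 0#
      P′≉0 P′≈0 = 0<⇒≉0 (W-pos t 0<c (inj₂ Fy≉0)) (trans (+-cong (0· P′≈0)
        (-‿cong (0· (trans (P-cong t sum≈x) Px≈0)))) (-‿inverseʳ 0#))

    -- z has a square root w = c + i d in the upper half plane, and |w| > 1 gives w + 1 / w the
    -- imaginary part d (1 - 1 / |w|²) > 0. There P ≠ 0 by `herglotz-pos`, hence R(z) = w^n P(w + 1
    -- / w) ≠ 0.
    off-axis : ∀ u v → 1# < norm (u , v) → ¬ (0< u × v ≈ 0#) → ¬ ℂE.ev Rℝ (u , v) ℂ.≈ ℂ.0#
    off-axis u v 1<n not-positive Rz≈0 =
      let c , d , 0<d , ww≈z = upper-sqrt u v 1<n not-positive
          N = norm (c , d)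
          0<N = +-nonneg-pos (square-nonneg c) (*-pos 0<d 0<d)
          n , Nn≈1 = inverse (0<⇒≉0 0<N)
      in absurd c d n 0<d ww≈z 0<N Nn≈1
      where
      absurd : ∀ c d n → 0< d → ((c , d) ℂ.* (c , d)) ℂ.≈ (u , v) → 0< norm (c , d) → norm (c , d) * n ≈ 1# → ⊥
      absurd c d n 0<d ww≈z 0<N Nn≈1 = ℂ-*-≉0 (ℂ-power-≉0 (order T) w≉0) (herglotz⇒P≉0 t (herglotz-pos t 0<im))
        (ℂ.trans (ℂ.sym (R-value ℂ-ring ρ {w} {w⁻¹} ww⁻¹≈1)) (ℂ.trans (ev-integers real ι-real (R G) (w ℂ.* w)) (ℂ.trans (ℂE.ev-cong₂ Rℝ ww≈z) Rz≈0)))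
        where
        w w⁻¹ : ℂ.Carrier
        w = c , d
        w⁻¹ = c * n , - (d * n)
        w≉0 : ¬ w ℂ.≈ ℂ.0#
        w≉0 (_ , d≈0) = 0<⇒≉0 0<d d≈0
        ww⁻¹≈1 : (w ℂ.* w⁻¹) ℂ.≈ ℂ.1#
        ww⁻¹≈1 = trans (solve 3 (λ c d n → c :* (c :* n) :- d :* :- (d :* n) := (c :* c :+ d :* d) :* n) refl c d n) Nn≈1 ,
          solve 3 (λ c d n → c :* :- (d :* n) :+ d :* (c :* n) := con +0) refl c d n
        1<N : 1# < norm w
        1<N = square-<⇒< 0<N (<-respˡ-≈ (sym (*-identityˡ 1#)) (<-respʳ-≈ (trans (sym (norm-cong ww≈z)) (norm-* w w)) 1<n))
          where
          norm-cong : ∀ {z z′} → z ℂ.≈ z′ → norm z ≈ norm z′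
          norm-cong (a≈ , b≈) = +-cong (*-cong a≈ a≈) (*-cong b≈ b≈)
        0<im : 0< d - d * n
        0<im = 0<-resp (trans (solve 3 (λ N d n → d :* ((N :- con (+ 1)) :* n) := d :* (N :* n) :- d :* n) refl (norm w) d n)
            (+-congʳ (trans (*-congˡ Nn≈1) (*-identityʳ d))))
          (*-pos 0<d (*-pos (<⇒0< 1<N) (0<inverse 0<N Nn≈1)))

    complex-root⇒real : ∀ u v → 1# < norm (u , v) → ℂE.ev Rℝ (u , v) ℂ.≈ ℂ.0# → 0< u × v ≈ 0#
    complex-root⇒real u v 1<n Rz≈0 with sign u | ≉0-or-≈0 v
    ... | pos 0<u  | inj₂ v≈0 = 0<u , v≈0
    ... | pos 0<u  | inj₁ v≉0 = ⊥-elim (off-axis u v 1<n (λ (_ , v≈0) → v≉0 v≈0) Rz≈0)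
    ... | nul u≈0  | _ = ⊥-elim (off-axis u v 1<n (λ (0<u , _) → 0<⇒≉0 0<u u≈0) Rz≈0)
    ... | neg 0<-u | _ = ⊥-elim (off-axis u v 1<n (λ (0<u , _) → 0<⇒¬0<- 0<u 0<-u) Rz≈0)

    module _ {x₁ x₂} (2<x₁ : two < x₁) (x₁<x₂ : x₁ < x₂) (P₁≈0 : P t x₁ ≈ 0#) (P₂≈0 : P t x₂ ≈ 0#)
      (F₁≉0 : F t x₁ ≉ 0#) (F₂≉0 : F t x₂ ≉ 0#) (only : ∀ y → two < y → P t y ≈ 0# → y ≈ x₁ ⊎ y ≈ x₂) where

      private
        r₁ = root x₁ 2<x₁
        r₂ = root x₂ (<-trans 2<x₁ x₁<x₂)
        module r₁ = Root r₁
        module r₂ = Root r₂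
        a = r₁.σ * r₁.σ
        b = r₂.σ * r₂.σ
        q₁ = quot a Rℝ
        q = quot b q₁

        a≉b : a ≉ b
        a≉b = roots-distinct r₁ r₂ x₁<x₂

        Ra≈0 : ev Rℝ a ≈ 0#
        Ra≈0 = Rℝ-root P₁≈0 r₁

        q₁b≈0 : ev q₁ b ≈ 0#
        q₁b≈0 = *-cancel-0 (λ b-a≈0 → a≉b (sym (x-y≈0⇒x≈y b-a≈0))) (trans (sym (factor Rℝ a Ra≈0 b)) (Rℝ-root P₂≈0 r₂))

      module _ {κ′ ℓ′} {L : CommutativeRing κ′ ℓ′} (φ : Hom rawRing L) where
        private
          module L where
            open CommutativeRing L public
            open Integers L public
          module φ = Hom φ
          open Evaluation φ renaming (ev to evᴸ; ev-quot to ev-quotᴸ; ev-eval to ev-evalᴸ) using ()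

          factorᴸ : ∀ p c → ev p c ≈ 0# → ∀ z → evᴸ p z L.≈ (z L.- φ.⟦ c ⟧) L.* evᴸ (quot c p) z
          factorᴸ p c pc≈0 z = L.trans (ev-quotᴸ p c z) (L.trans (L.+-congˡ (L.trans (L.sym (ev-evalᴸ p c))
            (L.trans (φ.cong (trans (ev-eval p c) pc≈0)) φ.0-homo))) (L.+-identityʳ _))

        -- Needed in three rings: dual numbers show that q does not vanish at a and b, the field and
        -- the complex numbers that q has no other root outside the unit circle.
        factored : ∀ z → evᴸ Rℝ z L.≈ (z L.- φ.⟦ a ⟧) L.* ((z L.- φ.⟦ b ⟧) L.* evᴸ q z)
        factored z = L.trans (factorᴸ Rℝ a Ra≈0 z) (L.*-congˡ (factorᴸ q₁ b q₁b≈0 z))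

      private
        qa≉0 : ev q a ≉ 0#
        qa≉0 qa≈0 = no-double-root P₁≈0 F₁≉0 r₁ (factored constant z̃) (-‿inverseʳ a)
          (trans (*-congˡ (trans (reflexive (D-real q a (proj₂ z̃))) qa≈0)) (zeroʳ _))
          where z̃ = (r₁.σ , 1#) dual.* (r₁.σ , 1#)

        qb≉0 : ev q b ≉ 0#
        qb≉0 qb≈0 = no-double-root P₂≈0 F₂≉0 r₂
          (dual.trans (factored constant z̃) (dual.trans (dual.sym (dual.*-assoc (z̃ dual.- (a , 0#)) (z̃ dual.- (b , 0#)) (D.ev q z̃)))
            (dual.trans (dual.*-congʳ (dual.*-comm (z̃ dual.- (a , 0#)) (z̃ dual.- (b , 0#)))) (dual.*-assoc (z̃ dual.- (b , 0#)) (z̃ dual.- (a , 0#)) (D.ev q z̃)))))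
          (-‿inverseʳ b) (trans (*-congˡ (trans (reflexive (D-real q b (proj₂ z̃))) qb≈0)) (zeroʳ _))
          where z̃ = (r₂.σ , 1#) dual.* (r₂.σ , 1#)

        -- With s² = u, such a root would give the zero s + 1 / s > 2 of `P`. This is x₁ or x₂, so u
        -- is a or b, where q does not vanish.
        no-real-root : ∀ u → 0< u → 1# < u * u → ev q u ≈ 0# → ⊥
        no-real-root u 0<u 1<uu qu≈0 =
          let s , 0<s , ss≈u = sqrt 0<u
              s⁻¹ , ss⁻¹≈1 = inverse (0<⇒≉0 0<s)
          in absurd s s⁻¹ 0<s ss≈u ss⁻¹≈1
          where
          absurd : ∀ s s⁻¹ → 0< s → s * s ≈ u → s * s⁻¹ ≈ 1# → ⊥
          absurd s s⁻¹ 0<s ss≈u ss⁻¹≈1 = Sum.[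
              (λ y≈x₁ → qa≉0 (trans (ev-cong₂ q (sym (u≈ r₁ y≈x₁))) qu≈0)) ,
              (λ y≈x₂ → qb≉0 (trans (ev-cong₂ q (sym (u≈ r₂ y≈x₂))) qu≈0)) ]′ (only (s + s⁻¹) 2<y Py≈0)
            where
            1<u : 1# < u
            1<u = square-<⇒< 0<u (<-respˡ-≈ (sym (*-identityˡ 1#)) 1<uu)
            1<s : 1# < s
            1<s = square-<⇒< 0<s (<-respˡ-≈ (sym (*-identityˡ 1#)) (<-respʳ-≈ (sym ss≈u) 1<u))
            r : Root (s + s⁻¹)
            r = record { σ = s ; σ⁻¹ = s⁻¹ ; 1<σ = 1<s ; σσ⁻¹≈1 = ss⁻¹≈1 ; sum≈x = refl }
            u≈ : ∀ {x} (r′ : Root x) → s + s⁻¹ ≈ x → u ≈ Root.σ r′ * Root.σ r′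
            u≈ r′ eq = trans (sym ss≈u) (*-cong (root-unique r r′ eq) (root-unique r r′ eq))
            2<y : two < s + s⁻¹
            2<y = 0<⇒< (0<-resp (trans (solve 2 (λ s t → (s :- con (+ 1)) :* (con (+ 1) :- t) := s :+ t :- con (+ 1) :- s :* t) refl s s⁻¹)
              (trans (+-congˡ (-‿cong ss⁻¹≈1)) (solve 1 (λ y → y :- con (+ 1) :- con (+ 1) := y :- (con (+ 1) :+ con (+ 1))) refl (s + s⁻¹))))
              (*-pos (<⇒0< 1<s) (<⇒0< (Root.σ⁻¹<1 r))))
            Py≈0 : P t (s + s⁻¹) ≈ 0#
            Py≈0 = root⇒zero ss⁻¹≈1 (trans (ev-cong₂ Rℝ ss≈u) (trans (factored (identity K) u) (·0 (·0 qu≈0))))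

        outside : ∀ {x} (r : Root x) → OutsideUnitCircle (Root.σ r * Root.σ r , 0#)
        outside r = 0<⇒< (0<-resp (solve 1 (λ s → (s :- con (+ 1)) :* (s :+ con (+ 1)) :* (s :* s :+ con (+ 1)) := s :* s :* (s :* s) :+ con +0 :* con +0 :- con (+ 1)) refl (Root.σ r))
          (*-pos (*-pos (<⇒0< (Root.1<σ r)) (+-pos (Root.0<σ r) 0<1)) (+-pos (*-pos (Root.0<σ r) (Root.0<σ r)) 0<1)))

        _≋_ : List ℂ.Carrier → List Carrier → Set _
        _≋_ = Pointwise (λ z x → z ℂ.≈ (x , 0#))

        module ℂL = Coefficients ℂ

        ≋-coeff : ∀ {Q q} → Q ≋ q → ∀ k → ℂL.coeff Q k ℂ.≈ (coeff q k , 0#)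
        ≋-coeff []       k       = refl , refl
        ≋-coeff (e ∷ es) zero    = e
        ≋-coeff (e ∷ es) (suc k) = ≋-coeff es k

        ≋-add : ∀ {Q q Q′ q′} → Q ≋ q → Q′ ≋ q′ → ℂL.add Q Q′ ≋ add q q′
        ≋-add []       es′        = es′
        ≋-add (e ∷ es) []         = e ∷ es
        ≋-add (e ∷ es) (e′ ∷ es′) = (+-cong (proj₁ e) (proj₁ e′) , trans (+-cong (proj₂ e) (proj₂ e′)) (+-identityˡ 0#)) ∷ ≋-add es es′

        ≋-scale : ∀ {z x Q q} → z ℂ.≈ (x , 0#) → Q ≋ q → ℂL.scale z Q ≋ scale x q
        ≋-scale e []         = []
        ≋-scale {x = x} e (_∷_ {y = y} e′ es) = ℂ.trans (ℂ.*-cong e e′) (ℂ.sym (Hom.*-homo real x y)) ∷ ≋-scale e es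

        ≋-mul : ∀ {Q q Q′ q′} → Q ≋ q → Q′ ≋ q′ → ℂL.mul Q Q′ ≋ mul q q′
        ≋-mul []       es′ = []
        ≋-mul (e ∷ es) es′ = ≋-add (≋-scale e es′) ((refl , refl) ∷ ≋-mul es es′)

        ≋-map : ∀ p → map (_, 0#) p ≋ p
        ≋-map []      = []
        ≋-map (x ∷ p) = (refl , refl) ∷ ≋-map p

        ≋-X- : ∀ c → (X- (c , 0#)) ≋ (- c ∷ 1# ∷ [])
        ≋-X- c = (refl , -0#≈0#) ∷ (refl , refl) ∷ []

        ≋-fromℤ : ∀ p → map fromℤ p ≋ map ι p
        ≋-fromℤ []      = []
        ≋-fromℤ (i ∷ p) = fromℤ-real i ∷ ≋-fromℤ p

        product : List Carrier
        product = mul (mul (- a ∷ 1# ∷ []) (- b ∷ 1# ∷ [])) q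

        product-value : ∀ x → ev Rℝ x ≈ ev product x
        product-value x = trans (factored (identity K) x) (sym (trans (ev-mul (mul (- a ∷ 1# ∷ []) (- b ∷ 1# ∷ [])) q x)
          (trans (*-congʳ (ev-mul (- a ∷ 1# ∷ []) (- b ∷ 1# ∷ []) x))
            (solve 4 (λ x a b q → (:- a :+ x :* (con (+ 1) :+ x :* con +0)) :* (:- b :+ x :* (con (+ 1) :+ x :* con +0)) :* q := (x :- a) :* ((x :- b) :* q)) refl x a b (ev q x)))))

      two-roots : TwoRootsOutsideUnitCircle (R G)
      two-roots = (a , 0#) , (b , 0#) , map (_, 0#) q , (λ (a≈b , _) → a≉b a≈b) , outside r₁ , outside r₂ ,
        (λ k → ℂ.trans (≋-coeff (≋-fromℤ (R G)) k) (ℂ.trans (equal-values⇒equal-coefficients Rℝ product product-value k , refl)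
          (ℂ.sym (≋-coeff (≋-mul (≋-mul (≋-X- a) (≋-X- b)) (≋-map q)) k)))) ,
        λ (u , v) qz≈0 1<n →
          let qz≈0′ = ℂ.trans (ℂ.reflexive (≡.sym (ℂE.eval-map q (u , v)))) qz≈0
              0<u , v≈0 = complex-root⇒real u v 1<n (ℂ.trans (factored real (u , v)) (ℂ.trans (ℂ.*-congˡ {(u , v) ℂ.- (a , 0#)} (ℂ.trans (ℂ.*-congˡ {(u , v) ℂ.- (b , 0#)} qz≈0′) (ℂ.zeroʳ ((u , v) ℂ.- (b , 0#))))) (ℂ.zeroʳ ((u , v) ℂ.- (a , 0#)))))
          in no-real-root u 0<u (<-respʳ-≈ (trans (+-congˡ (0· v≈0)) (+-identityʳ _)) 1<n)
               (proj₁ (ℂ.trans (Hom-ev q u) (ℂ.trans (ℂE.ev-cong₂ q (refl , sym v≈0)) qz≈0′)))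
        where
        Hom-ev : ∀ p x → (ev p x , 0#) ℂ.≈ ℂE.ev p (x , 0#)
        Hom-ev []      x = refl , refl
        Hom-ev (c ∷ p) x = ℂ.trans (Hom.+-homo real c (x * ev p x)) (ℂ.+-congˡ {c , 0#} (ℂ.trans (Hom.*-homo real x (ev p x)) (ℂ.*-congˡ {x , 0#} (Hom-ev p x))))

-- The three statements on Salem trees.

module SalemTrees {κ ℓ₁ ℓ₂} (ℝ : RealClosedField κ ℓ₁ ℓ₂) where
  open RealClosedField ℝ hiding (zero) renaming (commutativeRing to K)
  open OrderedField ℝ
  open Monotonicity ℝ
  open JoinedTrees ℝ
  open TreeEigenvectors ℝ
  open TreeSpectra ℝ
  open NuValues ℝ
  open ReciprocalRoots ℝ using (two-roots)
  open Integers K using (solve; _:=_; :-_)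
  open CharacteristicLaws K
  open TreeSums K using (Solves; Solves-cong; graph⇒tree; tree⇒graph)
  open Spectra ℝ
  open RootedGraph using (graph)

  -- An eigenvector of the forest obtained by deleting the root: c absorbs the equation at the root.

  RootlessEigenvector : (t : Tree) → Carrier → Set _
  RootlessEigenvector t x = ∃[ f ] ∃[ c ] Solves t f x c × f (top t) ≈ 0# × ∃[ p ] f p ≉ 0#

  -- If a branch s has index x > 2, its eigenvector φ is extended by zero, and c = -φ(top) cancels
  -- its contribution at the root.
  bounded-or-rootless : ∀ t → Branches-bounded t 2ᴿ ⊎ ∃[ x ] 2ᴿ < x × RootlessEigenvector t x
  bounded-or-rootless •       = inj₁ tt
  bounded-or-rootless (t ⊕ s) = by-cases (bounded-or-exceeds s 2ᴿ) (bounded-or-rootless t)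
    where
    by-cases : Bounded s 2ᴿ ⊎ Exceeds s 2ᴿ → Branches-bounded t 2ᴿ ⊎ (∃[ x ] 2ᴿ < x × RootlessEigenvector t x) →
      Branches-bounded (t ⊕ s) 2ᴿ ⊎ ∃[ x ] 2ᴿ < x × RootlessEigenvector (t ⊕ s) x
    by-cases (inj₁ bs) (inj₁ bt) = inj₁ (bt , bs)
    by-cases (inj₁ bs) (inj₂ (x , 2<x , f , c , eq , f≈0 , p , f≉0)) = inj₂ (x , 2<x , Sum.[ f , (λ _ → 0#) ] , c ,
      (Solves-cong t (λ _ → refl) (sym (+-identityʳ c)) eq , Solves-cong s (λ _ → refl) (sym f≈0) (Solves-zero s x)) , f≈0 , inj₁ p , f≉0)
    by-cases (inj₂ (x , 2<x , ps , Ps≈0)) _ = inj₂ (x , 2<x , Sum.[ (λ _ → 0#) , φ s x ] , - φ s x (top s) ,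
      (Solves-cong t (λ _ → refl) (sym (-‿inverseˡ _)) (Solves-zero t x) , Solves-cong s (λ _ → refl) Ps≈0 (φ-solves s x)) , refl ,
      inj₂ (top s) , λ φ≈0 → 0<⇒≉0 (F-pos s ps) (trans (sym (φ-top s x)) φ≈0))

  -- Two terms for T may order the branches differently. An eigenvector of T - r for some x > 2 is a
  -- notion of the graph, so it is moved from t to t′, where boundedness of the branches excludes
  -- it.
  branches-bounded-invariant : ∀ {T t t′} → Represents T t → Represents T t′ → Branches-bounded t′ 2ᴿ → Branches-bounded t 2ᴿ
  branches-bounded-invariant {T} {t} {t′} ρ ρ′ bt′ = Sum.[ id , (λ (x , 2<x , r) → ⊥-elim (impossible x 2<x r)) ]′ (bounded-or-rootless t)
    where
    module ρ = Represents ρ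
    module ρ′ = Represents ρ′
    impossible : ∀ x → 2ᴿ < x → RootlessEigenvector t x → ⊥
    impossible x 2<x (f , c , eq , f≈0 , p , f≉0) = f≉0 (trans (reflexive (≡.cong f (≡.sym (≡.trans (≡.cong ρ.locate (ρ′.place-locate _)) (ρ.locate-place p)))))
        (solution-vanishes t′ (Solves-cong t′ (λ _ → refl) c≈0 eq′) g≈0 (λ (_ , F≈0) → 0<⇒≉0 0<F F≈0) (ρ′.locate (ρ.place p))))
      where
      g : Pos t′ → Carrier
      g = f ∘ ρ.locate ∘ ρ′.place
      eq′ : Solves t′ g x c
      eq′ = graph⇒tree ρ′ {f ∘ ρ.locate} (tree⇒graph ρ eq)
      g≈0 : g (top t′) ≈ 0#
      g≈0 = trans (reflexive (≡.cong f (≡.trans (≡.cong ρ.locate (≡.trans ρ′.roots (≡.sym ρ.roots))) (ρ.locate-place (top t))))) f≈0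
      0<F : 0< F t′ x
      0<F = F-pos t′ (Branches-bounded⇒Positive t′ bt′ 2<x)
      c≈0 : c ≈ 0#
      c≈0 = *-cancel-0 (0<⇒≉0 0<F) (trans (sym (root-value t′ eq′)) (·0 g≈0))

  private
    pointwise⇒forest : ∀ {Ts ss} → Pointwise Decomposed Ts ss → All (IsTree ∘ graph) Ts → Branches-bounded (attach ss) 2ᴿ → CyclotomicForest Ts
    pointwise⇒forest []       []             _         = []
    pointwise⇒forest (d ∷ ds) (tree ∷ trees) (bt , bs) = (tree , cyclotomic (represents d) bs) ∷ pointwise⇒forest ds trees bt

    forest⇒pointwise : ∀ {Ts ss} → Pointwise Decomposed Ts ss → CyclotomicForest Ts → Branches-bounded (attach ss) 2ᴿ
    forest⇒pointwise []       []              = tt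
    forest⇒pointwise (d ∷ ds) ((_ , cyc) ∷ cs) = forest⇒pointwise ds cs , cyclotomic⇒bounded (represents d) cyc

  bounded⇒cyclotomicForest : ∀ {T t} → IsTree (graph T) → Decomposed T t → Branches-bounded t 2ᴿ → CyclotomicForest (T ′)
  bounded⇒cyclotomicForest {T} tree (decomposed ss _ ds) bt = pointwise⇒forest ds (branch-trees T tree) bt

  cyclotomicForest⇒bounded : ∀ {T t} → Decomposed T t → CyclotomicForest (T ′) → Branches-bounded t 2ᴿ
  cyclotomicForest⇒bounded (decomposed ss _ ds) cs = forest⇒pointwise ds cs

  module _ (T : RootedGraph) (tree : IsTree (graph T)) (forest : CyclotomicForest (T ′)) where
    private
      t = proj₁ (decompose T tree)
      d = proj₂ (decompose T tree)
      ρ = represents d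
      bt = cyclotomicForest⇒bounded d forest

    2<ν⇒salem : [ 2ℚ ] <⁺ νᶠ (T ′) → SalemTree (graph T)
    2<ν⇒salem 2<ν =
      let y , 2<y , py , Py≈0 = 2<ν⇒exceeds d bt 2<ν
      in tree , salem ρ 2<y Py≈0 (0<⇒≉0 (F-pos t py)) λ z 2<z Pz≈0 →
           index-unique t (Branches-bounded⇒Positive t bt 2<z , Pz≈0) (py , Py≈0)

    ν≤2⇒cyclotomic : νᶠ (T ′) ≤⁺ [ 2ℚ ] → CyclotomicTree (graph T)
    ν≤2⇒cyclotomic ν≤2 = tree , cyclotomic ρ (ν≤2⇒bounded d bt ν≤2)

  record TypeATree (T : RootedGraph) : Set (κ ⊔ ℓ₁ ⊔ ℓ₂) where
    field
      {tree}     : Tree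
      decomposes : Decomposed T tree
      branches   : Branches-bounded tree 2ᴿ
      exceeds    : Exceeds tree 2ᴿ

  typeA⇒tree : ∀ {T} → TypeA T → TypeATree T
  typeA⇒tree {T} (tree , forest , 2<ν) = record { decomposes = d ; branches = bt ; exceeds = 2<ν⇒exceeds d bt 2<ν }
    where
    d = proj₂ (decompose T tree)
    bt = cyclotomicForest⇒bounded d forest

  tree⇒typeA : ∀ {T t} → Represents T t → Branches-bounded t 2ᴿ → Exceeds t 2ᴿ → TypeA T
  tree⇒typeA {T} {t} ρ bt et = tree , bounded⇒cyclotomicForest tree d bt′ , exceeds⇒2<ν d bt′ et′
    where
    tree = represents⇒tree ρ
    t′ = proj₁ (decompose T tree)
    d = proj₂ (decompose T tree)
    bt′ = branches-bounded-invariant (represents d) ρ bt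
    et′ : Exceeds t′ 2ᴿ
    et′ = Sum.[ (λ b → let y , 2<y , _ , Py≈0 = et in ⊥-elim (absurd 2<y (proj₂ (cyclotomic (represents d) b y (zero⇒eigenvalue ρ Py≈0))))) , id ]′ (bounded-or-exceeds t′ 2ᴿ)
      where
      absurd : ∀ {y} → 2ᴿ < y → y < 2ᴿ ⊎ y ≈ 2ᴿ → ⊥
      absurd 2<y (inj₁ y<2) = <-asym 2<y y<2
      absurd 2<y (inj₂ y≈2) = <-irrefl (sym y≈2) 2<y

  module _ (t s : Tree) (bt : Branches-bounded t 2ᴿ) (bs : Branches-bounded s 2ᴿ) (et : Exceeds t 2ᴿ) where

    -- The index of the join. At it `P s` is positive because s is a branch, and by `zero-signs` so
    -- is `P t`.
    top-zero : ∃[ x ] 2ᴿ < x × P (t ⊕ s) x ≈ 0# × (0< P t x × 0< P s x) × F (t ⊕ s) x ≉ 0#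
    top-zero =
      let x , 2<x , (pt , ps , 0<Ps) , Px≈0 = index-of-join t s et
      in x , 2<x , Px≈0 , signs 0<Ps (zero-signs t s bt bs 2<x Px≈0) , 0<⇒≉0 (*-pos (F-pos t pt) 0<Ps)
      where
      signs : ∀ {x} → 0< P s x → (0< P t x × 0< P s x) ⊎ (0< - P t x × 0< - P s x) → 0< P t x × 0< P s x
      signs 0<Ps (inj₁ positive)    = positive
      signs 0<Ps (inj₂ (_ , 0<-Ps)) = contradiction 0<-Ps (0<⇒¬0<- 0<Ps)

  joined-salem : ∀ T₁ T₂ → TypeA T₁ → TypeA T₂ → excess T₁ T₂ ≤⁺ [ 1ℚ ] → SalemTree (graph (T₁ +ᵀ T₂))
  joined-salem T₁ T₂ A₁ A₂ e≤1 =
    let x , 2<x , Px≈0 , positive , F≉0 = top-zero t s bt bs et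
    in represents⇒tree ρ , salem ρ 2<x Px≈0 F≉0 λ y 2<y Py≈0 →
         Sum.[ (λ positive′ → same-signs⇒equal t s bt bs 2<y 2<x Py≈0 Px≈0 (inj₁ (positive′ , positive))) ,
               -- A zero with both pivots negative would make `P` of the join positive at 2, against
               -- the bound on the excess.
               (λ (0<-Pt , 0<-Ps) → let pt , ps , 0≤-P = excess≤1 a.decomposes bt b.decomposes bs e≤1 in
                 ⊥-elim (0≤⇒¬0<- 0≤-P (0<-resp (solve 1 (λ p → p := :- :- p) refl (P (t ⊕ s) 2ᴿ)) (both-negative-falls t s pt ps 2<y 0<-Pt 0<-Ps Py≈0)))) ]′
           (zero-signs t s bt bs 2<y Py≈0)
    where
    module a = TypeATree (typeA⇒tree A₁)
    module b = TypeATree (typeA⇒tree A₂)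
    t = a.tree
    s = b.tree
    bt = a.branches
    bs = b.branches
    et = a.exceeds
    ρ = represents-+ᵀ (represents a.decomposes) (represents b.decomposes)

  two-zeros : ∀ T₁ T₂ (A₁ : TypeATree T₁) (A₂ : TypeATree T₂) → [ 1ℚ ] <⁺ excess T₁ T₂ →
    let t = TypeATree.tree A₁; s = TypeATree.tree A₂ in
    ∃[ x₁ ] ∃[ x₂ ] 2ᴿ < x₁ × x₁ < x₂ × P (t ⊕ s) x₁ ≈ 0# × P (t ⊕ s) x₂ ≈ 0# × F (t ⊕ s) x₁ ≉ 0# × F (t ⊕ s) x₂ ≉ 0# ×
      (∀ y → 2ᴿ < y → P (t ⊕ s) y ≈ 0# → y ≈ x₁ ⊎ y ≈ x₂)
  two-zeros T₁ T₂ A₁ A₂ 1<e =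
    let x₁ , 2<x₁ , P₁≈0 , 0<-Pt , 0<-Ps = excess⇒second-zero t s bt bs et es (1<excess a.decomposes bt b.decomposes bs 1<e)
        x₂ , 2<x₂ , P₂≈0 , (0<Pt , 0<Ps) , F₂≉0 = top-zero t s bt bs et
    in x₁ , x₂ , 2<x₁ , ascending 2<x₂ 0<Ps 0<-Ps , P₁≈0 , P₂≈0 ,
       *-≉0 (0<⇒≉0 (F-pos t (Branches-bounded⇒Positive t bt 2<x₁))) (0<-⇒≉0 0<-Ps) , F₂≉0 , λ y 2<y Py≈0 →
         Sum.[ (λ positive → inj₂ (same-signs⇒equal t s bt bs 2<y 2<x₂ Py≈0 P₂≈0 (inj₁ (positive , (0<Pt , 0<Ps))))) ,
               (λ negative → inj₁ (same-signs⇒equal t s bt bs 2<y 2<x₁ Py≈0 P₁≈0 (inj₂ (negative , (0<-Pt , 0<-Ps))))) ]′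
           (zero-signs t s bt bs 2<y Py≈0)
    where
    module a = TypeATree A₁
    module b = TypeATree A₂
    t = a.tree
    s = b.tree
    bt = a.branches
    bs = b.branches
    et = a.exceeds
    es = b.exceeds
    ascending : ∀ {x₁ x₂} → 2ᴿ < x₂ → 0< P s x₂ → 0< - P s x₁ → x₁ < x₂
    ascending {x₁} {x₂} 2<x₂ 0<P 0<-P = by-order (<-or-≥ x₁ x₂)
      where
      by-order : x₁ < x₂ ⊎ (x₂ < x₁ ⊎ x₂ ≈ x₁) → x₁ < x₂
      by-order (inj₁ x₁<x₂) = x₁<x₂
      by-order (inj₂ (inj₁ x₂<x₁)) = contradiction 0<-P (0<⇒¬0<- (P-rises s (Branches-bounded⇒Positive s bs 2<x₂) x₂<x₁ (inj₁ 0<P)))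
      by-order (inj₂ (inj₂ x₂≈x₁)) = contradiction 0<-P (0<⇒¬0<- (0<-resp (P-cong s x₂≈x₁) 0<P))

  joined-two-roots : ∀ T₁ T₂ → TypeA T₁ → TypeA T₂ → [ 1ℚ ] <⁺ excess T₁ T₂ → TwoRootsOutsideUnitCircle (R (graph (T₁ +ᵀ T₂)))
  joined-two-roots T₁ T₂ A₁ A₂ 1<e =
    let x₁ , x₂ , 2<x₁ , x₁<x₂ , P₁≈0 , P₂≈0 , F₁≉0 , F₂≉0 , only = two-zeros T₁ T₂ (typeA⇒tree A₁) (typeA⇒tree A₂) 1<e
    in two-roots (represents-+ᵀ (represents a.decomposes) (represents b.decomposes)) 2<x₁ x₁<x₂ P₁≈0 P₂≈0 F₁≉0 F₂≉0 only
    where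
    module a = TypeATree (typeA⇒tree A₁)
    module b = TypeATree (typeA⇒tree A₂)

  -- The bound on the size makes the walk of `search` end.
  Splits : Tree → Set _
  Splits t = ∃[ t₀ ] ∃[ s ] t ≃ (t₀ ⊕ s) × Exceeds s 2ᴿ × size s ℕ.< size t

  0<size : ∀ t → 0 ℕ.< size t
  0<size •       = ℕ.s≤s ℕ.z≤n
  0<size (t ⊕ s) = ℕ.≤-trans (0<size t) (ℕ.m≤m+n _ _)

  bounded-or-splits : ∀ t → Branches-bounded t 2ᴿ ⊎ Splits t
  bounded-or-splits •       = inj₁ tt
  bounded-or-splits (t ⊕ s) = by-cases (bounded-or-exceeds s 2ᴿ) (bounded-or-splits t)
    where
    by-cases : Bounded s 2ᴿ ⊎ Exceeds s 2ᴿ → Branches-bounded t 2ᴿ ⊎ Splits t → Branches-bounded (t ⊕ s) 2ᴿ ⊎ Splits (t ⊕ s)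
    by-cases (inj₁ bs) (inj₁ bt) = inj₁ (bt , bs)
    by-cases (inj₂ es) _         = inj₂ (t , s , ≃-refl , es , ℕ.m<n+m (size s) (0<size t))
    by-cases (inj₁ bs) (inj₂ (t₀ , w , t≃ , ew , w<t)) = inj₂ (t₀ ⊕ s , w , ≃-trans (⊕-cong t≃ ≃-refl) (⊕-swap t₀ w s) , ew , ℕ.≤-trans w<t (ℕ.m≤m+n _ _))

  module _ (G : Graph) (isSalem : SalemGraph G) where

    TypeAForm TypeBForm : Set _
    TypeAForm = ∃[ t ] Rootable G t × Branches-bounded t 2ᴿ
    TypeBForm = ∃[ t ] ∃[ s ] Rootable G (t ⊕ s) × (Branches-bounded t 2ᴿ × Exceeds t 2ᴿ) × (Branches-bounded s 2ᴿ × Exceeds s 2ᴿ)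

    -- Walk from the root into a branch of index > 2 as long as there is one ahead.

    search : ∀ n t s → size s ℕ.≤ n → Rootable G (t ⊕ s) → Exceeds s 2ᴿ → TypeAForm ⊎ TypeBForm
    search zero    t s s≤0 g es = contradiction (0<size s) (ℕ.≤⇒≯ s≤0)
    search (suc n) t s s≤n g es = ahead (bounded-or-splits s)
      where
      behind : Branches-bounded s 2ᴿ → Bounded t 2ᴿ ⊎ Exceeds t 2ᴿ → Branches-bounded t 2ᴿ ⊎ Splits t → TypeAForm ⊎ TypeBForm
      -- With no eigenvalue above 2 behind, the top of s serves as the root and t becomes one more
      -- bounded branch.
      behind bs (inj₁ t≤2) _                                = inj₁ (s ⊕ t , rootable-flip g , bs , t≤2)
      behind bs (inj₂ et) (inj₁ bt)                         = inj₂ (t , s , g , (bt , et) , (bs , es))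
      behind bs (inj₂ et) (inj₂ (t₀ , w , t≃ , ew , _)) =
        ⊥-elim (two-branches t₀ w s (salem⇒one-zero (proj₂ (rootable-≃ (⊕-cong t≃ ≃-refl) g)) isSalem) ew es)
      ahead : Branches-bounded s 2ᴿ ⊎ Splits s → TypeAForm ⊎ TypeBForm
      ahead (inj₁ bs) = behind bs (bounded-or-exceeds t 2ᴿ) (bounded-or-splits t)
      -- The root moves to the top of s: everything behind becomes the branch t there, and the walk
      -- faces the smaller w.
      ahead (inj₂ (s₀ , w , s≃ , ew , w<s)) = search n (s₀ ⊕ t) w (ℕ.≤-pred (ℕ.≤-trans w<s s≤n))
        (rootable-≃ (⊕-swap s₀ w t) (rootable-flip (rootable-≃ (⊕-cong ≃-refl s≃) g))) ew

    salem-form : ∀ t → Rootable G t → TypeAForm ⊎ TypeBForm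
    salem-form t g = Sum.[ (λ bt → inj₁ (t , g , bt)) , (λ (t₀ , s , t≃ , es , _) → search (size s) t₀ s ℕ.≤-refl (rootable-≃ t≃ g) es) ]′ (bounded-or-splits t)

    TypeAResult TypeBResult : Set _
    TypeAResult = ∃[ r ] TypeA (G rootedAt r)
    TypeBResult = ∃[ T₁ ] ∃[ T₂ ] TypeA T₁ × TypeA T₂ × excess T₁ T₂ ≤⁺ [ 1ℚ ] × G ≅ graph (T₁ +ᵀ T₂)

    type-A : TypeAForm → TypeAResult
    type-A (t , (r , ρ) , bt) = r , tree⇒typeA ρ bt exceeds
      where
      exceeds : Exceeds t 2ᴿ
      exceeds = let x , 2<x , Px≈0 , _ = salem⇒one-zero ρ isSalem in x , 2<x , Branches-bounded⇒Positive t bt 2<x , Px≈0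

    type-B : TypeBForm → TypeBResult
    type-B (t , s , (r , ρ) , (bt , et) , (bs , es)) = treeGraph t , treeGraph s , A₁ , A₂ ,
      Sum.[ id , (λ 1<e → ⊥-elim (absurd 1<e)) ]′ (≤⁺-or-<⁺ (excess (treeGraph t) (treeGraph s)) 1ℚ) ,
      same-tree⇒≅ ρ (treeGraph-represents (t ⊕ s))
      where
      A₁ : TypeA (treeGraph t)
      A₁ = tree⇒typeA (treeGraph-represents t) bt et
      A₂ : TypeA (treeGraph s)
      A₂ = tree⇒typeA (treeGraph-represents s) bs es
      absurd : [ 1ℚ ] <⁺ excess (treeGraph t) (treeGraph s) → ⊥
      absurd 1<e =
        let x₁ , x₂ , 2<x₁ , x₁<x₂ , P₁≈0 , P₂≈0 , _ = two-zeros (treeGraph t) (treeGraph s) (typeA⇒tree A₁) (typeA⇒tree A₂) 1<e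
            _ , _ , _ , unique = salem⇒one-zero ρ isSalem
        in <-irrefl (trans (unique x₁ 2<x₁ (on-ρ P₁≈0)) (sym (unique x₂ (<-trans 2<x₁ x₁<x₂) (on-ρ P₂≈0)))) x₁<x₂
        where
        module a = TypeATree (typeA⇒tree A₁)
        module b = TypeATree (typeA⇒tree A₂)
        -- The terms from `typeA⇒tree` may order branches differently from t and s; the zeros agree
        -- because both are the eigenvalues of the same graph.
        on-ρ : ∀ {x} → P (a.tree ⊕ b.tree) x ≈ 0# → P (t ⊕ s) x ≈ 0#
        on-ρ Px≈0 = eigenvalue⇒zero (treeGraph-represents (t ⊕ s)) (zero⇒eigenvalue (represents-+ᵀ (represents a.decomposes) (represents b.decomposes)) Px≈0)

  salem-tree-form : ∀ G → SalemTree G →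
    (∃[ r ] TypeA (G rootedAt r)) ⊎ (∃[ T₁ ] ∃[ T₂ ] TypeA T₁ × TypeA T₂ × excess T₁ T₂ ≤⁺ [ 1ℚ ] × G ≅ graph (T₁ +ᵀ T₂))
  salem-tree-form G (tree , isSalem) =
    let r = IsTree.nonempty tree
        t , d = decompose (G rootedAt r) tree
    in Sum.map (type-A G isSalem) (type-B G isSalem) (salem-form G isSalem t (r , represents d))

theorem16 :
  ∀ {c ℓ₁ ℓ₂} (ℝ : RealClosedField c ℓ₁ ℓ₂) →
  let open Spectra ℝ
      open RootedGraph using (graph)
  in
  (∀ (T : RootedGraph) → IsTree (graph T) → CyclotomicForest (T ′) →
    ([ 2ℚ ] <⁺ νᶠ (T ′) → SalemTree (graph T)) ×
    (νᶠ (T ′) ≤⁺ [ 2ℚ ] → CyclotomicTree (graph T)))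
  ×
  (∀ (T₁ T₂ : RootedGraph) → TypeA T₁ → TypeA T₂ →
    (excess T₁ T₂ ≤⁺ [ 1ℚ ] → SalemTree (graph (T₁ +ᵀ T₂))) ×
    ([ 1ℚ ] <⁺ excess T₁ T₂ → TwoRootsOutsideUnitCircle (R (graph (T₁ +ᵀ T₂)))))
  ×
  (∀ (G : Graph) → SalemTree G →
    (∃[ r ] TypeA (G rootedAt r)) ⊎
    (∃[ T₁ ] ∃[ T₂ ] TypeA T₁ × TypeA T₂ × excess T₁ T₂ ≤⁺ [ 1ℚ ] × G ≅ graph (T₁ +ᵀ T₂)))
theorem16 ℝ =
  (λ T tree forest → 2<ν⇒salem T tree forest , ν≤2⇒cyclotomic T tree forest) ,
  (λ T₁ T₂ A₁ A₂ → joined-salem T₁ T₂ A₁ A₂ , joined-two-roots T₁ T₂ A₁ A₂) ,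
  salem-tree-form
  where open SalemTrees ℝ
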